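{- Let $A=\{a_k\}_{k\in\mathbb{Z}}$ and $B=\{b_k\}_{k\in\mathbb{Z}}$ be sequences of complex numbers, each being $o(k^{c})$ as $k\to\pm\infty$ for some $c<1$. Let $x$ and $y$ be nonzero real numbers with $x\notin\mathbb{Z}$. Then $$\begin{aligned} &\pi^2xy\cot(\pi x;A)\coth(\pi y;B)\\ &=a_0b_0+2a_0D^{(B)}(2)y^2-2b_0D^{(A)}(2)x^2\\ &\quad-2\pi xy\sum_{n=1}^\infty\left\{\frac{x^2a_n\coth(\pi ny/x;B)}{n(n^2-x^2)}+\frac{y^2b_n\coth(\pi nx/y;A)}{n(n^2+y^2)}\right\}. \end{aligned}$$
   Context: Growth conditions $a_k=o(k^c)$ are understood with $|k|^c$ for negative $k$. For a sequence $A=\{a_k\}$ (likewise $B=\{b_k\}$): $D^{(A)}(j):=\sum_{k=1}^\infty\frac{a_k}{k^j}$ for $j>1$. The cotangent function with sequence $A$ is defined by $$\pi\cot(\pi s;A):=\frac{a_0}{s}-2s\sum_{k=1}^\infty\frac{a_k}{k^2-s^2},$$ and the hyperbolic cotangent with sequence $A$ by $\coth(s;A):=i\cot(is;A)$. -}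

module Defs where

open import Data.Nat.Base as ℕ using (ℕ; zero; suc)
import Data.Nat.Properties as ℕₚ
open import Data.Integer.Base as ℤ using (ℤ; +_; -[1+_]; +[1+_]; ∣_∣)
import Data.Integer.Properties as ℤₚ
open import Data.Rational.Base as ℚ using (ℚ; 0ℚ; 1ℚ; ½; ↥_; ↧ₙ_)
import Data.Rational.Properties as ℚₚ
import Data.Rational.Unnormalised.Base as ℚᵘ
import Data.Rational.Unnormalised.Properties as ℚᵘₚ
open import Data.Rational.Solver using (module +-*-Solver)
open import Data.Product.Base using (Σ-syntax; ∃-syntax; _×_; _,_; proj₁; proj₂)
open import Data.Sum.Base using (inj₁; inj₂)
open import Relation.Nullary.Decidable.Core using (yes; no)
open import Relation.Nullary.Negation.Core using (contradiction)
open import Relation.Binary.PropositionalEquality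
  using (_≡_; refl; sym; trans; cong; cong₂; subst)

IsCauchy : (ℕ → ℚ) → Set
IsCauchy s = ∀ ε → 0ℚ ℚ.< ε →
  ∃[ N ] ∀ m n → N ℕ.≤ m → N ℕ.≤ n → ℚ.∣ s m ℚ.- s n ∣ ℚ.≤ ε

module ℚ-Lemmas where

  half : ∀ {ε} → 0ℚ ℚ.< ε → 0ℚ ℚ.< ½ ℚ.* ε
  half {ε} ε>0 = ℚₚ.positive⁻¹ (½ ℚ.* ε)
    {{ℚₚ.pos*pos⇒pos ½ ε {{ℚ.positive ε>0}}}}

  half+half : ∀ ε → ½ ℚ.* ε ℚ.+ ½ ℚ.* ε ≡ ε
  half+half = solve 1 (λ e → con ½ :* e :+ con ½ :* e := e) refl
    where open +-*-Solver

  ∣-∣-sym : ∀ p q → ℚ.∣ p ℚ.- q ∣ ≡ ℚ.∣ q ℚ.- p ∣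
  ∣-∣-sym p q = trans (sym (ℚₚ.∣-p∣≡∣p∣ (p ℚ.- q)))
    (cong ℚ.∣_∣ (solve 2 (λ a b → :- (a :- b) := b :- a) refl p q))
    where open +-*-Solver

  *-mono : ∀ {p q r s} → 0ℚ ℚ.≤ p → 0ℚ ℚ.≤ s → p ℚ.≤ q → r ℚ.≤ s →
           p ℚ.* r ℚ.≤ q ℚ.* s
  *-mono {p} {q} {r} {s} 0≤p 0≤s p≤q r≤s = ℚₚ.≤-trans
    (ℚₚ.*-monoˡ-≤-nonNeg p {{ℚ.nonNegative 0≤p}} r≤s)
    (ℚₚ.*-monoʳ-≤-nonNeg s {{ℚ.nonNegative 0≤s}} p≤q)

  pos* : ∀ {p q} → 0ℚ ℚ.< p → 0ℚ ℚ.< q → 0ℚ ℚ.< p ℚ.* q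
  pos* {p} {q} p>0 q>0 = ℚₚ.positive⁻¹ (p ℚ.* q)
    {{ℚₚ.pos*pos⇒pos p {{ℚ.positive p>0}} q {{ℚ.positive q>0}}}}

  0≤∣_∣ : ∀ p → 0ℚ ℚ.≤ ℚ.∣ p ∣
  0≤∣ p ∣ = ℚₚ.0≤∣p∣ p

  1/pos : ∀ {p} → 0ℚ ℚ.< p → ∃[ q ] 0ℚ ℚ.< q × q ℚ.* p ≡ 1ℚ
  1/pos {p} p>0 =
    ℚ.1/_ p {{nz}} , ℚₚ.positive⁻¹ _ {{ℚₚ.1/pos⇒pos p {{ℚ.positive p>0}}}} ,
    ℚₚ.*-inverseˡ p {{nz}}
    where nz = ℚ.>-nonZero p>0

  near⇒cauchy : (s : ℕ → ℚ) →
    (∀ ε → 0ℚ ℚ.< ε → ∃[ N ] ∀ n → N ℕ.≤ n → ℚ.∣ s n ℚ.- s N ∣ ℚ.≤ ε) →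
    IsCauchy s
  near⇒cauchy s near ε ε>0 with near (½ ℚ.* ε) (half ε>0)
  ... | N , h = N , λ m n N≤m N≤n → begin
    ℚ.∣ s m ℚ.- s n ∣
      ≡⟨ cong ℚ.∣_∣ (solve 3 (λ a b c → a :- b := (a :- c) :+ (c :- b)) refl (s m) (s n) (s N)) ⟩
    ℚ.∣ (s m ℚ.- s N) ℚ.+ (s N ℚ.- s n) ∣
      ≤⟨ ℚₚ.∣p+q∣≤∣p∣+∣q∣ (s m ℚ.- s N) (s N ℚ.- s n) ⟩
    ℚ.∣ s m ℚ.- s N ∣ ℚ.+ ℚ.∣ s N ℚ.- s n ∣
      ≡⟨ cong (ℚ.∣ s m ℚ.- s N ∣ ℚ.+_) (∣-∣-sym (s N) (s n)) ⟩
    ℚ.∣ s m ℚ.- s N ∣ ℚ.+ ℚ.∣ s n ℚ.- s N ∣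
      ≤⟨ ℚₚ.+-mono-≤ (h m N≤m) (h n N≤n) ⟩
    ½ ℚ.* ε ℚ.+ ½ ℚ.* ε
      ≡⟨ half+half ε ⟩
    ε ∎
    where open ℚₚ.≤-Reasoning
          open +-*-Solver

open ℚ-Lemmas

-- A real number is a Cauchy sequence of rationals; equality is the setoid
-- equality _≈ᵣ_.  Proofs of the Cauchy property are kept abstract, since only
-- their types matter.
record ℝ : Set where
  no-eta-equality
  constructor mkℝ
  field
    seq    : ℕ → ℚ
    cauchy : IsCauchy seq

open ℝ public

infix 4 _≈ᵣ_ _≤ᵣ_ _<ᵣ_ _#ᵣ_

_≈ᵣ_ _≤ᵣ_ _<ᵣ_ : ℝ → ℝ → Set
x ≈ᵣ y = ∀ ε → 0ℚ ℚ.< ε → ∃[ N ] ∀ n → N ℕ.≤ n → ℚ.∣ seq x n ℚ.- seq y n ∣ ℚ.≤ ε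
x ≤ᵣ y = ∀ ε → 0ℚ ℚ.< ε → ∃[ N ] ∀ n → N ℕ.≤ n → seq x n ℚ.≤ seq y n ℚ.+ ε
x <ᵣ y = ∃[ ε ] 0ℚ ℚ.< ε × ∃[ N ] ∀ n → N ℕ.≤ n → seq x n ℚ.+ ε ℚ.≤ seq y n

-- Apartness, the constructive form of x ≠ y.
record _#ᵣ_ (x y : ℝ) : Set where
  no-eta-equality
  pattern
  constructor apart
  field
    gap   : ℚ
    gap>0 : 0ℚ ℚ.< gap
    from  : ℕ
    far   : ∀ n → from ℕ.≤ n → gap ℚ.≤ ℚ.∣ seq x n ℚ.- seq y n ∣

abstract
  rat-cauchy : ∀ q → IsCauchy (λ _ → q)
  rat-cauchy q = λ ε ε>0 → 0 , λ _ _ _ _ →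
    subst (ℚ._≤ ε) (sym (cong ℚ.∣_∣ (ℚₚ.+-inverseʳ q))) (ℚₚ.<⇒≤ ε>0)

ratᵣ : ℚ → ℝ
ratᵣ q = mkℝ (λ _ → q) (rat-cauchy q)

intᵣ : ℤ → ℝ
intᵣ k = ratᵣ (k ℚ./ 1)

natᵣ : ℕ → ℝ
natᵣ n = intᵣ (+ n)

0ᵣ 1ᵣ : ℝ
0ᵣ = natᵣ 0
1ᵣ = natᵣ 1

infixl 6 _+ᵣ_ _-ᵣ_
infixl 7 _*ᵣ_ _÷ᵣ_[_]
infix  8 -ᵣ_
infixr 8 _^ᵣ_

abstract
  +-cauchy : ∀ x y → IsCauchy (λ n → seq x n ℚ.+ seq y n)
  +-cauchy x y = λ ε ε>0 →
    let N₁ , h₁ = cauchy x (½ ℚ.* ε) (half ε>0)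
        N₂ , h₂ = cauchy y (½ ℚ.* ε) (half ε>0)
    in N₁ ℕ.⊔ N₂ , λ m n N≤m N≤n → begin
      ℚ.∣ seq x m ℚ.+ seq y m ℚ.- (seq x n ℚ.+ seq y n) ∣
        ≡⟨ cong ℚ.∣_∣ (solve 4 (λ a b c d → a :+ b :- (c :+ d) := (a :- c) :+ (b :- d)) refl
             (seq x m) (seq y m) (seq x n) (seq y n)) ⟩
      ℚ.∣ (seq x m ℚ.- seq x n) ℚ.+ (seq y m ℚ.- seq y n) ∣
        ≤⟨ ℚₚ.∣p+q∣≤∣p∣+∣q∣ (seq x m ℚ.- seq x n) (seq y m ℚ.- seq y n) ⟩
      ℚ.∣ seq x m ℚ.- seq x n ∣ ℚ.+ ℚ.∣ seq y m ℚ.- seq y n ∣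
        ≤⟨ ℚₚ.+-mono-≤
             (h₁ m n (ℕₚ.m⊔n≤o⇒m≤o N₁ N₂ N≤m) (ℕₚ.m⊔n≤o⇒m≤o N₁ N₂ N≤n))
             (h₂ m n (ℕₚ.m⊔n≤o⇒n≤o N₁ N₂ N≤m) (ℕₚ.m⊔n≤o⇒n≤o N₁ N₂ N≤n)) ⟩
      ½ ℚ.* ε ℚ.+ ½ ℚ.* ε
        ≡⟨ half+half ε ⟩
      ε ∎
    where open ℚₚ.≤-Reasoning
          open +-*-Solver

_+ᵣ_ : ℝ → ℝ → ℝ
x +ᵣ y = mkℝ (λ n → seq x n ℚ.+ seq y n) (+-cauchy x y)

abstract
  neg-cauchy : ∀ x → IsCauchy (λ n → ℚ.- seq x n)
  neg-cauchy x = λ ε ε>0 →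
    let N , h = cauchy x ε ε>0
    in N , λ m n N≤m N≤n → subst (ℚ._≤ ε)
         (trans (sym (ℚₚ.∣-p∣≡∣p∣ (seq x m ℚ.- seq x n)))
           (cong ℚ.∣_∣ (solve 2 (λ a b → :- (a :- b) := :- a :- (:- b)) refl (seq x m) (seq x n))))
         (h m n N≤m N≤n)
    where open +-*-Solver

-ᵣ_ : ℝ → ℝ
-ᵣ x = mkℝ (λ n → ℚ.- seq x n) (neg-cauchy x)

_-ᵣ_ : ℝ → ℝ → ℝ
x -ᵣ y = x +ᵣ (-ᵣ y)

module Bounded where

  bounded : (x : ℝ) → ∃[ B ] 0ℚ ℚ.< B × ∃[ N ] ∀ n → N ℕ.≤ n → ℚ.∣ seq x n ∣ ℚ.≤ B
  bounded x with cauchy x 1ℚ (ℚₚ.positive⁻¹ 1ℚ)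
  ... | N , h = 1ℚ ℚ.+ ℚ.∣ seq x N ∣ ,
    ℚₚ.+-mono-<-≤ (ℚₚ.positive⁻¹ 1ℚ) 0≤∣ seq x N ∣ ,
    N , λ n N≤n → begin
      ℚ.∣ seq x n ∣
        ≡⟨ cong ℚ.∣_∣ (solve 2 (λ a b → a := (a :- b) :+ b) refl (seq x n) (seq x N)) ⟩
      ℚ.∣ (seq x n ℚ.- seq x N) ℚ.+ seq x N ∣
        ≤⟨ ℚₚ.∣p+q∣≤∣p∣+∣q∣ (seq x n ℚ.- seq x N) (seq x N) ⟩
      ℚ.∣ seq x n ℚ.- seq x N ∣ ℚ.+ ℚ.∣ seq x N ∣
        ≤⟨ ℚₚ.+-monoˡ-≤ ℚ.∣ seq x N ∣ (h n N N≤n ℕₚ.≤-refl) ⟩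
      1ℚ ℚ.+ ℚ.∣ seq x N ∣ ∎
    where open ℚₚ.≤-Reasoning
          open +-*-Solver

open Bounded

abstract
  *-cauchy : ∀ x y → IsCauchy (λ n → seq x n ℚ.* seq y n)
  *-cauchy x y = λ ε ε>0 →
    let B  , B>0  , M₁ , b₁ = bounded x
        C  , C>0  , M₂ , b₂ = bounded y
        B′ , B′>0 , B′B≡1   = 1/pos B>0
        C′ , C′>0 , C′C≡1   = 1/pos C>0
        N₁ , h₁ = cauchy x (½ ℚ.* ε ℚ.* C′) (pos* (half ε>0) C′>0)
        N₂ , h₂ = cauchy y (½ ℚ.* ε ℚ.* B′) (pos* (half ε>0) B′>0)
        M = M₁ ℕ.⊔ M₂
        N = N₁ ℕ.⊔ N₂
    in M ℕ.⊔ N , λ m n ≤m ≤n →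
      let xm = seq x m ; ym = seq y m ; xn = seq x n ; yn = seq y n
          M≤m = ℕₚ.m⊔n≤o⇒m≤o M N ≤m ; M≤n = ℕₚ.m⊔n≤o⇒m≤o M N ≤n
          N≤m = ℕₚ.m⊔n≤o⇒n≤o M N ≤m ; N≤n = ℕₚ.m⊔n≤o⇒n≤o M N ≤n
      in begin
      ℚ.∣ xm ℚ.* ym ℚ.- xn ℚ.* yn ∣
        ≡⟨ cong ℚ.∣_∣ (solve 4 (λ a b c d → a :* b :- c :* d := a :* (b :- d) :+ (a :- c) :* d)
             refl xm ym xn yn) ⟩
      ℚ.∣ xm ℚ.* (ym ℚ.- yn) ℚ.+ (xm ℚ.- xn) ℚ.* yn ∣
        ≤⟨ ℚₚ.∣p+q∣≤∣p∣+∣q∣ (xm ℚ.* (ym ℚ.- yn)) ((xm ℚ.- xn) ℚ.* yn) ⟩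
      ℚ.∣ xm ℚ.* (ym ℚ.- yn) ∣ ℚ.+ ℚ.∣ (xm ℚ.- xn) ℚ.* yn ∣
        ≡⟨ cong₂ ℚ._+_ (ℚₚ.∣p*q∣≡∣p∣*∣q∣ xm (ym ℚ.- yn)) (ℚₚ.∣p*q∣≡∣p∣*∣q∣ (xm ℚ.- xn) yn) ⟩
      ℚ.∣ xm ∣ ℚ.* ℚ.∣ ym ℚ.- yn ∣ ℚ.+ ℚ.∣ xm ℚ.- xn ∣ ℚ.* ℚ.∣ yn ∣
        ≤⟨ ℚₚ.+-mono-≤
             (*-mono 0≤∣ xm ∣ (ℚₚ.<⇒≤ (pos* (half ε>0) B′>0))
               (b₁ m (ℕₚ.m⊔n≤o⇒m≤o M₁ M₂ M≤m))
               (h₂ m n (ℕₚ.m⊔n≤o⇒n≤o N₁ N₂ N≤m) (ℕₚ.m⊔n≤o⇒n≤o N₁ N₂ N≤n)))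
             (*-mono 0≤∣ xm ℚ.- xn ∣ (ℚₚ.<⇒≤ C>0)
               (h₁ m n (ℕₚ.m⊔n≤o⇒m≤o N₁ N₂ N≤m) (ℕₚ.m⊔n≤o⇒m≤o N₁ N₂ N≤n))
               (b₂ n (ℕₚ.m⊔n≤o⇒n≤o M₁ M₂ M≤n))) ⟩
      B ℚ.* (½ ℚ.* ε ℚ.* B′) ℚ.+ ½ ℚ.* ε ℚ.* C′ ℚ.* C
        ≡⟨ solve 5 (λ b b′ c c′ e → b :* (e :* b′) :+ e :* c′ :* c := b′ :* b :* e :+ c′ :* c :* e)
             refl B B′ C C′ (½ ℚ.* ε) ⟩
      B′ ℚ.* B ℚ.* (½ ℚ.* ε) ℚ.+ C′ ℚ.* C ℚ.* (½ ℚ.* ε)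
        ≡⟨ cong₂ (λ p q → p ℚ.* (½ ℚ.* ε) ℚ.+ q ℚ.* (½ ℚ.* ε)) B′B≡1 C′C≡1 ⟩
      1ℚ ℚ.* (½ ℚ.* ε) ℚ.+ 1ℚ ℚ.* (½ ℚ.* ε)
        ≡⟨ cong₂ ℚ._+_ (ℚₚ.*-identityˡ (½ ℚ.* ε)) (ℚₚ.*-identityˡ (½ ℚ.* ε)) ⟩
      ½ ℚ.* ε ℚ.+ ½ ℚ.* ε
        ≡⟨ half+half ε ⟩
      ε ∎
    where open ℚₚ.≤-Reasoning
          open +-*-Solver

_*ᵣ_ : ℝ → ℝ → ℝ
x *ᵣ y = mkℝ (λ n → seq x n ℚ.* seq y n) (*-cauchy x y)

_^ᵣ_ : ℝ → ℕ → ℝ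
x ^ᵣ zero  = 1ᵣ
x ^ᵣ suc n = x *ᵣ x ^ᵣ n

-- The junk value inv 0 = 0 only affects finitely many terms of the inverse of
-- a real number apart from 0.
inv : ℚ → ℚ
inv q with q ℚₚ.≟ 0ℚ
... | yes _   = 0ℚ
... | no  q≢0 = ℚ.1/_ q {{ℚ.≢-nonZero q≢0}}

inv-inverseˡ : ∀ {q} → 0ℚ ℚ.< ℚ.∣ q ∣ → inv q ℚ.* q ≡ 1ℚ
inv-inverseˡ {q} ∣q∣>0 with q ℚₚ.≟ 0ℚ
... | yes refl = contradiction ∣q∣>0 (ℚₚ.<-irrefl refl)
... | no  q≢0  = ℚₚ.*-inverseˡ q {{ℚ.≢-nonZero q≢0}}

module Inverse where

  ∣-0∣ : ∀ q → ℚ.∣ q ℚ.- 0ℚ ∣ ≡ ℚ.∣ q ∣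
  ∣-0∣ q = cong ℚ.∣_∣ (ℚₚ.+-identityʳ q)

  inv-bound : ∀ {q δ δ′} → 0ℚ ℚ.< δ → 0ℚ ℚ.< δ′ → δ′ ℚ.* δ ≡ 1ℚ →
              δ ℚ.≤ ℚ.∣ q ∣ → ℚ.∣ inv q ∣ ℚ.≤ δ′
  inv-bound {q} {δ} {δ′} δ>0 δ′>0 δ′δ≡1 δ≤q = begin
    ℚ.∣ inv q ∣                                ≡⟨ ℚₚ.*-identityʳ ℚ.∣ inv q ∣ ⟨
    ℚ.∣ inv q ∣ ℚ.* 1ℚ                         ≡⟨ cong (ℚ.∣ inv q ∣ ℚ.*_) δ′δ≡1 ⟨
    ℚ.∣ inv q ∣ ℚ.* (δ′ ℚ.* δ)                 ≤⟨ *-mono 0≤∣ inv q ∣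
                                                   (ℚₚ.≤-trans (ℚₚ.<⇒≤ (pos* δ′>0 δ>0)) (ℚₚ.*-monoˡ-≤-nonNeg δ′ {{δ′≥0}} δ≤q))
                                                   ℚₚ.≤-refl
                                                   (ℚₚ.*-monoˡ-≤-nonNeg δ′ {{δ′≥0}} δ≤q) ⟩
    ℚ.∣ inv q ∣ ℚ.* (δ′ ℚ.* ℚ.∣ q ∣)           ≡⟨ solve 3 (λ a b c → a :* (b :* c) := b :* (a :* c)) refl ℚ.∣ inv q ∣ δ′ ℚ.∣ q ∣ ⟩
    δ′ ℚ.* (ℚ.∣ inv q ∣ ℚ.* ℚ.∣ q ∣)           ≡⟨ cong (δ′ ℚ.*_) (ℚₚ.∣p*q∣≡∣p∣*∣q∣ (inv q) q) ⟨
    δ′ ℚ.* ℚ.∣ inv q ℚ.* q ∣                   ≡⟨ cong (λ t → δ′ ℚ.* ℚ.∣ t ∣) (inv-inverseˡ {q} (ℚₚ.<-≤-trans δ>0 δ≤q)) ⟩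
    δ′ ℚ.* 1ℚ                                  ≡⟨ ℚₚ.*-identityʳ δ′ ⟩
    δ′ ∎
    where open ℚₚ.≤-Reasoning
          open +-*-Solver
          δ′≥0 = ℚ.nonNegative (ℚₚ.<⇒≤ δ′>0)

open Inverse

abstract
  recip-cauchy : ∀ x → x #ᵣ 0ᵣ → IsCauchy (λ n → inv (seq x n))
  recip-cauchy x (apart δ δ>0 M far) = λ ε ε>0 →
    let δ′ , δ′>0 , δ′δ≡1 = 1/pos δ>0
        N , h = cauchy x (ε ℚ.* (δ ℚ.* δ)) (pos* ε>0 (pos* δ>0 δ>0))
    in M ℕ.⊔ N , λ m n ≤m ≤n →
      let a = seq x m ; b = seq x n ; a′ = inv a ; b′ = inv b
          δ≤a = subst (δ ℚ.≤_) (∣-0∣ a) (far m (ℕₚ.m⊔n≤o⇒m≤o M N ≤m))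
          δ≤b = subst (δ ℚ.≤_) (∣-0∣ b) (far n (ℕₚ.m⊔n≤o⇒m≤o M N ≤n))
          δ′≥0 = ℚₚ.<⇒≤ δ′>0
      in begin
      ℚ.∣ a′ ℚ.- b′ ∣
        ≡⟨ cong ℚ.∣_∣ (cong₂ ℚ._-_
             (trans (sym (ℚₚ.*-identityʳ a′)) (cong (a′ ℚ.*_) (sym (inv-inverseˡ {b} (ℚₚ.<-≤-trans δ>0 δ≤b)))))
             (trans (sym (ℚₚ.*-identityʳ b′)) (cong (b′ ℚ.*_) (sym (inv-inverseˡ {a} (ℚₚ.<-≤-trans δ>0 δ≤a)))))) ⟩
      ℚ.∣ a′ ℚ.* (b′ ℚ.* b) ℚ.- b′ ℚ.* (a′ ℚ.* a) ∣
        ≡⟨ cong ℚ.∣_∣ (solve 4 (λ a b a′ b′ → a′ :* (b′ :* b) :- b′ :* (a′ :* a) := (b :- a) :* (a′ :* b′))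
             refl a b a′ b′) ⟩
      ℚ.∣ (b ℚ.- a) ℚ.* (a′ ℚ.* b′) ∣
        ≡⟨ trans (ℚₚ.∣p*q∣≡∣p∣*∣q∣ (b ℚ.- a) (a′ ℚ.* b′))
             (cong (ℚ.∣ b ℚ.- a ∣ ℚ.*_) (ℚₚ.∣p*q∣≡∣p∣*∣q∣ a′ b′)) ⟩
      ℚ.∣ b ℚ.- a ∣ ℚ.* (ℚ.∣ a′ ∣ ℚ.* ℚ.∣ b′ ∣)
        ≤⟨ *-mono 0≤∣ b ℚ.- a ∣ (ℚₚ.<⇒≤ (pos* δ′>0 δ′>0))
             (h n m (ℕₚ.m⊔n≤o⇒n≤o M N ≤n) (ℕₚ.m⊔n≤o⇒n≤o M N ≤m))
             (*-mono 0≤∣ a′ ∣ δ′≥0 (inv-bound {a} δ>0 δ′>0 δ′δ≡1 δ≤a) (inv-bound {b} δ>0 δ′>0 δ′δ≡1 δ≤b)) ⟩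
      ε ℚ.* (δ ℚ.* δ) ℚ.* (δ′ ℚ.* δ′)
        ≡⟨ solve 3 (λ e d d′ → e :* (d :* d) :* (d′ :* d′) := e :* (d′ :* d) :* (d′ :* d)) refl ε δ δ′ ⟩
      ε ℚ.* (δ′ ℚ.* δ) ℚ.* (δ′ ℚ.* δ)
        ≡⟨ cong (λ t → ε ℚ.* t ℚ.* t) δ′δ≡1 ⟩
      ε ℚ.* 1ℚ ℚ.* 1ℚ
        ≡⟨ trans (ℚₚ.*-identityʳ (ε ℚ.* 1ℚ)) (ℚₚ.*-identityʳ ε) ⟩
      ε ∎
    where open ℚₚ.≤-Reasoning
          open +-*-Solver

recip : (x : ℝ) → x #ᵣ 0ᵣ → ℝ
recip x x#0 = mkℝ (λ n → inv (seq x n)) (recip-cauchy x x#0)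

_÷ᵣ_[_] : ℝ → (y : ℝ) → y #ᵣ 0ᵣ → ℝ
x ÷ᵣ y [ y#0 ] = x *ᵣ recip y y#0

-- π = 4 (1 - 1/3 + 1/5 - ⋯)
leibnizTerm : ℕ → ℚ
leibnizTerm n = + 4 ℚ./ suc (2 ℕ.* n)

sign : ℕ → ℚ
sign zero    = 1ℚ
sign (suc n) = ℚ.- sign n

alternatingSum : (ℕ → ℚ) → ℕ → ℚ
alternatingSum a zero    = 0ℚ
alternatingSum a (suc n) = alternatingSum a n ℚ.+ sign n ℚ.* a n

module Leibniz where

  /-mono : ∀ p q d e → p ℤ.* + suc e ℤ.≤ q ℤ.* + suc d → p ℚ./ suc d ℚ.≤ q ℚ./ suc e
  /-mono p q d e h = ℚₚ.toℚᵘ-cancel-≤ (begin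
    ℚ.toℚᵘ (p ℚ./ suc d)  ≃⟨ ℚₚ.toℚᵘ-fromℚᵘ (ℚᵘ.mkℚᵘ p d) ⟩
    ℚᵘ.mkℚᵘ p d           ≤⟨ ℚᵘ.*≤* h ⟩
    ℚᵘ.mkℚᵘ q e           ≃⟨ ℚₚ.toℚᵘ-fromℚᵘ (ℚᵘ.mkℚᵘ q e) ⟨
    ℚ.toℚᵘ (q ℚ./ suc e)  ∎)
    where open ℚᵘₚ.≤-Reasoning

  term-anti : ∀ n → leibnizTerm (suc n) ℚ.≤ leibnizTerm n
  term-anti n = /-mono (+ 4) (+ 4) (2 ℕ.* suc n) (2 ℕ.* n)
    (ℤₚ.*-monoˡ-≤-nonNeg (+ 4) (ℤ.+≤+ (ℕ.s≤s (ℕₚ.*-monoʳ-≤ 2 (ℕₚ.n≤1+n n)))))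

  term-nonneg : ∀ n → 0ℚ ℚ.≤ leibnizTerm n
  term-nonneg n = ℚₚ.nonNegative⁻¹ _ {{ℚₚ.normalize-nonNeg 4 (suc (2 ℕ.* n))}}

  term-small : ∀ ε → 0ℚ ℚ.< ε → ∃[ N ] leibnizTerm N ℚ.≤ ε
  term-small ε@(ℚ.mkℚ +[1+ p ] d _) ε>0 = 2 ℕ.* suc d , subst (leibnizTerm (2 ℕ.* suc d) ℚ.≤_)
    (ℚₚ.fromℚᵘ-toℚᵘ ε)
    (/-mono (+ 4) +[1+ p ] (2 ℕ.* (2 ℕ.* suc d)) d (ℤ.+≤+ (begin
      4 ℕ.* suc d                       ≡⟨ ℕₚ.*-assoc 2 2 (suc d) ⟩
      2 ℕ.* (2 ℕ.* suc d)               ≤⟨ ℕₚ.n≤1+n _ ⟩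
      suc (2 ℕ.* (2 ℕ.* suc d))         ≤⟨ ℕₚ.m≤n*m _ (suc p) ⟩
      suc p ℕ.* suc (2 ℕ.* (2 ℕ.* suc d)) ∎)))
    where open ℕₚ.≤-Reasoning
  term-small (ℚ.mkℚ (+ 0) _ _)    (ℚ.*<* (ℤ.+<+ ()))
  term-small (ℚ.mkℚ -[1+ _ ] _ _) (ℚ.*<* ())

  p-q≤p : ∀ {p q} → 0ℚ ℚ.≤ q → p ℚ.- q ℚ.≤ p
  p-q≤p {p} {q} 0≤q = subst (p ℚ.- q ℚ.≤_) (ℚₚ.+-identityʳ p)
    (ℚₚ.+-monoʳ-≤ p (ℚₚ.neg-antimono-≤ 0≤q))

  p≤q⇒0≤q-p : ∀ {p q} → p ℚ.≤ q → 0ℚ ℚ.≤ q ℚ.- p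
  p≤q⇒0≤q-p {p} {q} p≤q = subst (ℚ._≤ q ℚ.- p) (ℚₚ.+-inverseʳ p)
    (ℚₚ.+-monoˡ-≤ (ℚ.- p) p≤q)

  ∣sign∣ : ∀ n → ℚ.∣ sign n ∣ ≡ 1ℚ
  ∣sign∣ zero    = refl
  ∣sign∣ (suc n) = trans (ℚₚ.∣-p∣≡∣p∣ (sign n)) (∣sign∣ n)

  module Alternating (a : ℕ → ℚ) (a-nonneg : ∀ n → 0ℚ ℚ.≤ a n)
                     (a-anti : ∀ n → a (suc n) ℚ.≤ a n) where

    tail : ℕ → ℕ → ℚ
    tail zero    n = 0ℚ
    tail (suc m) n = a n ℚ.- tail m (suc n)

    tail-bounds : ∀ m n → 0ℚ ℚ.≤ tail m n × tail m n ℚ.≤ a n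
    tail-bounds zero    n = ℚₚ.≤-refl , a-nonneg n
    tail-bounds (suc m) n with tail-bounds m (suc n)
    ... | 0≤t , t≤a = p≤q⇒0≤q-p (ℚₚ.≤-trans t≤a (a-anti n)) , p-q≤p 0≤t

    sum-tail : ∀ m n →
      alternatingSum a (m ℕ.+ n) ≡ alternatingSum a n ℚ.+ sign n ℚ.* tail m n
    sum-tail zero    n =
      solve 2 (λ s g → s := s :+ g :* con 0ℚ) refl (alternatingSum a n) (sign n)
      where open +-*-Solver
    sum-tail (suc m) n = trans (cong (alternatingSum a) (sym (ℕₚ.+-suc m n)))
      (trans (sum-tail m (suc n))
        (solve 4 (λ s g a t → s :+ g :* a :+ (:- g) :* t := s :+ g :* (a :- t)) refl
          (alternatingSum a n) (sign n) (a n) (tail m (suc n))))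
      where open +-*-Solver

    sum-near : ∀ m n → ℚ.∣ alternatingSum a (m ℕ.+ n) ℚ.- alternatingSum a n ∣ ℚ.≤ a n
    sum-near m n = begin
      ℚ.∣ alternatingSum a (m ℕ.+ n) ℚ.- alternatingSum a n ∣
        ≡⟨ cong (λ t → ℚ.∣ t ℚ.- alternatingSum a n ∣) (sum-tail m n) ⟩
      ℚ.∣ alternatingSum a n ℚ.+ sign n ℚ.* tail m n ℚ.- alternatingSum a n ∣
        ≡⟨ cong ℚ.∣_∣ (solve 2 (λ s u → s :+ u :- s := u) refl
             (alternatingSum a n) (sign n ℚ.* tail m n)) ⟩
      ℚ.∣ sign n ℚ.* tail m n ∣
        ≡⟨ ℚₚ.∣p*q∣≡∣p∣*∣q∣ (sign n) (tail m n) ⟩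
      ℚ.∣ sign n ∣ ℚ.* ℚ.∣ tail m n ∣
        ≡⟨ cong₂ ℚ._*_ (∣sign∣ n) (ℚₚ.0≤p⇒∣p∣≡p (proj₁ (tail-bounds m n))) ⟩
      1ℚ ℚ.* tail m n
        ≡⟨ ℚₚ.*-identityˡ (tail m n) ⟩
      tail m n
        ≤⟨ proj₂ (tail-bounds m n) ⟩
      a n ∎
      where open ℚₚ.≤-Reasoning
            open +-*-Solver

    alternating-cauchy : (∀ ε → 0ℚ ℚ.< ε → ∃[ N ] a N ℚ.≤ ε) →
      IsCauchy (alternatingSum a)
    alternating-cauchy a-small = near⇒cauchy (alternatingSum a) λ ε ε>0 →
      let N , small = a-small ε ε>0
      in N , λ n N≤n → ℚₚ.≤-trans
           (subst (λ k → ℚ.∣ alternatingSum a k ℚ.- alternatingSum a N ∣ ℚ.≤ a N)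
             (ℕₚ.m∸n+n≡m N≤n) (sum-near (n ℕ.∸ N) N))
           small

open Leibniz

abstract
  leibniz-cauchy : IsCauchy (alternatingSum leibnizTerm)
  leibniz-cauchy =
    Alternating.alternating-cauchy leibnizTerm term-nonneg term-anti term-small

πᵣ : ℝ
πᵣ = mkℝ (alternatingSum leibnizTerm) leibniz-cauchy

infix 4 _≈_ _#0

record ℂ : Set where
  constructor _+i_
  field
    re im : ℝ

open ℂ public

_≈_ : ℂ → ℂ → Set
z ≈ w = (re z ≈ᵣ re w) × (im z ≈ᵣ im w)

real : ℝ → ℂ
real x = x +i 0ᵣ

nat : ℕ → ℂ
nat n = real (natᵣ n)

𝕚 : ℂ
𝕚 = 0ᵣ +i 1ᵣ

π : ℂ
π = real πᵣ

infixl 6 _+_ _-_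
infixl 7 _*_ _÷_[_]
infix  8 -_
infixr 8 _^_

_+_ _-_ _*_ : ℂ → ℂ → ℂ
z + w = (re z +ᵣ re w) +i (im z +ᵣ im w)
z - w = (re z -ᵣ re w) +i (im z -ᵣ im w)
z * w = (re z *ᵣ re w -ᵣ im z *ᵣ im w) +i (re z *ᵣ im w +ᵣ im z *ᵣ re w)

-_ : ℂ → ℂ
- z = (-ᵣ re z) +i (-ᵣ im z)

_^_ : ℂ → ℕ → ℂ
z ^ zero  = nat 1
z ^ suc n = z * z ^ n

normSq : ℂ → ℝ
normSq z = re z *ᵣ re z +ᵣ im z *ᵣ im z

_#0 : ℂ → Set
z #0 = normSq z #ᵣ 0ᵣ

-- z / w = z · w̄ / |w|²
_÷_[_] : ℂ → (w : ℂ) → w #0 → ℂ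
z ÷ w [ w#0 ] = z * (re w +i (-ᵣ im w)) * real (recip (normSq w) w#0)

-- |z| ≤ r, with the square root in |z| cleared.
∣_∣≤_ : ℂ → ℝ → Set
∣ z ∣≤ r = (0ᵣ ≤ᵣ r) × (normSq z ≤ᵣ r *ᵣ r)

partialSum : (ℕ → ℂ) → ℕ → ℂ
partialSum f zero    = nat 0
partialSum f (suc n) = partialSum f n + f n

-- The series f 0 + f 1 + ⋯ converges to S.
HasSum : (ℕ → ℂ) → ℂ → Set
HasSum f S = ∀ ε → 0ℚ ℚ.< ε →
  ∃[ N ] ∀ n → N ℕ.≤ n → ∣ partialSum f n - S ∣≤ ratᵣ ε

_^ℤ_ : (b : ℕ) .{{_ : ℕ.NonZero b}} → ℤ → ℚ
b ^ℤ (+ n)    = + (b ℕ.^ n) ℚ./ 1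
b ^ℤ -[1+ n ] = ℚ._/_ (+ 1) (b ℕ.^ suc n) {{ℕₚ.m^n≢0 b (suc n)}}

-- v = b ^ c for an integer b ≥ 1 and a real exponent c: the number v is
-- nonnegative and b^r ≤ v ≤ b^t for all rationals r ≤ c ≤ t, where the
-- comparison with b^(p/q) is raised to the power q.
record IsPow (b : ℕ) .{{_ : ℕ.NonZero b}} (c v : ℝ) : Set where
  field
    nonneg : 0ᵣ ≤ᵣ v
    lower  : ∀ r → ratᵣ r ≤ᵣ c → ratᵣ (b ^ℤ (↥ r)) ≤ᵣ v ^ᵣ (↧ₙ r)
    upper  : ∀ t → c ≤ᵣ ratᵣ t → v ^ᵣ (↧ₙ t) ≤ᵣ ratᵣ (b ^ℤ (↥ t))

-- a_k = o(|k|^c) as k → ±∞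
IsLittleO : (ℤ → ℂ) → ℝ → Set
IsLittleO A c = ∀ ε → 0ℚ ℚ.< ε →
  ∃[ K ] ∀ k .{{_ : ℤ.NonZero k}} → K ℕ.≤ ∣ k ∣ →
  ∃[ v ] IsPow ∣ k ∣ c v × ∣ A k ∣≤ (ratᵣ ε *ᵣ v)

SublinearGrowth : (ℤ → ℂ) → Set
SublinearGrowth A = ∃[ c ] (c <ᵣ 1ᵣ) × IsLittleO A c

module Apartness where

  #0-ext : ∀ {x y} → (∀ n → seq x n ≡ seq y n) → x #ᵣ 0ᵣ → y #ᵣ 0ᵣ
  #0-ext x≡y (apart ε ε>0 N h) = apart ε ε>0 N λ n N≤n →
    subst (λ q → ε ℚ.≤ ℚ.∣ q ℚ.- 0ℚ ∣) (x≡y n) (h n N≤n)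

  -#0 : ∀ {x y} → x #ᵣ y → (x -ᵣ y) #ᵣ 0ᵣ
  -#0 {x} {y} (apart ε ε>0 N h) = apart ε ε>0 N λ n N≤n →
    subst (ε ℚ.≤_) (sym (∣-0∣ (seq x n ℚ.- seq y n))) (h n N≤n)

  *#0 : ∀ {x y} → x #ᵣ 0ᵣ → y #ᵣ 0ᵣ → (x *ᵣ y) #ᵣ 0ᵣ
  *#0 {x} {y} (apart ε ε>0 N h) (apart δ δ>0 M g) =
    apart (ε ℚ.* δ) (pos* ε>0 δ>0) (N ℕ.⊔ M) λ n ≤n → subst (ε ℚ.* δ ℚ.≤_)
      (trans (sym (ℚₚ.∣p*q∣≡∣p∣*∣q∣ (seq x n) (seq y n))) (sym (∣-0∣ _)))
      (*-mono (ℚₚ.<⇒≤ ε>0) 0≤∣ seq y n ∣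
        (subst (ε ℚ.≤_) (∣-0∣ (seq x n)) (h n (ℕₚ.m⊔n≤o⇒m≤o N M ≤n)))
        (subst (δ ℚ.≤_) (∣-0∣ (seq y n)) (g n (ℕₚ.m⊔n≤o⇒n≤o N M ≤n))))

  0≤q*q : ∀ q → 0ℚ ℚ.≤ q ℚ.* q
  0≤q*q q with ℚₚ.≤-total 0ℚ q
  ... | inj₁ 0≤q = *-mono ℚₚ.≤-refl 0≤q 0≤q 0≤q
  ... | inj₂ q≤0 = subst (0ℚ ℚ.≤_) (solve 1 (λ a → (:- a) :* (:- a) := a :* a) refl q)
      (*-mono ℚₚ.≤-refl 0≤-q 0≤-q 0≤-q)
    where open +-*-Solver
          0≤-q = ℚₚ.neg-antimono-≤ q≤0

  1≤nat : ∀ n → 1ℚ ℚ.≤ + suc n ℚ./ 1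
  1≤nat n = /-mono (+ 1) (+ suc n) 0 0 (ℤ.+≤+ (ℕ.s≤s ℕ.z≤n))

  -- the squares are written the way _^ᵣ_ computes on terms of the sequences
  difference-of-squares : ∀ a b →
    ℚ.- 1ℚ ℚ.* ((b ℚ.- a) ℚ.* (b ℚ.- (ℚ.- a))) ≡ a ℚ.* (a ℚ.* 1ℚ) ℚ.- b ℚ.* (b ℚ.* 1ℚ)
  difference-of-squares = solve 2 (λ a b →
    con (ℚ.- 1ℚ) :* ((b :- a) :* (b :- (:- a))) := a :* (a :* con 1ℚ) :- b :* (b :* con 1ℚ)) refl
    where open +-*-Solver

  1≤sum-of-squares : ∀ a b → 1ℚ ℚ.≤ a → 1ℚ ℚ.≤ a ℚ.* (a ℚ.* 1ℚ) ℚ.+ b ℚ.* (b ℚ.* 1ℚ)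
  1≤sum-of-squares a b 1≤a = begin
    1ℚ                  ≤⟨ *-mono 0≤1 (ℚₚ.≤-trans 0≤1 1≤a) 1≤a 1≤a ⟩
    a ℚ.* a             ≡⟨ ℚₚ.+-identityʳ (a ℚ.* a) ⟨
    a ℚ.* a ℚ.+ 0ℚ      ≤⟨ ℚₚ.+-monoʳ-≤ (a ℚ.* a) (0≤q*q b) ⟩
    a ℚ.* a ℚ.+ b ℚ.* b
      ≡⟨ cong₂ (λ p q → a ℚ.* p ℚ.+ b ℚ.* q) (ℚₚ.*-identityʳ a) (ℚₚ.*-identityʳ b) ⟨
    a ℚ.* (a ℚ.* 1ℚ) ℚ.+ b ℚ.* (b ℚ.* 1ℚ) ∎
    where open ℚₚ.≤-Reasoning
          0≤1 = ℚₚ.nonNegative⁻¹ 1ℚ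

  1≤⇒1≤∣-0∣ : ∀ {q} → 1ℚ ℚ.≤ q → 1ℚ ℚ.≤ ℚ.∣ q ℚ.- 0ℚ ∣
  1≤⇒1≤∣-0∣ {q} 1≤q = subst (1ℚ ℚ.≤_)
    (sym (trans (∣-0∣ q) (ℚₚ.0≤p⇒∣p∣≡p (ℚₚ.≤-trans (ℚₚ.nonNegative⁻¹ 1ℚ) 1≤q)))) 1≤q

  a[a²-x²]#0 : ∀ a x → a #ᵣ 0ᵣ → x #ᵣ a → x #ᵣ (-ᵣ a) → (a *ᵣ (a ^ᵣ 2 -ᵣ x ^ᵣ 2)) #ᵣ 0ᵣ
  a[a²-x²]#0 a x a#0 x#a x#-a = *#0 {a} {a ^ᵣ 2 -ᵣ x ^ᵣ 2} a#0
    (#0-ext {(-ᵣ 1ᵣ) *ᵣ ((x -ᵣ a) *ᵣ (x -ᵣ (-ᵣ a)))} {a ^ᵣ 2 -ᵣ x ^ᵣ 2}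
      (λ m → difference-of-squares (seq a m) (seq x m))
      (*#0 { -ᵣ 1ᵣ} {(x -ᵣ a) *ᵣ (x -ᵣ (-ᵣ a))} (apart 1ℚ (ℚₚ.positive⁻¹ 1ℚ) 0 λ _ _ → ℚₚ.≤-refl)
        (*#0 {x -ᵣ a} {x -ᵣ (-ᵣ a)} (-#0 {x} {a} x#a) (-#0 {x} { -ᵣ a} x#-a))))

  a[a²+y²]#0 : ∀ a y → (∀ m → 1ℚ ℚ.≤ seq a m) → a #ᵣ 0ᵣ → (a *ᵣ (a ^ᵣ 2 +ᵣ y ^ᵣ 2)) #ᵣ 0ᵣ
  a[a²+y²]#0 a y 1≤a a#0 = *#0 {a} {a ^ᵣ 2 +ᵣ y ^ᵣ 2} a#0
    (apart 1ℚ (ℚₚ.positive⁻¹ 1ℚ) 0 λ m _ →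
      1≤⇒1≤∣-0∣ (1≤sum-of-squares (seq a m) (seq y m) (1≤a m)))

  #-int : ∀ {x} n → x #ᵣ intᵣ -[1+ n ] → x #ᵣ (-ᵣ natᵣ (suc n))
  #-int n (apart ε ε>0 N h) = apart ε ε>0 N h

open Apartness

abstract

  nat#0 : ∀ n → natᵣ (suc n) #ᵣ 0ᵣ
  nat#0 n = apart 1ℚ (ℚₚ.positive⁻¹ 1ℚ) 0 λ _ _ → 1≤⇒1≤∣-0∣ (1≤nat n)

  real#0 : ∀ x → x #ᵣ 0ᵣ → real x #0
  real#0 x x#0 = #0-ext {x *ᵣ x} {normSq (real x)}
    (λ n → solve 1 (λ a → a :* a := a :* a :+ con 0ℚ :* con 0ℚ) refl (seq x n))
    (*#0 {x} {x} x#0 x#0)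
    where open +-*-Solver

  pow#0 : ∀ n j → (natᵣ (suc n) ^ᵣ j) #ᵣ 0ᵣ
  pow#0 n zero    = nat#0 0
  pow#0 n (suc j) = *#0 {natᵣ (suc n)} {natᵣ (suc n) ^ᵣ j} (nat#0 n) (pow#0 n j)

  n[n²-x²]#0 : ∀ x → (∀ k → x #ᵣ intᵣ k) → ∀ n →
    (natᵣ (suc n) *ᵣ (natᵣ (suc n) ^ᵣ 2 -ᵣ x ^ᵣ 2)) #ᵣ 0ᵣ
  n[n²-x²]#0 x x∉ℤ n =
    a[a²-x²]#0 (natᵣ (suc n)) x (nat#0 n) (x∉ℤ (+ suc n)) (#-int n (x∉ℤ -[1+ n ]))

  n[n²+y²]#0 : ∀ y n → (natᵣ (suc n) *ᵣ (natᵣ (suc n) ^ᵣ 2 +ᵣ y ^ᵣ 2)) #ᵣ 0ᵣ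
  n[n²+y²]#0 y n = a[a²+y²]#0 (natᵣ (suc n)) y (λ _ → 1≤nat n) (nat#0 n)

-- Infinite series are not total operations, so D^(A), cot and coth are given by
-- their graphs.  Series over k ≥ 1 are indexed by k - 1.

-- v = D^(A)(j)
IsD : (ℤ → ℂ) → ℕ → ℂ → Set
IsD A j v = HasSum
  (λ k → A (+ suc k) ÷ real (natᵣ (suc k) ^ᵣ j) [ real#0 (natᵣ (suc k) ^ᵣ j) (pow#0 k j) ]) v

-- v = cot(z; A), where z = π s and
-- π cot(π s; A) = a₀ / s - 2 s Σ_{k ≥ 1} a_k / (k² - s²).
IsCot : (ℤ → ℂ) → ℂ → ℂ → Set
IsCot A z v =
  Σ[ s ∈ ℂ ] π * s ≈ z ×
  Σ[ s#0 ∈ s #0 ]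
  Σ[ k²-s²#0 ∈ (∀ k → nat (suc k) ^ 2 - s ^ 2 #0) ]
  Σ[ S ∈ ℂ ] HasSum (λ k → A (+ suc k) ÷ (nat (suc k) ^ 2 - s ^ 2) [ k²-s²#0 k ]) S ×
  π * v ≈ A (+ 0) ÷ s [ s#0 ] - nat 2 * s * S

-- v = coth(z; A) = i cot(i z; A)
IsCoth : (ℤ → ℂ) → ℂ → ℂ → Set
IsCoth A z v = ∃[ w ] IsCot A (𝕚 * z) w × v ≈ 𝕚 * w

{-# OPTIONS --safe #-}

-- Write p_n = 1/(n² - x²) and q_m = 1/(m² + y²).  Unfolding the definitions, π x cot(π x; A) and
-- π y coth(π y; B) are a₀ - 2 x² Σ a_n p_n and b₀ + 2 y² Σ b_m q_m, and the left-hand side is their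
-- product.  The two kinds of terms on the right come from the partial fraction decomposition
--   p_n q_m = x² p_n / (m² x² + n² y²) + y² q_m / (m² x² + n² y²),
-- whose first summand is summed over m first (giving the values of coth( · ; B)) and whose second
-- summand is summed over n first (giving those of coth( · ; A)).  The interchange is justified since
-- both summands are dominated by |a_n| |b_m| / (n² m²), up to a constant.  Finally Σ |a_n| / n²
-- converges: if c ≤ d/(d+1) then |a_n| / n ≤ n^(-1/(d+1)) for large n, which is at most 2^(-i) as
-- soon as n ≥ Q^i with Q = 2^(d+1), so the indices from Q^i to Q^(i+1) contribute at most Q / 2^i.
module Submission where

-- The decomposition accounts only for the product of the two series. Each value of `coth` also
-- carries a polar term, b₀/s or a₀/s. Up to the common factor 1/(π x y), these contribute b₀ x² a_n
-- (p_n - 1/n²) and a₀ y² b_n (1/n² - q_n) to the general term. Their sums turn the two D-terms on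
-- the right into the mixed products of b₀ with Σ a_n p_n and of a₀ with Σ b_m q_m that the
-- left-hand side contains.
--
-- The setting is constructive: order and equality of reals are undecidable, division takes a proof
-- of apartness, and every sum has to be exhibited. Divisions are therefore traded for
-- multiplications by given inverses, so that all algebra takes place in a commutative ring. Sizes
-- are rational numbers that bound the Cauchy sequences at all late indices, so that convergence
-- reduces to summable sequences of rationals, and completeness supplies the sums.

open import Algebra.Bundles using (CommutativeRing)
import Algebra.Solver.Ring
open import Algebra.Solver.Ring.AlmostCommutativeRing
  using (fromCommutativeRing; _-Raw-AlmostCommutative⟶_)
open import Data.Integer.Base as ℤ using (ℤ; +_; -[1+_])
import Data.Integer.Properties as ℤₚ
open import Data.Maybe.Base using (just; nothing)
open import Data.Nat.Base as ℕ using (ℕ; zero; suc)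
import Data.Nat.Properties as ℕₚ
open import Data.Product.Base using (Σ-syntax; ∃-syntax; _×_; _,_; proj₁; proj₂)
open import Data.Rational.Base as ℚ using (ℚ; 0ℚ; 1ℚ; ½)
import Data.Rational.Properties as ℚₚ
open import Data.Rational.Solver using (module +-*-Solver)
import Data.Rational.Unnormalised.Base as ℚᵘ
import Data.Rational.Unnormalised.Properties as ℚᵘₚ
open import Data.Sum.Base using (inj₁; inj₂)
open import Level using (0ℓ)
open import Relation.Binary.Definitions using (WeaklyDecidable)
import Relation.Binary.PropositionalEquality as ≡
import Relation.Binary.Reasoning.Setoid
open import Relation.Nullary.Decidable.Core using (yes; no)
open import Relation.Nullary.Negation.Core using (contradiction)

-- Ring identities behind the formula

-- The numeral 1 is the image of 1ℚ, so that the solver recognises it.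
module Identities {c ℓ} (R : CommutativeRing c ℓ)
  (rational : CommutativeRing.rawRing ℚₚ.+-*-commutativeRing -Raw-AlmostCommutative⟶ fromCommutativeRing R) where

  open CommutativeRing R hiding (zero)
  open _-Raw-AlmostCommutative⟶_ rational using (⟦_⟧)
  open import Relation.Binary.Reasoning.Setoid setoid

  -- The solver needs to compare coefficients. These are rationals, since equality in the ring of
  -- complex numbers cannot be decided.
  _≟_ : WeaklyDecidable (λ p q → ⟦ p ⟧ ≈ ⟦ q ⟧)
  p ≟ q with p ℚₚ.≟ q
  ... | yes ≡.refl = just refl
  ... | no  _      = nothing

  open Algebra.Solver.Ring (CommutativeRing.rawRing ℚₚ.+-*-commutativeRing)
    (fromCommutativeRing R) rational _≟_ public using (solve; _:=_; con; _:+_; _:*_; _:-_; :-_)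

  infix 8 _²

  1′ : Carrier
  1′ = ⟦ 1ℚ ⟧

  -- Unfolds to the same term as `z ^ 2` on complex numbers, so the identities below apply to it as
  -- they stand.
  _² : Carrier → Carrier
  x ² = x * (x * 1′)

  *-congˡ′ : ∀ {x y z} → y ≈ z → x * y ≈ x * z
  *-congˡ′ = *-cong refl

  *-identityʳ′ : ∀ x → x * 1′ ≈ x
  *-identityʳ′ = solve 1 (λ x → x :* con 1ℚ := x) refl

  -- Below, i = 1/n, p = 1/(n² - x²), q = 1/(n² + y²).
  p-i² : ∀ {n i x p} → n * i ≈ 1′ → (n ² - x ²) * p ≈ 1′ → p - i * i ≈ x * x * p * (i * i)
  p-i² {n} {i} {x} {p} ni≈1 p-inv = begin
    p - i * i
      ≈⟨ solve 2 (λ p i → p :- i :* i := p :* (con 1ℚ :* con 1ℚ) :- i :* i :* con 1ℚ) refl p i ⟩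
    p * (1′ * 1′) - i * i * 1′
      ≈⟨ +-cong (*-congˡ′ (*-cong ni≈1 ni≈1)) (-‿cong (*-congˡ′ p-inv)) ⟨
    p * (n * i * (n * i)) - i * i * ((n ² - x ²) * p)
      ≈⟨ solve 4 (λ n i x p → p :* (n :* i :* (n :* i)) :- i :* i :* ((n :* (n :* con 1ℚ) :- x :* (x :* con 1ℚ)) :* p)
           := x :* x :* p :* (i :* i)) refl n i x p ⟩
    x * x * p * (i * i) ∎

  -- Like `p-i²`, a partial fraction: the polar term of a `coth` value brings a product of 1/n² with
  -- p or q, and writing it as a difference separates it into two single series, one of them the
  -- series of D.
  i²-q : ∀ {n i y q} → n * i ≈ 1′ → (n ² + y ²) * q ≈ 1′ → i * i - q ≈ y * y * q * (i * i)
  i²-q {n} {i} {y} {q} ni≈1 q-inv = begin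
    i * i - q
      ≈⟨ solve 2 (λ q i → i :* i :- q := i :* i :* con 1ℚ :- q :* (con 1ℚ :* con 1ℚ)) refl q i ⟩
    i * i * 1′ - q * (1′ * 1′)
      ≈⟨ +-cong (*-congˡ′ q-inv) (-‿cong (*-congˡ′ (*-cong ni≈1 ni≈1))) ⟨
    i * i * ((n ² + y ²) * q) - q * (n * i * (n * i))
      ≈⟨ solve 4 (λ n i y q → i :* i :* ((n :* (n :* con 1ℚ) :+ y :* (y :* con 1ℚ)) :* q) :- q :* (n :* i :* (n :* i))
           := y :* y :* q :* (i :* i)) refl n i y q ⟩
    y * y * q * (i * i) ∎

  -- Clearing x² from m² + (n y / x)² leaves m² x² + n² y², which is unchanged when (m, x) and (n,
  -- y) are exchanged. It appears as a factor because an inverse for it is only built afterwards, in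
  -- `split`.
  scaled-inverse : ∀ {m n x y x⁻¹ s g} → x * x⁻¹ ≈ 1′ → s ≈ n * y * x⁻¹ → (m ² + s ²) * g ≈ 1′ →
    g * (m * m * (x * x) + n * n * (y * y)) ≈ x * x
  scaled-inverse {m} {n} {x} {y} {x⁻¹} {s} {g} x-inv s≈ g-inv = begin
    g * (m * m * (x * x) + n * n * (y * y))
      ≈⟨ solve 5 (λ m n x y g → g :* (m :* m :* (x :* x) :+ n :* n :* (y :* y))
           := g :* (m :* m :* (x :* x) :+ n :* n :* (y :* y) :* (con 1ℚ :* con 1ℚ))) refl m n x y g ⟩
    g * (m * m * (x * x) + n * n * (y * y) * (1′ * 1′))
      ≈⟨ *-congˡ′ (+-cong refl (*-congˡ′ (*-cong x-inv x-inv))) ⟨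
    g * (m * m * (x * x) + n * n * (y * y) * (x * x⁻¹ * (x * x⁻¹)))
      ≈⟨ solve 6 (λ m n x y x⁻¹ g → g :* (m :* m :* (x :* x) :+ n :* n :* (y :* y) :* (x :* x⁻¹ :* (x :* x⁻¹)))
           := (m :* m :+ n :* y :* x⁻¹ :* (n :* y :* x⁻¹)) :* g :* (x :* x)) refl m n x y x⁻¹ g ⟩
    (m * m + n * y * x⁻¹ * (n * y * x⁻¹)) * g * (x * x)
      ≈⟨ *-cong (*-cong (+-cong refl (*-cong s≈ s≈)) refl) refl ⟨
    (m * m + s * s) * g * (x * x)
      ≈⟨ solve 4 (λ m s g x → (m :* m :+ s :* s) :* g :* (x :* x)
           := (m :* (m :* con 1ℚ) :+ s :* (s :* con 1ℚ)) :* g :* (x :* x)) refl m s g x ⟩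
    (m ² + s ²) * g * (x * x)
      ≈⟨ *-cong g-inv refl ⟩
    1′ * (x * x)
      ≈⟨ solve 1 (λ x → con 1ℚ :* x := x) refl (x * x) ⟩
    x * x ∎

  -- With e = 1/(m² x² + n² y²), so that g = x² e and g′ = y² e, this is
  -- x² (m² + y²) + y² (n² - x²) = m² x² + n² y².
  split : ∀ {m n x y x⁻¹ y⁻¹ p q s s′ g g′} →
    x * x⁻¹ ≈ 1′ → y * y⁻¹ ≈ 1′ → s ≈ n * y * x⁻¹ → s′ ≈ m * x * y⁻¹ →
    (n ² - x ²) * p ≈ 1′ → (m ² + y ²) * q ≈ 1′ →
    (m ² + s ²) * g ≈ 1′ → (n ² + s′ ²) * g′ ≈ 1′ →
    p * g + q * g′ ≈ p * q
  split {m} {n} {x} {y} {x⁻¹} {y⁻¹} {p} {q} {s} {s′} {g} {g′} x-inv y-inv s≈ s′≈ p-inv q-inv g-inv g′-inv = begin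
    p * g + q * g′
      ≈⟨ *-identityʳ′ (p * g + q * g′) ⟨
    (p * g + q * g′) * 1′
      ≈⟨ *-congˡ′ De≈1 ⟨
    (p * g + q * g′) * (D * e)
      ≈⟨ solve 6 (λ p g q g′ D e → (p :* g :+ q :* g′) :* (D :* e) := (p :* (g :* D) :+ q :* (g′ :* D)) :* e) refl p g q g′ D e ⟩
    (p * (g * D) + q * (g′ * D)) * e
      ≈⟨ *-cong (+-cong (*-congˡ′ gD) (*-congˡ′ g′D)) refl ⟩
    (p * (x * x) + q * (y * y)) * e
      ≈⟨ solve 5 (λ p q x y e → (p :* (x :* x) :+ q :* (y :* y)) :* e
           := (p :* (x :* x) :* con 1ℚ :+ q :* (y :* y) :* con 1ℚ) :* e) refl p q x y e ⟩
    (p * (x * x) * 1′ + q * (y * y) * 1′) * e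
      -- Inserting 1 = (m² + y²) q beside p and 1 = (n² - x²) p beside q makes p q a common factor.
      ≈⟨ *-cong (+-cong (*-congˡ′ q-inv) (*-congˡ′ p-inv)) refl ⟨
    (p * (x * x) * ((m ² + y ²) * q) + q * (y * y) * ((n ² - x ²) * p)) * e
      ≈⟨ solve 7 (λ m n x y p q e →
           (p :* (x :* x) :* ((m :* (m :* con 1ℚ) :+ y :* (y :* con 1ℚ)) :* q) :+
            q :* (y :* y) :* ((n :* (n :* con 1ℚ) :- x :* (x :* con 1ℚ)) :* p)) :* e
           := p :* q :* ((m :* m :* (x :* x) :+ n :* n :* (y :* y)) :* e)) refl m n x y p q e ⟩
    p * q * (D * e)
      ≈⟨ *-congˡ′ De≈1 ⟩
    p * q * 1′
      ≈⟨ *-identityʳ′ (p * q) ⟩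
    p * q ∎
    where
    D = m * m * (x * x) + n * n * (y * y)
    -- The inverse of `D` is read off from g = x² / D, so the apartness of `D` from 0 need not be
    -- proved.
    e = g * (x⁻¹ * x⁻¹)
    gD : g * D ≈ x * x
    gD = scaled-inverse x-inv s≈ g-inv
    g′D : g′ * D ≈ y * y
    g′D = trans (*-congˡ′ (+-comm (m * m * (x * x)) (n * n * (y * y)))) (scaled-inverse y-inv s′≈ g′-inv)
    De≈1 : D * e ≈ 1′
    De≈1 = begin
      D * e                       ≈⟨ solve 3 (λ D g x⁻¹ → D :* (g :* (x⁻¹ :* x⁻¹)) := g :* D :* (x⁻¹ :* x⁻¹)) refl D g x⁻¹ ⟩
      g * D * (x⁻¹ * x⁻¹)         ≈⟨ *-cong gD refl ⟩
      x * x * (x⁻¹ * x⁻¹)         ≈⟨ solve 2 (λ x x⁻¹ → x :* x :* (x⁻¹ :* x⁻¹) := x :* x⁻¹ :* (x :* x⁻¹)) refl x x⁻¹ ⟩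
      x * x⁻¹ * (x * x⁻¹)         ≈⟨ *-cong x-inv x-inv ⟩
      1′ * 1′               ≈⟨ solve 0 (con 1ℚ :* con 1ℚ := con 1ℚ) refl ⟩
      1′                       ∎

  -- One fraction of the general term, with its `coth` value at s = n y / x expanded. Leaving `p`
  -- and `d` free of any formula in n and x lets it serve both fractions: `d` becomes p - 1/n² in
  -- one use and 1/n² - q in the other, with x and y exchanged.
  half-term : ∀ {n i x y x⁻¹ y⁻¹ p d} ι t a b₀ S →
    n * i ≈ 1′ → x * x⁻¹ ≈ 1′ → y * y⁻¹ ≈ 1′ → d ≈ x * x * p * (i * i) →
    x ² * a * (ι * (b₀ * (i * y⁻¹ * x) + t * (n * y * x⁻¹) * S)) * (i * p) ≈
    ι * x⁻¹ * y⁻¹ * (b₀ * (x * x) * (a * d) + t * (x * x) * (y * y) * (a * p * S))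
  half-term {n} {i} {x} {y} {x⁻¹} {y⁻¹} {p} {d} ι t a b₀ S n-inv x-inv y-inv d≈ = begin
    x ² * a * (ι * (b₀ * (i * y⁻¹ * x) + t * (n * y * x⁻¹) * S)) * (i * p)
      ≈⟨ solve 12 (λ n i x y x⁻¹ y⁻¹ p ι t a b₀ S →
           x :* (x :* con 1ℚ) :* a :* (ι :* (b₀ :* (i :* y⁻¹ :* x) :+ t :* (n :* y :* x⁻¹) :* S)) :* (i :* p)
           := ι :* a :* p :* (b₀ :* y⁻¹ :* x :* x :* x :* i :* i) :+ ι :* a :* p :* (t :* x :* y :* S) :* (x :* x⁻¹ :* (n :* i)))
           refl n i x y x⁻¹ y⁻¹ p ι t a b₀ S ⟩
    ι * a * p * (b₀ * y⁻¹ * x * x * x * i * i) + ι * a * p * (t * x * y * S) * (x * x⁻¹ * (n * i))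
      ≈⟨ +-cong refl (*-congˡ′ (*-cong x-inv n-inv)) ⟩
    ι * a * p * (b₀ * y⁻¹ * x * x * x * i * i) + ι * a * p * (t * x * y * S) * (1′ * 1′)
      ≈⟨ +-cong (*-identityʳ′ (ι * a * p * (b₀ * y⁻¹ * x * x * x * i * i))) refl ⟨
    ι * a * p * (b₀ * y⁻¹ * x * x * x * i * i) * 1′ + ι * a * p * (t * x * y * S) * (1′ * 1′)
      ≈⟨ +-cong (*-congˡ′ x-inv) (*-congˡ′ (*-cong x-inv y-inv)) ⟨
    ι * a * p * (b₀ * y⁻¹ * x * x * x * i * i) * (x * x⁻¹) + ι * a * p * (t * x * y * S) * (x * x⁻¹ * (y * y⁻¹))
      ≈⟨ solve 11 (λ i x y x⁻¹ y⁻¹ p ι t a b₀ S →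
           ι :* a :* p :* (b₀ :* y⁻¹ :* x :* x :* x :* i :* i) :* (x :* x⁻¹) :+ ι :* a :* p :* (t :* x :* y :* S) :* (x :* x⁻¹ :* (y :* y⁻¹))
           := ι :* x⁻¹ :* y⁻¹ :* (b₀ :* (x :* x) :* (a :* (x :* x :* p :* (i :* i))) :+ t :* (x :* x) :* (y :* y) :* (a :* p :* S)))
           refl i x y x⁻¹ y⁻¹ p ι t a b₀ S ⟩
    ι * x⁻¹ * y⁻¹ * (b₀ * (x * x) * (a * (x * x * p * (i * i))) + t * (x * x) * (y * y) * (a * p * S))
      ≈⟨ *-congˡ′ (+-cong (*-congˡ′ (*-congˡ′ d≈)) refl) ⟨
    ι * x⁻¹ * y⁻¹ * (b₀ * (x * x) * (a * d) + t * (x * x) * (y * y) * (a * p * S)) ∎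

  product-formula : ∀ {p ι x x⁻¹ y y⁻¹} t a₀ b₀ SA SB DA DB →
    p * ι ≈ 1′ → x * x⁻¹ ≈ 1′ → y * y⁻¹ ≈ 1′ →
    p ² * x * y * (ι * (a₀ * x⁻¹ - t * x * SA)) * (ι * (b₀ * y⁻¹ + t * y * SB)) ≈
    a₀ * b₀ + t * a₀ * DB * y ² - t * b₀ * DA * x ²
      - t * p * x * y * (ι * x⁻¹ * y⁻¹ *
          (b₀ * (x * x) * (SA - DA) + a₀ * (y * y) * (DB - SB) + t * (x * x) * (y * y) * (SA * SB)))
  product-formula {p} {ι} {x} {x⁻¹} {y} {y⁻¹} t a₀ b₀ SA SB DA DB p-inv x-inv y-inv = begin
    p ² * x * y * (ι * (a₀ * x⁻¹ - t * x * SA)) * (ι * (b₀ * y⁻¹ + t * y * SB))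
      ≈⟨ solve 11 (λ p ι x x⁻¹ y y⁻¹ t a₀ b₀ SA SB →
           p :* (p :* con 1ℚ) :* x :* y :* (ι :* (a₀ :* x⁻¹ :- t :* x :* SA)) :* (ι :* (b₀ :* y⁻¹ :+ t :* y :* SB))
           := p :* ι :* (p :* ι) :* ((a₀ :* (x :* x⁻¹) :- t :* x :* x :* SA) :* (b₀ :* (y :* y⁻¹) :+ t :* y :* y :* SB)))
           refl p ι x x⁻¹ y y⁻¹ t a₀ b₀ SA SB ⟩
    p * ι * (p * ι) * ((a₀ * (x * x⁻¹) - t * x * x * SA) * (b₀ * (y * y⁻¹) + t * y * y * SB))
      ≈⟨ *-cong (*-cong p-inv p-inv) (*-cong (+-cong (*-congˡ′ x-inv) refl) (+-cong (*-congˡ′ y-inv) refl)) ⟩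
    1′ * 1′ * ((a₀ * 1′ - t * x * x * SA) * (b₀ * 1′ + t * y * y * SB))
      -- `DA` and `DB` occur only on the right, where the differences `SA - DA` and `DB - SB` cancel
      -- them against the D-terms.
      ≈⟨ solve 9 (λ x y t a₀ b₀ SA SB DA DB →
           con 1ℚ :* con 1ℚ :* ((a₀ :* con 1ℚ :- t :* x :* x :* SA) :* (b₀ :* con 1ℚ :+ t :* y :* y :* SB))
           := a₀ :* b₀ :+ t :* a₀ :* DB :* (y :* (y :* con 1ℚ)) :- t :* b₀ :* DA :* (x :* (x :* con 1ℚ))
              :- t :* (con 1ℚ :* (con 1ℚ :* con 1ℚ)) :*
                (b₀ :* (x :* x) :* (SA :- DA) :+ a₀ :* (y :* y) :* (DB :- SB) :+ t :* (x :* x) :* (y :* y) :* (SA :* SB)))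
           refl x y t a₀ b₀ SA SB DA DB ⟩
    P - t * (1′ * (1′ * 1′)) * L
      ≈⟨ +-cong refl (-‿cong (*-cong (*-congˡ′ (*-cong p-inv (*-cong x-inv y-inv))) refl)) ⟨
    P - t * (p * ι * (x * x⁻¹ * (y * y⁻¹))) * L
      ≈⟨ solve 9 (λ p ι x x⁻¹ y y⁻¹ t P L →
           P :- t :* (p :* ι :* (x :* x⁻¹ :* (y :* y⁻¹))) :* L := P :- t :* p :* x :* y :* (ι :* x⁻¹ :* y⁻¹ :* L))
           refl p ι x x⁻¹ y y⁻¹ t P L ⟩
    P - t * p * x * y * (ι * x⁻¹ * y⁻¹ * L) ∎
    where
    P = a₀ * b₀ + t * a₀ * DB * y ² - t * b₀ * DA * x ²
    L = b₀ * (x * x) * (SA - DA) + a₀ * (y * y) * (DB - SB) + t * (x * x) * (y * y) * (SA * SB)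

  -- Separates the general term into pieces that can be summed independently: two differences of
  -- single series and the double series.
  term-formula : ∀ {n i x y x⁻¹ y⁻¹ p q} ι t a b a₀ b₀ S T →
    n * i ≈ 1′ → x * x⁻¹ ≈ 1′ → y * y⁻¹ ≈ 1′ → (n ² - x ²) * p ≈ 1′ → (n ² + y ²) * q ≈ 1′ →
    x ² * a * (ι * (b₀ * (i * y⁻¹ * x) + t * (n * y * x⁻¹) * S)) * (i * p) +
    y ² * b * (ι * (a₀ * (i * x⁻¹ * y) + t * (n * x * y⁻¹) * T)) * (i * q) ≈
    ι * x⁻¹ * y⁻¹ *
      (b₀ * (x * x) * (a * p - a * (i * i)) + a₀ * (y * y) * (b * (i * i) - b * q)
        + t * (x * x) * (y * y) * (a * p * S + b * q * T))
  term-formula {n} {i} {x} {y} {x⁻¹} {y⁻¹} {p} {q} ι t a b a₀ b₀ S T n-inv x-inv y-inv p-inv q-inv = begin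
    x ² * a * (ι * (b₀ * (i * y⁻¹ * x) + t * (n * y * x⁻¹) * S)) * (i * p) +
    y ² * b * (ι * (a₀ * (i * x⁻¹ * y) + t * (n * x * y⁻¹) * T)) * (i * q)
      ≈⟨ +-cong (half-term ι t a b₀ S n-inv x-inv y-inv (p-i² n-inv p-inv))
                (half-term ι t b a₀ T n-inv y-inv x-inv (i²-q n-inv q-inv)) ⟩
    ι * x⁻¹ * y⁻¹ * (b₀ * (x * x) * (a * (p - i * i)) + t * (x * x) * (y * y) * (a * p * S)) +
    ι * y⁻¹ * x⁻¹ * (a₀ * (y * y) * (b * (i * i - q)) + t * (y * y) * (x * x) * (b * q * T))
      ≈⟨ solve 7 (λ ι x⁻¹ y⁻¹ M N t c →
           ι :* x⁻¹ :* y⁻¹ :* (M :+ t) :+ ι :* y⁻¹ :* x⁻¹ :* (N :+ c) := ι :* x⁻¹ :* y⁻¹ :* (M :+ N :+ (t :+ c))) refl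
           ι x⁻¹ y⁻¹ (b₀ * (x * x) * (a * (p - i * i))) (a₀ * (y * y) * (b * (i * i - q)))
           (t * (x * x) * (y * y) * (a * p * S)) (t * (y * y) * (x * x) * (b * q * T)) ⟩
    ι * x⁻¹ * y⁻¹ *
      (b₀ * (x * x) * (a * (p - i * i)) + a₀ * (y * y) * (b * (i * i - q))
        + (t * (x * x) * (y * y) * (a * p * S) + t * (y * y) * (x * x) * (b * q * T)))
      ≈⟨ *-congˡ′ (+-cong (+-cong
           (*-congˡ′ (solve 3 (λ a p i → a :* (p :- i :* i) := a :* p :- a :* (i :* i)) refl a p i))
           (*-congˡ′ (solve 3 (λ b i q → b :* (i :* i :- q) := b :* (i :* i) :- b :* q) refl b i q)))
           (solve 5 (λ t X Y M N → t :* X :* Y :* M :+ t :* Y :* X :* N := t :* X :* Y :* (M :+ N)) refl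
             t (x * x) (y * y) (a * p * S) (b * q * T))) ⟩
    ι * x⁻¹ * y⁻¹ *
      (b₀ * (x * x) * (a * p - a * (i * i)) + a₀ * (y * y) * (b * (i * i) - b * q)
        + t * (x * x) * (y * y) * (a * p * S + b * q * T)) ∎

  product-inverse : ∀ {a b a⁻¹ b⁻¹} → a * a⁻¹ ≈ 1′ → b * b⁻¹ ≈ 1′ → a * b * (a⁻¹ * b⁻¹) ≈ 1′
  product-inverse {a} {b} {a⁻¹} {b⁻¹} a-inv b-inv = begin
    a * b * (a⁻¹ * b⁻¹)     ≈⟨ solve 4 (λ a b c d → a :* b :* (c :* d) := a :* c :* (b :* d)) refl a b a⁻¹ b⁻¹ ⟩
    a * a⁻¹ * (b * b⁻¹)     ≈⟨ *-cong a-inv b-inv ⟩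
    1′ * 1′                 ≈⟨ *-identityʳ′ 1′ ⟩
    1′                      ∎

open import Defs
open ℚ-Lemmas
open ≡ using (_≡_; refl; sym; trans; cong; cong₂; subst; module ≡-Reasoning)
open import Algebra.Properties.CommutativeSemiring.Exp
  (CommutativeRing.commutativeSemiring ℚₚ.+-*-commutativeRing)
  using (^-assocʳ; ^-distrib-*)
  renaming (_^_ to _^ℚ_)

-- Eventual bounds and the commutative ring of complex numbers

Eventually : (ℕ → Set) → Set
Eventually P = ∃[ N ] ∀ n → N ℕ.≤ n → P n

ev-map : ∀ {P Q : ℕ → Set} → (∀ n → P n → Q n) → Eventually P → Eventually Q
ev-map f (N , h) = N , λ n N≤n → f n (h n N≤n)

ev-zip : ∀ {P Q R : ℕ → Set} → (∀ n → P n → Q n → R n) →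
         Eventually P → Eventually Q → Eventually R
ev-zip f (N , h) (M , g) = N ℕ.⊔ M , λ n ≤n →
  f n (h n (ℕₚ.m⊔n≤o⇒m≤o N M ≤n)) (g n (ℕₚ.m⊔n≤o⇒n≤o N M ≤n))

ev-witness : ∀ {P : ℕ → Set} → Eventually P → ∃[ n ] P n
ev-witness (N , h) = N , h N ℕₚ.≤-refl

always : ∀ {P : ℕ → Set} → (∀ n → P n) → Eventually P
always h = 0 , λ n _ → h n

0≤+ : ∀ {p q} → 0ℚ ℚ.≤ p → 0ℚ ℚ.≤ q → 0ℚ ℚ.≤ p ℚ.+ q
0≤+ 0≤p 0≤q = ℚₚ.+-mono-≤ 0≤p 0≤q

0<+ : ∀ {p q} → 0ℚ ℚ.< p → 0ℚ ℚ.< q → 0ℚ ℚ.< p ℚ.+ q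
0<+ {p} {q} 0<p 0<q = ℚₚ.+-mono-< {0ℚ} {p} {0ℚ} {q} 0<p 0<q

0≤* : ∀ {p q} → 0ℚ ℚ.≤ p → 0ℚ ℚ.≤ q → 0ℚ ℚ.≤ p ℚ.* q
0≤* 0≤p 0≤q = *-mono ℚₚ.≤-refl 0≤q 0≤p 0≤q

p≤∣p∣ : ∀ p → p ℚ.≤ ℚ.∣ p ∣
p≤∣p∣ p with ℚₚ.≤-total 0ℚ p
... | inj₁ 0≤p = ℚₚ.≤-reflexive (sym (ℚₚ.0≤p⇒∣p∣≡p 0≤p))
... | inj₂ p≤0 = ℚₚ.≤-trans p≤0 0≤∣ p ∣

∣p∣*∣p∣ : ∀ p → ℚ.∣ p ∣ ℚ.* ℚ.∣ p ∣ ≡ p ℚ.* p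
∣p∣*∣p∣ p = trans (sym (ℚₚ.∣p*q∣≡∣p∣*∣q∣ p p)) (ℚₚ.0≤p⇒∣p∣≡p (Apartness.0≤q*q p))

-- Unlike the Euclidean norm, this one stays rational at each index.
ν : ℂ → ℕ → ℚ
ν z n = ℚ.∣ seq (re z) n ∣ ℚ.+ ℚ.∣ seq (im z) n ∣

infix 4 _≋_ _≺_

-- `z ≈ w` unfolds to statements about sequences, from which z and w cannot be inferred; the record
-- keeps them visible to unification.
record _≋_ (z w : ℂ) : Set where
  constructor equal
  field ≋⇒≈ : z ≈ w

-- In contrast to `_≤ᵣ_`, there is no slack ε: the bound itself holds at late indices, so bounds add
-- and multiply directly.
record _≺_ (z : ℂ) (q : ℚ) : Set where
  constructor bound
  field ν-bound : Eventually (λ n → ν z n ℚ.≤ q)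

open _≋_ public
open _≺_ public

module _ where
  open +-*-Solver

  0≤ν : ∀ z n → 0ℚ ℚ.≤ ν z n
  0≤ν z n = 0≤+ 0≤∣ seq (re z) n ∣ 0≤∣ seq (im z) n ∣

  ν-+ : ∀ z w n → ν (z + w) n ℚ.≤ ν z n ℚ.+ ν w n
  ν-+ z w n = begin
    ν (z + w) n
      ≤⟨ ℚₚ.+-mono-≤ (ℚₚ.∣p+q∣≤∣p∣+∣q∣ a c) (ℚₚ.∣p+q∣≤∣p∣+∣q∣ b d) ⟩
    (ℚ.∣ a ∣ ℚ.+ ℚ.∣ c ∣) ℚ.+ (ℚ.∣ b ∣ ℚ.+ ℚ.∣ d ∣)
      ≡⟨ solve 4 (λ a b c d → (a :+ c) :+ (b :+ d) := (a :+ b) :+ (c :+ d)) refl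
           ℚ.∣ a ∣ ℚ.∣ b ∣ ℚ.∣ c ∣ ℚ.∣ d ∣ ⟩
    ν z n ℚ.+ ν w n ∎
    where open ℚₚ.≤-Reasoning
          a = seq (re z) n ; b = seq (im z) n ; c = seq (re w) n ; d = seq (im w) n

  ν-* : ∀ z w n → ν (z * w) n ℚ.≤ ν z n ℚ.* ν w n
  ν-* z w n = begin
    ν (z * w) n
      ≤⟨ ℚₚ.+-mono-≤ (ℚₚ.∣p-q∣≤∣p∣+∣q∣ (a ℚ.* c) (b ℚ.* d)) (ℚₚ.∣p+q∣≤∣p∣+∣q∣ (a ℚ.* d) (b ℚ.* c)) ⟩
    (ℚ.∣ a ℚ.* c ∣ ℚ.+ ℚ.∣ b ℚ.* d ∣) ℚ.+ (ℚ.∣ a ℚ.* d ∣ ℚ.+ ℚ.∣ b ℚ.* c ∣)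
      ≡⟨ cong₂ ℚ._+_ (cong₂ ℚ._+_ (ℚₚ.∣p*q∣≡∣p∣*∣q∣ a c) (ℚₚ.∣p*q∣≡∣p∣*∣q∣ b d))
                     (cong₂ ℚ._+_ (ℚₚ.∣p*q∣≡∣p∣*∣q∣ a d) (ℚₚ.∣p*q∣≡∣p∣*∣q∣ b c)) ⟩
    (ℚ.∣ a ∣ ℚ.* ℚ.∣ c ∣ ℚ.+ ℚ.∣ b ∣ ℚ.* ℚ.∣ d ∣) ℚ.+ (ℚ.∣ a ∣ ℚ.* ℚ.∣ d ∣ ℚ.+ ℚ.∣ b ∣ ℚ.* ℚ.∣ c ∣)
      ≡⟨ solve 4 (λ a b c d → (a :* c :+ b :* d) :+ (a :* d :+ b :* c) := (a :+ b) :* (c :+ d)) refl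
           ℚ.∣ a ∣ ℚ.∣ b ∣ ℚ.∣ c ∣ ℚ.∣ d ∣ ⟩
    ν z n ℚ.* ν w n ∎
    where open ℚₚ.≤-Reasoning
          a = seq (re z) n ; b = seq (im z) n ; c = seq (re w) n ; d = seq (im w) n

  -- Ring laws hold at every single index as identities of rationals; estimates are left to the
  -- equivalence and congruence laws.
  pointwise : ∀ {z w} → (∀ n → seq (re z) n ≡ seq (re w) n) →
              (∀ n → seq (im z) n ≡ seq (im w) n) → z ≋ w
  pointwise {z} {w} r i = equal
    ((λ ε ε>0 → always (close ε ε>0 r)) , (λ ε ε>0 → always (close ε ε>0 i)))
    where
    close : ∀ ε → 0ℚ ℚ.< ε → {s t : ℕ → ℚ} → (∀ n → s n ≡ t n) → ∀ n → ℚ.∣ s n ℚ.- t n ∣ ℚ.≤ ε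
    close ε ε>0 {s} {t} s≡t n = subst (ℚ._≤ ε)
      (cong ℚ.∣_∣ (sym (trans (cong (ℚ._- t n) (s≡t n)) (ℚₚ.+-inverseʳ (t n))))) (ℚₚ.<⇒≤ ε>0)

  ≺-mono : ∀ {z p q} → p ℚ.≤ q → z ≺ p → z ≺ q
  ≺-mono p≤q (bound h) = bound (ev-map (λ _ z≤p → ℚₚ.≤-trans z≤p p≤q) h)

  ≺-+ : ∀ {z w p q} → z ≺ p → w ≺ q → z + w ≺ p ℚ.+ q
  ≺-+ {z} {w} (bound h) (bound g) = bound
    (ev-zip (λ n z≤p w≤q → ℚₚ.≤-trans (ν-+ z w n) (ℚₚ.+-mono-≤ z≤p w≤q)) h g)

  ≺-nonNeg : ∀ {z p} → z ≺ p → 0ℚ ℚ.≤ p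
  ≺-nonNeg {z} (bound h) = let n , z≤p = ev-witness h in ℚₚ.≤-trans (0≤ν z n) z≤p

  ≺-* : ∀ {z w p q} → z ≺ p → w ≺ q → z * w ≺ p ℚ.* q
  ≺-* {z} {w} z≺p w≺q = bound
    (ev-zip (λ n z≤p w≤q → ℚₚ.≤-trans (ν-* z w n) (*-mono (0≤ν z n) (≺-nonNeg w≺q) z≤p w≤q))
      (ν-bound z≺p) (ν-bound w≺q))

  ≋⇒≺ : ∀ {z w ε} → 0ℚ ℚ.< ε → z ≋ w → z - w ≺ ε
  ≋⇒≺ {ε = ε} ε>0 (equal (r , i)) = bound
    (ev-zip (λ n p q → subst (_ ℚ.≤_) (half+half ε) (ℚₚ.+-mono-≤ p q))
      (r (½ ℚ.* ε) (half ε>0)) (i (½ ℚ.* ε) (half ε>0)))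

  p≤p+q : ∀ p {q} → 0ℚ ℚ.≤ q → p ℚ.≤ p ℚ.+ q
  p≤p+q p {q} 0≤q = subst (ℚ._≤ p ℚ.+ q) (ℚₚ.+-identityʳ p) (ℚₚ.+-monoʳ-≤ p 0≤q)

  q≤p+q : ∀ {p} q → 0ℚ ℚ.≤ p → q ℚ.≤ p ℚ.+ q
  q≤p+q {p} q 0≤p = subst (ℚ._≤ p ℚ.+ q) (ℚₚ.+-identityˡ q) (ℚₚ.+-monoˡ-≤ q 0≤p)

  -- Together with `≋⇒≺`, turns laws of equality into estimates for `ν`, so that real and imaginary
  -- parts need not be treated separately.
  ≺⇒≋ : ∀ {z w} → (∀ ε → 0ℚ ℚ.< ε → z - w ≺ ε) → z ≋ w
  ≺⇒≋ {z} {w} h = equal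
    ( (λ ε ε>0 → ev-map (λ n → ℚₚ.≤-trans (p≤p+q (ℚ.∣ seq (re (z - w)) n ∣) 0≤∣ seq (im (z - w)) n ∣))
        (ν-bound (h ε ε>0)))
    , (λ ε ε>0 → ev-map (λ n → ℚₚ.≤-trans (q≤p+q (ℚ.∣ seq (im (z - w)) n ∣) 0≤∣ seq (re (z - w)) n ∣))
        (ν-bound (h ε ε>0))))

  ν-≡ : ∀ z w n → seq (re z) n ≡ seq (re w) n → seq (im z) n ≡ seq (im w) n → ν z n ≡ ν w n
  ν-≡ z w n = cong₂ (λ p q → ℚ.∣ p ∣ ℚ.+ ℚ.∣ q ∣)

  ν-swap : ∀ z w n → ν (z - w) n ≡ ν (w - z) n
  ν-swap z w n = cong₂ ℚ._+_ (∣-∣-sym (seq (re z) n) (seq (re w) n)) (∣-∣-sym (seq (im z) n) (seq (im w) n))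

  ν-via : ∀ z w n → ν z n ℚ.≤ ν (z - w) n ℚ.+ ν w n
  ν-via z w n = begin
    ν z n                    ≡⟨ ν-≡ z (z - w + w) n (insert (seq (re z) n) (seq (re w) n))
                                                    (insert (seq (im z) n) (seq (im w) n)) ⟩
    ν (z - w + w) n          ≤⟨ ν-+ (z - w) w n ⟩
    ν (z - w) n ℚ.+ ν w n    ∎
    where
    open ℚₚ.≤-Reasoning
    insert : ∀ p q → p ≡ p ℚ.- q ℚ.+ q
    insert = solve 2 (λ p q → p := p :- q :+ q) refl

  ν-triangle : ∀ z w v n → ν (z - v) n ℚ.≤ ν (z - w) n ℚ.+ ν (w - v) n
  ν-triangle z w v n = begin
    ν (z - v) n                    ≡⟨ ν-≡ (z - v) (z - w + (w - v)) n
                                        (insert (seq (re z) n) (seq (re w) n) (seq (re v) n))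
                                        (insert (seq (im z) n) (seq (im w) n) (seq (im v) n)) ⟩
    ν (z - w + (w - v)) n          ≤⟨ ν-+ (z - w) (w - v) n ⟩
    ν (z - w) n ℚ.+ ν (w - v) n    ∎
    where
    open ℚₚ.≤-Reasoning
    insert : ∀ p q r → p ℚ.- r ≡ p ℚ.- q ℚ.+ (q ℚ.- r)
    insert = solve 3 (λ p q r → p :- r := p :- q :+ (q :- r)) refl

  ≋-refl : ∀ {z} → z ≋ z
  ≋-refl = pointwise (λ _ → refl) (λ _ → refl)

  ≺-swap : ∀ {z w p} → z - w ≺ p → w - z ≺ p
  ≺-swap {z} {w} {p} (bound h) = bound (ev-map (λ n → subst (ℚ._≤ p) (ν-swap z w n)) h)

  ≋-sym : ∀ {z w} → z ≋ w → w ≋ z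
  ≋-sym e = ≺⇒≋ λ ε ε>0 → ≺-swap (≋⇒≺ ε>0 e)

  ≺-trans : ∀ {z w v p q} → z - w ≺ p → w - v ≺ q → z - v ≺ p ℚ.+ q
  ≺-trans {z} {w} {v} (bound h) (bound g) = bound
    (ev-zip (λ n zw wv → ℚₚ.≤-trans (ν-triangle z w v n) (ℚₚ.+-mono-≤ zw wv)) h g)

  ≋-trans : ∀ {z w v} → z ≋ w → w ≋ v → z ≋ v
  ≋-trans {z} {w} {v} z≋w w≋v = ≺⇒≋ λ ε ε>0 → subst (z - v ≺_) (half+half ε)
    (≺-trans (≋⇒≺ (half ε>0) z≋w) (≋⇒≺ (half ε>0) w≋v))

  ≺-bounded : ∀ z → ∃[ q ] 0ℚ ℚ.< q × z ≺ q
  ≺-bounded z =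
    let p , p>0 , h = Bounded.bounded (re z)
        q , q>0 , g = Bounded.bounded (im z)
    in p ℚ.+ q , 0<+ p>0 q>0 ,
       bound (ev-zip (λ n re≤p im≤q → ℚₚ.+-mono-≤ {ℚ.∣ seq (re z) n ∣} {p} {ℚ.∣ seq (im z) n ∣} {q} re≤p im≤q) h g)

  ≺-≡ : ∀ {z w p} → (∀ n → seq (re z) n ≡ seq (re w) n) → (∀ n → seq (im z) n ≡ seq (im w) n) →
        z ≺ p → w ≺ p
  ≺-≡ {z} {w} {p} r i (bound h) = bound (ev-map (λ n → subst (ℚ._≤ p) (ν-≡ z w n (r n) (i n))) h)

  ≺-+-diff : ∀ {z z′ w w′ p q} → z - z′ ≺ p → w - w′ ≺ q → (z + w) - (z′ + w′) ≺ p ℚ.+ q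
  ≺-+-diff {z} {z′} {w} {w′} h g = ≺-≡ {z - z′ + (w - w′)} {z + w - (z′ + w′)}
    (λ n → regroup (seq (re z) n) (seq (re z′) n) (seq (re w) n) (seq (re w′) n))
    (λ n → regroup (seq (im z) n) (seq (im z′) n) (seq (im w) n) (seq (im w′) n))
    (≺-+ h g)
    where
    regroup : ∀ p q r s → p ℚ.- q ℚ.+ (r ℚ.- s) ≡ p ℚ.+ r ℚ.- (q ℚ.+ s)
    regroup = solve 4 (λ p q r s → p :- q :+ (r :- s) := p :+ r :- (q :+ s)) refl

  +-cong : ∀ {z z′ w w′} → z ≋ z′ → w ≋ w′ → z + w ≋ z′ + w′
  +-cong {z} {z′} {w} {w′} e f = ≺⇒≋ λ ε ε>0 → subst (z + w - (z′ + w′) ≺_) (half+half ε)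
    (≺-+-diff (≋⇒≺ (half ε>0) e) (≋⇒≺ (half ε>0) f))

  neg-cong : ∀ {z w} → z ≋ w → - z ≋ - w
  neg-cong {z} {w} e = ≺⇒≋ λ ε ε>0 → ≺-≡ {w - z} {(- z) - (- w)}
    (λ n → negate (seq (re z) n) (seq (re w) n))
    (λ n → negate (seq (im z) n) (seq (im w) n))
    (≺-swap (≋⇒≺ ε>0 e))
    where
    negate : ∀ p q → q ℚ.- p ≡ ℚ.- p ℚ.- ℚ.- q
    negate = solve 2 (λ p q → q :- p := (:- p) :- (:- q)) refl

  *-comm : ∀ z w → z * w ≋ w * z
  *-comm z w = pointwise
    (λ n → solve 4 (λ a b c d → a :* c :- b :* d := c :* a :- d :* b) refl
      (seq (re z) n) (seq (im z) n) (seq (re w) n) (seq (im w) n))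
    (λ n → solve 4 (λ a b c d → a :* d :+ b :* c := c :* b :+ d :* a) refl
      (seq (re z) n) (seq (im z) n) (seq (re w) n) (seq (im w) n))

  ≺-*-diff : ∀ {z w v p q} → z ≺ p → w - v ≺ q → z * w - z * v ≺ p ℚ.* q
  ≺-*-diff {z} {w} {v} h g = ≺-≡ {z * (w - v)} {z * w - z * v}
    (λ n → distrib-re (seq (re z) n) (seq (im z) n) (seq (re w) n) (seq (im w) n) (seq (re v) n) (seq (im v) n))
    (λ n → distrib-im (seq (re z) n) (seq (im z) n) (seq (re w) n) (seq (im w) n) (seq (re v) n) (seq (im v) n))
    (≺-* h g)
    where
    distrib-re : ∀ a b c d e f →
      a ℚ.* (c ℚ.- e) ℚ.- b ℚ.* (d ℚ.- f) ≡ a ℚ.* c ℚ.- b ℚ.* d ℚ.- (a ℚ.* e ℚ.- b ℚ.* f)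
    distrib-re = solve 6 (λ a b c d e f →
      a :* (c :- e) :- b :* (d :- f) := a :* c :- b :* d :- (a :* e :- b :* f)) refl
    distrib-im : ∀ a b c d e f →
      a ℚ.* (d ℚ.- f) ℚ.+ b ℚ.* (c ℚ.- e) ≡ a ℚ.* d ℚ.+ b ℚ.* c ℚ.- (a ℚ.* f ℚ.+ b ℚ.* e)
    distrib-im = solve 6 (λ a b c d e f →
      a :* (d :- f) :+ b :* (c :- e) := a :* d :+ b :* c :- (a :* f :+ b :* e)) refl

  cancel-inverse : ∀ B B′ ε → B′ ℚ.* B ≡ 1ℚ → B ℚ.* (B′ ℚ.* ε) ≡ ε
  cancel-inverse B B′ ε B′B≡1 = trans (solve 3 (λ b b′ e → b :* (b′ :* e) := b′ :* b :* e) refl B B′ ε)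
    (trans (cong (ℚ._* ε) B′B≡1) (ℚₚ.*-identityˡ ε))

  *-congˡ : ∀ {z w v} → w ≋ v → z * w ≋ z * v
  *-congˡ {z} {w} {v} e = ≺⇒≋ λ ε ε>0 →
    let B , B>0 , z≺B = ≺-bounded z
        B′ , B′>0 , B′B≡1 = 1/pos B>0
    in subst (z * w - z * v ≺_) (cancel-inverse B B′ ε B′B≡1)
         (≺-*-diff z≺B (≋⇒≺ (pos* B′>0 ε>0) e))

  *-cong : ∀ {z z′ w w′} → z ≋ z′ → w ≋ w′ → z * w ≋ z′ * w′
  *-cong {z} {z′} {w} {w′} e f =
    ≋-trans (*-congˡ f) (≋-trans (*-comm z w′) (≋-trans (*-congˡ e) (*-comm w′ z′)))

  *-assoc : ∀ z w v → (z * w) * v ≋ z * (w * v)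
  *-assoc z w v = pointwise
    (λ n → solve 6 (λ a b c d e f →
        (a :* c :- b :* d) :* e :- (a :* d :+ b :* c) :* f := a :* (c :* e :- d :* f) :- b :* (c :* f :+ d :* e)) refl
      (seq (re z) n) (seq (im z) n) (seq (re w) n) (seq (im w) n) (seq (re v) n) (seq (im v) n))
    (λ n → solve 6 (λ a b c d e f →
        (a :* c :- b :* d) :* f :+ (a :* d :+ b :* c) :* e := a :* (c :* f :+ d :* e) :+ b :* (c :* e :- d :* f)) refl
      (seq (re z) n) (seq (im z) n) (seq (re w) n) (seq (im w) n) (seq (re v) n) (seq (im v) n))

  *-identityˡ : ∀ z → nat 1 * z ≋ z
  *-identityˡ z = pointwise
    (λ n → solve 2 (λ a b → con 1ℚ :* a :- con 0ℚ :* b := a) refl (seq (re z) n) (seq (im z) n))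
    (λ n → solve 2 (λ a b → con 1ℚ :* b :+ con 0ℚ :* a := b) refl (seq (re z) n) (seq (im z) n))

  *-distribˡ : ∀ z w v → z * (w + v) ≋ z * w + z * v
  *-distribˡ z w v = pointwise
    (λ n → solve 6 (λ a b c d e f →
        a :* (c :+ e) :- b :* (d :+ f) := a :* c :- b :* d :+ (a :* e :- b :* f)) refl
      (seq (re z) n) (seq (im z) n) (seq (re w) n) (seq (im w) n) (seq (re v) n) (seq (im v) n))
    (λ n → solve 6 (λ a b c d e f →
        a :* (d :+ f) :+ b :* (c :+ e) := a :* d :+ b :* c :+ (a :* f :+ b :* e)) refl
      (seq (re z) n) (seq (im z) n) (seq (re w) n) (seq (im w) n) (seq (re v) n) (seq (im v) n))

ℂ-commutativeRing : CommutativeRing 0ℓ 0ℓ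
ℂ-commutativeRing = record
  { Carrier = ℂ ; _≈_ = _≋_ ; _+_ = _+_ ; _*_ = _*_ ; -_ = -_ ; 0# = nat 0 ; 1# = nat 1
  ; isCommutativeRing = record
    { isRing = record
      { +-isAbelianGroup = record
        { isGroup = record
          { isMonoid = record
            { isSemigroup = record
              { isMagma = record
                { isEquivalence = record { refl = ≋-refl ; sym = ≋-sym ; trans = ≋-trans }
                ; ∙-cong = +-cong }
              ; assoc = λ z w v → pointwise (λ n → ℚₚ.+-assoc (seq (re z) n) (seq (re w) n) (seq (re v) n))
                                            (λ n → ℚₚ.+-assoc (seq (im z) n) (seq (im w) n) (seq (im v) n)) }
            ; identity = (λ z → pointwise (λ n → ℚₚ.+-identityˡ (seq (re z) n)) (λ n → ℚₚ.+-identityˡ (seq (im z) n)))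
                       , (λ z → pointwise (λ n → ℚₚ.+-identityʳ (seq (re z) n)) (λ n → ℚₚ.+-identityʳ (seq (im z) n))) }
          ; inverse = (λ z → pointwise (λ n → ℚₚ.+-inverseˡ (seq (re z) n)) (λ n → ℚₚ.+-inverseˡ (seq (im z) n)))
                    , (λ z → pointwise (λ n → ℚₚ.+-inverseʳ (seq (re z) n)) (λ n → ℚₚ.+-inverseʳ (seq (im z) n)))
          ; ⁻¹-cong = neg-cong }
        ; comm = λ z w → pointwise (λ n → ℚₚ.+-comm (seq (re z) n) (seq (re w) n)) (λ n → ℚₚ.+-comm (seq (im z) n) (seq (im w) n)) }
      ; *-cong = *-cong
      ; *-assoc = *-assoc
      ; *-identity = *-identityˡ , λ z → ≋-trans (*-comm z (nat 1)) (*-identityˡ z)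
      ; distrib = *-distribˡ , λ z w v → ≋-trans (*-comm (w + v) z)
          (≋-trans (*-distribˡ z w v) (+-cong (*-comm z w) (*-comm z v))) }
    ; *-comm = *-comm } }

module ℂ-Ring = CommutativeRing ℂ-commutativeRing
module ≋-Reasoning = Relation.Binary.Reasoning.Setoid ℂ-Ring.setoid

rational-homo : CommutativeRing.rawRing ℚₚ.+-*-commutativeRing
                -Raw-AlmostCommutative⟶ fromCommutativeRing ℂ-commutativeRing
rational-homo = record
  { ⟦_⟧    = λ q → real (ratᵣ q)
  ; +-homo = λ p q → pointwise (λ _ → refl) (λ _ → refl)
  ; *-homo = λ p q → pointwise
      (λ _ → solve 2 (λ a b → a :* b := a :* b :- con 0ℚ :* con 0ℚ) refl p q)
      (λ _ → solve 2 (λ a b → con 0ℚ := a :* con 0ℚ :+ con 0ℚ :* b) refl p q)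
  ; -‿homo = λ p → pointwise (λ _ → refl) (λ _ → refl)
  ; 0-homo = ≋-refl
  ; 1-homo = ≋-refl
  }
  where open +-*-Solver

module ℂ-Solver = Identities ℂ-commutativeRing rational-homo

-- Inverses, division and apartness

ν-real* : ∀ t z n → ν (real t * z) n ≡ ℚ.∣ seq t n ∣ ℚ.* ν z n
ν-real* t z n = begin
  ν (real t * z) n
    ≡⟨ cong₂ (λ p q → ℚ.∣ p ∣ ℚ.+ ℚ.∣ q ∣)
         (solve 3 (λ t a b → t :* a :- con 0ℚ :* b := t :* a) refl (seq t n) (seq (re z) n) (seq (im z) n))
         (solve 3 (λ t a b → t :* b :+ con 0ℚ :* a := t :* b) refl (seq t n) (seq (re z) n) (seq (im z) n)) ⟩
  ℚ.∣ seq t n ℚ.* seq (re z) n ∣ ℚ.+ ℚ.∣ seq t n ℚ.* seq (im z) n ∣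
    ≡⟨ cong₂ ℚ._+_ (ℚₚ.∣p*q∣≡∣p∣*∣q∣ (seq t n) (seq (re z) n)) (ℚₚ.∣p*q∣≡∣p∣*∣q∣ (seq t n) (seq (im z) n)) ⟩
  ℚ.∣ seq t n ∣ ℚ.* ℚ.∣ seq (re z) n ∣ ℚ.+ ℚ.∣ seq t n ∣ ℚ.* ℚ.∣ seq (im z) n ∣
    ≡⟨ ℚₚ.*-distribˡ-+ ℚ.∣ seq t n ∣ ℚ.∣ seq (re z) n ∣ ℚ.∣ seq (im z) n ∣ ⟨
  ℚ.∣ seq t n ∣ ℚ.* ν z n ∎
  where open ≡-Reasoning
        open +-*-Solver

0<1 : 0ℚ ℚ.< 1ℚ
0<1 = ℚₚ.positive⁻¹ 1ℚ

-- At a given index t p is only close to 1. Being within 1 of it gives size at most 2 for t p, and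
-- dividing by t ≥ d gives 2/d, which is δ + δ.
inverse-≺ : ∀ {t p d δ} → 0ℚ ℚ.< δ → δ ℚ.* d ≡ 1ℚ → Eventually (λ n → d ℚ.≤ seq t n) →
            real t * p ≋ nat 1 → p ≺ δ ℚ.+ δ
inverse-≺ {t} {p} {d} {δ} δ>0 δd≡1 d≤t tp≋1 = bound (ev-zip step d≤t (ν-bound (≋⇒≺ 0<1 tp≋1)))
  where
  open ℚₚ.≤-Reasoning
  open +-*-Solver
  step : ∀ n → d ℚ.≤ seq t n → ν (real t * p - nat 1) n ℚ.≤ 1ℚ → ν p n ℚ.≤ δ ℚ.+ δ
  step n d≤tₙ near = begin
    ν p n                                       ≡⟨ ℚₚ.*-identityˡ (ν p n) ⟨
    1ℚ ℚ.* ν p n                                ≡⟨ cong (ℚ._* ν p n) δd≡1 ⟨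
    δ ℚ.* d ℚ.* ν p n                           ≡⟨ ℚₚ.*-assoc δ d (ν p n) ⟩
    δ ℚ.* (d ℚ.* ν p n)                         ≤⟨ scaled (ℚₚ.*-monoʳ-≤-nonNeg (ν p n) {{ℚ.nonNegative (0≤ν p n)}} d≤tₙ) ⟩
    δ ℚ.* (seq t n ℚ.* ν p n)                   ≤⟨ scaled (ℚₚ.*-monoʳ-≤-nonNeg (ν p n) {{ℚ.nonNegative (0≤ν p n)}} (p≤∣p∣ (seq t n))) ⟩
    δ ℚ.* (ℚ.∣ seq t n ∣ ℚ.* ν p n)             ≡⟨ cong (δ ℚ.*_) (ν-real* t p n) ⟨
    δ ℚ.* ν (real t * p) n                      ≤⟨ scaled (ν-via (real t * p) (nat 1) n) ⟩
    δ ℚ.* (ν (real t * p - nat 1) n ℚ.+ 1ℚ)     ≤⟨ scaled (ℚₚ.+-monoˡ-≤ 1ℚ near) ⟩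
    δ ℚ.* (1ℚ ℚ.+ 1ℚ)                           ≡⟨ solve 1 (λ d → d :* (con 1ℚ :+ con 1ℚ) := d :+ d) refl δ ⟩
    δ ℚ.+ δ                                     ∎
    where
    scaled : ∀ {p q} → p ℚ.≤ q → δ ℚ.* p ℚ.≤ δ ℚ.* q
    scaled = ℚₚ.*-monoˡ-≤-nonNeg δ {{ℚ.nonNegative (ℚₚ.<⇒≤ δ>0)}}

recip-inverse : ∀ t t#0 → real t * real (recip t t#0) ≋ nat 1
recip-inverse t t#0@(apart δ δ>0 M far) = equal
  -- From `M` on the terms of `t` stay away from 0, so the junk value of `inv` does not occur and
  -- the product is exactly 1.
  ( (λ ε ε>0 → M , λ n M≤n → exact ε ε>0 (trans
      (solve 2 (λ a b → a :* b :- con 0ℚ :* con 0ℚ := b :* a) refl (seq t n) (inv (seq t n)))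
      (inv-inverseˡ {seq t n} (ℚₚ.<-≤-trans δ>0 (subst (δ ℚ.≤_) (Inverse.∣-0∣ (seq t n)) (far n M≤n))))))
  , (λ ε ε>0 → 0 , λ n _ → exact ε ε>0
      (solve 2 (λ a b → a :* con 0ℚ :+ con 0ℚ :* b := con 0ℚ) refl (seq t n) (inv (seq t n)))))
  where
  open +-*-Solver
  exact : ∀ ε → 0ℚ ℚ.< ε → ∀ {p q} → p ≡ q → ℚ.∣ p ℚ.- q ∣ ℚ.≤ ε
  exact ε ε>0 {p} refl = subst (ℚ._≤ ε) (cong ℚ.∣_∣ (sym (ℚₚ.+-inverseʳ p))) (ℚₚ.<⇒≤ ε>0)

conj : ℂ → ℂ
conj z = re z +i (-ᵣ im z)

*-conj : ∀ z → z * conj z ≋ real (normSq z)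
*-conj z = pointwise
  (λ n → solve 2 (λ a b → a :* a :- b :* (:- b) := a :* a :+ b :* b) refl (seq (re z) n) (seq (im z) n))
  (λ n → solve 2 (λ a b → a :* (:- b) :+ b :* a := con 0ℚ) refl (seq (re z) n) (seq (im z) n))
  where open +-*-Solver

-- Inverses are unique, so a quotient may be computed with any of them, and the apartness proof
-- drops out of the algebra.
÷-inverse : ∀ z {w p} (w#0 : w #0) → w * p ≋ nat 1 → z ÷ w [ w#0 ] ≋ z * p
÷-inverse z {w} {p} w#0 wp≋1 = begin
  z * conj w * r               ≈⟨ solve 3 (λ z c r → z :* c :* r := con 1ℚ :* (z :* (c :* r))) ≋-refl z (conj w) r ⟩
  nat 1 * (z * (conj w * r))   ≈⟨ *-cong wp≋1 ≋-refl ⟨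
  w * p * (z * (conj w * r))   ≈⟨ solve 5 (λ w p z c r → w :* p :* (z :* (c :* r)) := w :* c :* r :* (z :* p)) ≋-refl w p z (conj w) r ⟩
  w * conj w * r * (z * p)     ≈⟨ *-cong (*-cong (*-conj w) ≋-refl) ≋-refl ⟩
  real (normSq w) * r * (z * p) ≈⟨ *-cong (recip-inverse (normSq w) w#0) ≋-refl ⟩
  nat 1 * (z * p)              ≈⟨ *-identityˡ (z * p) ⟩
  z * p                        ∎
  where
  open ≋-Reasoning
  open ℂ-Solver
  r = real (recip (normSq w) w#0)

-- Compares `ν` with the Euclidean norm, in which `_#0` is expressed.
half-square≤ : ∀ p q → ½ ℚ.* ((ℚ.∣ p ∣ ℚ.+ ℚ.∣ q ∣) ℚ.* (ℚ.∣ p ∣ ℚ.+ ℚ.∣ q ∣)) ℚ.≤ p ℚ.* p ℚ.+ q ℚ.* q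
half-square≤ p q = begin
  ½ ℚ.* ((s ℚ.+ t) ℚ.* (s ℚ.+ t))
    ≤⟨ p≤p+q _ (0≤* (ℚₚ.nonNegative⁻¹ ½) (Apartness.0≤q*q (s ℚ.- t))) ⟩
  ½ ℚ.* ((s ℚ.+ t) ℚ.* (s ℚ.+ t)) ℚ.+ ½ ℚ.* ((s ℚ.- t) ℚ.* (s ℚ.- t))
    ≡⟨ solve 2 (λ s t → con ½ :* ((s :+ t) :* (s :+ t)) :+ con ½ :* ((s :- t) :* (s :- t)) := s :* s :+ t :* t) refl s t ⟩
  s ℚ.* s ℚ.+ t ℚ.* t
    ≡⟨ cong₂ ℚ._+_ (∣p∣*∣p∣ p) (∣p∣*∣p∣ q) ⟩
  p ℚ.* p ℚ.+ q ℚ.* q ∎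
  where
  open ℚₚ.≤-Reasoning
  open +-*-Solver
  s = ℚ.∣ p ∣
  t = ℚ.∣ q ∣

-- Eventually w p has size at least ½ while p is bounded by some B, so w has size at least 1/(2B).
-- This recovers the apartness proofs that `IsCot` demands from explicit inverses.
inverse⇒#0 : ∀ {w p} → w * p ≋ nat 1 → w #0
inverse⇒#0 {w} {p} wp≋1 =
  let B , B>0 , p≺B = ≺-bounded p
      B′ , B′>0 , B′B≡1 = 1/pos B>0
      c = ½ ℚ.* B′
      c>0 = half B′>0
      N , h = ev-zip (large B B′ (ℚₚ.<⇒≤ B′>0) (ℚₚ.<⇒≤ B>0) B′B≡1) (ν-bound (≋⇒≺ (half 0<1) wp≋1)) (ν-bound p≺B)
  in apart (½ ℚ.* (c ℚ.* c)) (half (pos* c>0 c>0)) N λ n N≤n → begin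
       ½ ℚ.* (c ℚ.* c)                ≤⟨ ℚₚ.*-monoˡ-≤-nonNeg ½ (*-mono (ℚₚ.<⇒≤ c>0) (0≤ν w n) (h n N≤n) (h n N≤n)) ⟩
       ½ ℚ.* (ν w n ℚ.* ν w n)        ≤⟨ half-square≤ (seq (re w) n) (seq (im w) n) ⟩
       seq (normSq w) n               ≤⟨ p≤∣p∣ (seq (normSq w) n) ⟩
       ℚ.∣ seq (normSq w) n ∣         ≡⟨ Inverse.∣-0∣ (seq (normSq w) n) ⟨
       ℚ.∣ seq (normSq w) n ℚ.- 0ℚ ∣  ∎
  where
  open ℚₚ.≤-Reasoning
  open +-*-Solver
  large : ∀ B B′ → 0ℚ ℚ.≤ B′ → 0ℚ ℚ.≤ B → B′ ℚ.* B ≡ 1ℚ → ∀ n →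
          ν (w * p - nat 1) n ℚ.≤ ½ ℚ.* 1ℚ → ν p n ℚ.≤ B → ½ ℚ.* B′ ℚ.≤ ν w n
  large B B′ B′≥0 B≥0 B′B≡1 n near p≤B = begin
    ½ ℚ.* B′                    ≤⟨ ℚₚ.*-monoʳ-≤-nonNeg B′ {{ℚ.nonNegative B′≥0}} half≤ ⟩
    ν w n ℚ.* B ℚ.* B′          ≡⟨ solve 3 (λ v b b′ → v :* b :* b′ := v :* (b′ :* b)) refl (ν w n) B B′ ⟩
    ν w n ℚ.* (B′ ℚ.* B)        ≡⟨ cong (ν w n ℚ.*_) B′B≡1 ⟩
    ν w n ℚ.* 1ℚ                ≡⟨ ℚₚ.*-identityʳ (ν w n) ⟩
    ν w n                       ∎
    where
    half≤ : ½ ℚ.≤ ν w n ℚ.* B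
    half≤ = begin
      ½                                     ≡⟨ refl ⟩
      ℚ.- ½ ℚ.+ 1ℚ                          ≤⟨ ℚₚ.+-monoʳ-≤ (ℚ.- ½) (ν-via (nat 1) (w * p) n) ⟩
      ℚ.- ½ ℚ.+ (ν (nat 1 - w * p) n ℚ.+ ν (w * p) n)
        ≤⟨ ℚₚ.+-monoʳ-≤ (ℚ.- ½) (ℚₚ.+-monoˡ-≤ (ν (w * p) n) (subst (ℚ._≤ ½) (ν-swap (w * p) (nat 1) n) near)) ⟩
      ℚ.- ½ ℚ.+ (½ ℚ.+ ν (w * p) n)         ≡⟨ solve 1 (λ v → con (ℚ.- ½) :+ (con ½ :+ v) := v) refl (ν (w * p) n) ⟩
      ν (w * p) n                           ≤⟨ ν-* w p n ⟩
      ν w n ℚ.* ν p n                       ≤⟨ ℚₚ.*-monoˡ-≤-nonNeg (ν w n) {{ℚ.nonNegative (0≤ν w n)}} p≤B ⟩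
      ν w n ℚ.* B                           ∎

-- Limits of complex sequences

Lim : (ℕ → ℂ) → ℂ → Set
Lim P L = ∀ ε → 0ℚ ℚ.< ε → Eventually (λ n → P n - L ≺ ε)

lim-cong : ∀ {P Q L M} → (∀ n → P n ≋ Q n) → L ≋ M → Lim P L → Lim Q M
lim-cong {P} {Q} {L} {M} P≋Q L≋M P→L ε ε>0 = ev-map
  (λ n d → subst (Q n - M ≺_) sizes
    (≺-trans (≋⇒≺ (half ε>0) (≋-sym (P≋Q n))) (≺-trans d (≋⇒≺ (half (half ε>0)) L≋M))))
  (P→L (½ ℚ.* (½ ℚ.* ε)) (half (half ε>0)))
  where
  sizes : ½ ℚ.* ε ℚ.+ (½ ℚ.* (½ ℚ.* ε) ℚ.+ ½ ℚ.* (½ ℚ.* ε)) ≡ ε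
  sizes = trans (cong (½ ℚ.* ε ℚ.+_) (half+half (½ ℚ.* ε))) (half+half ε)

lim-const : ∀ c → Lim (λ _ → c) c
lim-const c ε ε>0 = always λ _ → ≋⇒≺ ε>0 ≋-refl

lim-+ : ∀ {P Q L M} → Lim P L → Lim Q M → Lim (λ n → P n + Q n) (L + M)
lim-+ {P} {Q} {L} {M} P→L Q→M ε ε>0 = ev-zip
  (λ n d e → subst (P n + Q n - (L + M) ≺_) (half+half ε) (≺-+-diff d e))
  (P→L (½ ℚ.* ε) (half ε>0)) (Q→M (½ ℚ.* ε) (half ε>0))

lim-scale : ∀ c {P L} → Lim P L → Lim (λ n → c * P n) (c * L)
lim-scale c {P} {L} P→L ε ε>0 =
  let B , B>0 , c≺B = ≺-bounded c
      B′ , B′>0 , B′B≡1 = 1/pos B>0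
  in ev-map (λ n d → subst (c * P n - c * L ≺_) (cancel-inverse B B′ ε B′B≡1) (≺-*-diff c≺B d))
       (P→L (B′ ℚ.* ε) (pos* B′>0 ε>0))

-- Writing p q = (p - l)(q - m) + l q + m p - l m leaves only a product of two null sequences to
-- estimate, and no bound on `P` or `Q` is required.
lim-* : ∀ {P Q L M} → Lim P L → Lim Q M → Lim (λ n → P n * Q n) (L * M)
lim-* {P} {Q} {L} {M} P→L Q→M = lim-cong
  (λ n → solve 4 (λ p q l m → (p :- l) :* (q :- m) :+ l :* q :+ m :* p :+ (:- l) :* m := p :* q)
    ≋-refl (P n) (Q n) L M)
  (solve 2 (λ l m → con 0ℚ :+ l :* m :+ m :* l :+ (:- l) :* m := l :* m) ≋-refl L M)
  (lim-+ {M = (- L) * M} (lim-+ {M = M * L} (lim-+ {M = L * M} product→0 (lim-scale L Q→M)) (lim-scale M P→L))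
    (lim-const ((- L) * M)))
  where
  open ℂ-Solver
  product→0 : Lim (λ n → (P n - L) * (Q n - M)) (nat 0)
  product→0 ε ε>0 = ev-zip
    (λ n d e → ≺-≡ {(P n - L) * (Q n - M)} {(P n - L) * (Q n - M) - nat 0}
       (λ k → sym (ℚₚ.+-identityʳ (seq (re ((P n - L) * (Q n - M))) k)))
       (λ k → sym (ℚₚ.+-identityʳ (seq (im ((P n - L) * (Q n - M))) k)))
       (subst ((P n - L) * (Q n - M) ≺_) (ℚₚ.*-identityʳ ε) (≺-* d e)))
    (P→L ε ε>0) (Q→M 1ℚ 0<1)

lim-approx : ∀ {P Q L} → Lim P L → (∀ ε → 0ℚ ℚ.< ε → Eventually (λ n → Q n - P n ≺ ε)) → Lim Q L
lim-approx {P} {Q} {L} P→L near ε ε>0 = ev-zip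
  (λ n d e → subst (Q n - L ≺_) (half+half ε) (≺-trans d e))
  (near (½ ℚ.* ε) (half ε>0)) (P→L (½ ℚ.* ε) (half ε>0))

-- Partial sums and sums of series

partialSum-cong : ∀ {f g} → (∀ n → f n ≋ g n) → ∀ n → partialSum f n ≋ partialSum g n
partialSum-cong f≋g zero    = ≋-refl
partialSum-cong f≋g (suc n) = +-cong (partialSum-cong f≋g n) (f≋g n)

partialSum-+ : ∀ f g n → partialSum (λ k → f k + g k) n ≋ partialSum f n + partialSum g n
partialSum-+ f g zero    = pointwise (λ _ → refl) (λ _ → refl)
partialSum-+ f g (suc n) = ≋-trans (+-cong (partialSum-+ f g n) ≋-refl)
  (solve 4 (λ p q a b → p :+ q :+ (a :+ b) := p :+ a :+ (q :+ b)) ≋-refl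
    (partialSum f n) (partialSum g n) (f n) (g n))
  where open ℂ-Solver

partialSum-scale : ∀ c f n → partialSum (λ k → c * f k) n ≋ c * partialSum f n
partialSum-scale c f zero    = solve 1 (λ c → con 0ℚ := c :* con 0ℚ) ≋-refl c
  where open ℂ-Solver
partialSum-scale c f (suc n) = ≋-trans (+-cong (partialSum-scale c f n) ≋-refl)
  (≋-sym (*-distribˡ c (partialSum f n) (f n)))

partialSum-0 : ∀ n → partialSum (λ _ → nat 0) n ≋ nat 0
partialSum-0 zero    = ≋-refl
partialSum-0 (suc n) = ≋-trans (+-cong (partialSum-0 n) (≋-refl {nat 0})) (ℂ-Ring.+-identityʳ (nat 0))

partialSum-swap : ∀ (F : ℕ → ℕ → ℂ) m n →
  partialSum (λ i → partialSum (F i) n) m ≋ partialSum (λ j → partialSum (λ i → F i j) m) n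
partialSum-swap F zero    n = ≋-sym (partialSum-0 n)
partialSum-swap F (suc m) n = ≋-trans (+-cong (partialSum-swap F m n) ≋-refl)
  (≋-sym (partialSum-+ (λ j → partialSum (λ i → F i j) m) (F m) n))

partialSum-* : ∀ f g m n →
  partialSum f m * partialSum g n ≋ partialSum (λ i → partialSum (λ j → f i * g j) n) m
partialSum-* f g m n = begin
  partialSum f m * partialSum g n                          ≈⟨ *-comm (partialSum f m) (partialSum g n) ⟩
  partialSum g n * partialSum f m                          ≈⟨ partialSum-scale (partialSum g n) f m ⟨
  partialSum (λ i → partialSum g n * f i) m                ≈⟨ partialSum-cong (λ i → *-comm (partialSum g n) (f i)) m ⟩
  partialSum (λ i → f i * partialSum g n) m                ≈⟨ partialSum-cong (λ i → partialSum-scale (f i) g n) m ⟨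
  partialSum (λ i → partialSum (λ j → f i * g j) n) m      ∎
  where open ≋-Reasoning

Sums : (ℕ → ℂ) → ℂ → Set
Sums f = Lim (partialSum f)

sums-cong : ∀ {f g S T} → (∀ n → f n ≋ g n) → S ≋ T → Sums f S → Sums g T
sums-cong f≋g = lim-cong (partialSum-cong f≋g)

sums-+ : ∀ {f g S T} → Sums f S → Sums g T → Sums (λ n → f n + g n) (S + T)
sums-+ {f} {g} s t = lim-cong (λ n → ≋-sym (partialSum-+ f g n)) ≋-refl (lim-+ s t)

sums-scale : ∀ c {f S} → Sums f S → Sums (λ n → c * f n) (c * S)
sums-scale c {f} s = lim-cong (λ n → ≋-sym (partialSum-scale c f n)) ≋-refl (lim-scale c s)

-- `ν` dominates the Euclidean norm: with s and t the absolute values of the coordinates, (s + t)²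
-- exceeds s² + t² by 2 s t.
sums⇒HasSum : ∀ {f S} → Sums f S → HasSum f S
sums⇒HasSum {f} {S} f→S ε ε>0 =
  let N , h = f→S ε ε>0
  in N , λ n N≤n → (λ δ δ>0 → always λ _ → ℚₚ.≤-trans (ℚₚ.<⇒≤ ε>0) (p≤p+q ε (ℚₚ.<⇒≤ δ>0)))
                 , λ δ δ>0 → ev-map (square δ δ>0 (partialSum f n - S)) (ν-bound (h n N≤n))
  where
  open ℚₚ.≤-Reasoning
  open +-*-Solver
  square : ∀ δ → 0ℚ ℚ.< δ → ∀ z k → ν z k ℚ.≤ ε → seq (normSq z) k ℚ.≤ ε ℚ.* ε ℚ.+ δ
  square δ δ>0 z k z≤ε = begin
    a ℚ.* a ℚ.+ b ℚ.* b                       ≡⟨ cong₂ ℚ._+_ (∣p∣*∣p∣ a) (∣p∣*∣p∣ b) ⟨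
    s ℚ.* s ℚ.+ t ℚ.* t                       ≤⟨ p≤p+q _ (0≤+ (0≤* 0≤∣ a ∣ 0≤∣ b ∣) (0≤* 0≤∣ a ∣ 0≤∣ b ∣)) ⟩
    s ℚ.* s ℚ.+ t ℚ.* t ℚ.+ (s ℚ.* t ℚ.+ s ℚ.* t)
      ≡⟨ solve 2 (λ s t → s :* s :+ t :* t :+ (s :* t :+ s :* t) := (s :+ t) :* (s :+ t)) refl s t ⟩
    (s ℚ.+ t) ℚ.* (s ℚ.+ t)                   ≤⟨ *-mono (0≤ν z k) (ℚₚ.<⇒≤ ε>0) z≤ε z≤ε ⟩
    ε ℚ.* ε                                   ≤⟨ p≤p+q (ε ℚ.* ε) (ℚₚ.<⇒≤ δ>0) ⟩
    ε ℚ.* ε ℚ.+ δ                             ∎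
    where a = seq (re z) k ; b = seq (im z) k ; s = ℚ.∣ a ∣ ; t = ℚ.∣ b ∣

-- Natural numbers and powers among the rationals

⌜_⌝ : ℕ → ℚ
⌜ n ⌝ = + n ℚ./ 1

⌜⌝-mono : ∀ {m n} → m ℕ.≤ n → ⌜ m ⌝ ℚ.≤ ⌜ n ⌝
⌜⌝-mono {m} {n} m≤n = Leibniz./-mono (+ m) (+ n) 0 0 (ℤₚ.*-monoʳ-≤-nonNeg (+ 1) (ℤ.+≤+ m≤n))

⌜⌝-* : ∀ m n → ⌜ m ℕ.* n ⌝ ≡ ⌜ m ⌝ ℚ.* ⌜ n ⌝
⌜⌝-* m n = ℚₚ.toℚᵘ-injective (begin
  ℚ.toℚᵘ ⌜ m ℕ.* n ⌝                                ≈⟨ ℚₚ.toℚᵘ-fromℚᵘ (ℚᵘ.mkℚᵘ (+ (m ℕ.* n)) 0) ⟩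
  ℚᵘ.mkℚᵘ (+ (m ℕ.* n)) 0                           ≈⟨ ℚᵘ.*≡* (cong (ℤ._* + 1) (ℤₚ.pos-* m n)) ⟩
  ℚᵘ.mkℚᵘ (+ m) 0 ℚᵘ.* ℚᵘ.mkℚᵘ (+ n) 0              ≈⟨ ℚᵘₚ.*-cong (ℚₚ.toℚᵘ-fromℚᵘ (ℚᵘ.mkℚᵘ (+ m) 0)) (ℚₚ.toℚᵘ-fromℚᵘ (ℚᵘ.mkℚᵘ (+ n) 0)) ⟨
  ℚ.toℚᵘ ⌜ m ⌝ ℚᵘ.* ℚ.toℚᵘ ⌜ n ⌝                    ≈⟨ ℚₚ.toℚᵘ-homo-* ⌜ m ⌝ ⌜ n ⌝ ⟨
  ℚ.toℚᵘ (⌜ m ⌝ ℚ.* ⌜ n ⌝)                          ∎)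
  where open Relation.Binary.Reasoning.Setoid ℚᵘₚ.≃-setoid

⌜⌝-^ : ∀ m n → ⌜ m ℕ.^ n ⌝ ≡ ⌜ m ⌝ ^ℚ n
⌜⌝-^ m zero    = refl
⌜⌝-^ m (suc n) = trans (⌜⌝-* m (m ℕ.^ n)) (cong (⌜ m ⌝ ℚ.*_) (⌜⌝-^ m n))

0≤⌜⌝ : ∀ n → 0ℚ ℚ.≤ ⌜ n ⌝
0≤⌜⌝ n = ⌜⌝-mono {0} {n} ℕ.z≤n

0<⌜suc⌝ : ∀ n → 0ℚ ℚ.< ⌜ suc n ⌝
0<⌜suc⌝ n = ℚₚ.<-≤-trans 0<1 (Apartness.1≤nat n)

archimedean : ∀ q → ∃[ n ] q ℚ.≤ ⌜ n ⌝
archimedean q@(ℚ.mkℚ (+ n) d _) = n , subst (ℚ._≤ ⌜ n ⌝) (ℚₚ.fromℚᵘ-toℚᵘ q)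
  (Leibniz./-mono (+ n) (+ n) d 0 (ℤₚ.*-monoˡ-≤-nonNeg (+ n) (ℤ.+≤+ (ℕ.s≤s ℕ.z≤n))))
archimedean q@(ℚ.mkℚ -[1+ n ] d _) = 0 , subst (ℚ._≤ 0ℚ) (ℚₚ.fromℚᵘ-toℚᵘ q)
  (Leibniz./-mono -[1+ n ] (+ 0) d 0 ℤ.-≤+)

n≤2^n : ∀ n → n ℕ.≤ 2 ℕ.^ n
n≤2^n zero    = ℕ.z≤n
n≤2^n (suc n) = ℕₚ.+-mono-≤ (ℕₚ.m^n>0 2 n) (ℕₚ.≤-trans (n≤2^n n) (ℕₚ.m≤m+n (2 ℕ.^ n) 0))

1^≡1 : ∀ n → 1ℚ ^ℚ n ≡ 1ℚ
1^≡1 zero    = refl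
1^≡1 (suc n) = trans (ℚₚ.*-identityˡ (1ℚ ^ℚ n)) (1^≡1 n)

0<^ : ∀ {p} n → 0ℚ ℚ.< p → 0ℚ ℚ.< p ^ℚ n
0<^ zero    p>0 = 0<1
0<^ (suc n) p>0 = pos* p>0 (0<^ n p>0)

^-inverse : ∀ p q n → p ℚ.* q ≡ 1ℚ → p ^ℚ n ℚ.* q ^ℚ n ≡ 1ℚ
^-inverse p q n pq≡1 = trans (sym (^-distrib-* p q n)) (trans (cong (_^ℚ n) pq≡1) (1^≡1 n))

½^-small : ∀ ε → 0ℚ ℚ.< ε → Eventually (λ n → ½ ^ℚ n ℚ.≤ ε)
½^-small ε ε>0 =
  let ε′ , ε′>0 , ε′ε≡1 = 1/pos ε>0
      N , ε′≤N = archimedean ε′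
  in N , λ n N≤n → begin
    ½ ^ℚ n                          ≡⟨ ℚₚ.*-identityʳ (½ ^ℚ n) ⟨
    ½ ^ℚ n ℚ.* 1ℚ                   ≡⟨ cong (½ ^ℚ n ℚ.*_) ε′ε≡1 ⟨
    ½ ^ℚ n ℚ.* (ε′ ℚ.* ε)           ≤⟨ *-mono (ℚₚ.<⇒≤ (0<^ n (ℚₚ.positive⁻¹ ½))) (0≤* (0≤⌜⌝ (2 ℕ.^ n)) (ℚₚ.<⇒≤ ε>0)) ℚₚ.≤-refl
                                         (ℚₚ.*-monoʳ-≤-nonNeg ε {{ℚ.nonNegative (ℚₚ.<⇒≤ ε>0)}}
                                           (ℚₚ.≤-trans ε′≤N (⌜⌝-mono (ℕₚ.≤-trans N≤n (n≤2^n n))))) ⟩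
    ½ ^ℚ n ℚ.* (⌜ 2 ℕ.^ n ⌝ ℚ.* ε)  ≡⟨ ℚₚ.*-assoc (½ ^ℚ n) ⌜ 2 ℕ.^ n ⌝ ε ⟨
    ½ ^ℚ n ℚ.* ⌜ 2 ℕ.^ n ⌝ ℚ.* ε    ≡⟨ cong (λ t → ½ ^ℚ n ℚ.* t ℚ.* ε) (⌜⌝-^ 2 n) ⟩
    ½ ^ℚ n ℚ.* ⌜ 2 ⌝ ^ℚ n ℚ.* ε     ≡⟨ cong (ℚ._* ε) (^-inverse ½ ⌜ 2 ⌝ n refl) ⟩
    1ℚ ℚ.* ε                        ≡⟨ ℚₚ.*-identityˡ ε ⟩
    ε                               ∎
  where open ℚₚ.≤-Reasoning

-- Completeness

∣∣-triangle : ∀ p q r → ℚ.∣ p ℚ.- r ∣ ℚ.≤ ℚ.∣ p ℚ.- q ∣ ℚ.+ ℚ.∣ q ℚ.- r ∣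
∣∣-triangle p q r = subst (λ t → ℚ.∣ t ∣ ℚ.≤ ℚ.∣ p ℚ.- q ∣ ℚ.+ ℚ.∣ q ℚ.- r ∣)
  (solve 3 (λ p q r → p :- q :+ (q :- r) := p :- r) refl p q r)
  (ℚₚ.∣p+q∣≤∣p∣+∣q∣ (p ℚ.- q) (q ℚ.- r))
  where open +-*-Solver

-- The limit is a diagonal: `P n` contributes its rational at an index past which it varies by at
-- most 2^(-n).
module ℝ-Complete (P : ℕ → ℝ)
  (P-cauchy : ∀ ε → 0ℚ ℚ.< ε → ∃[ N ] ∀ m n → N ℕ.≤ m → N ℕ.≤ n →
    Eventually (λ j → ℚ.∣ seq (P m) j ℚ.- seq (P n) j ∣ ℚ.≤ ε)) where

  0<½^ : ∀ n → 0ℚ ℚ.< ½ ^ℚ n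
  0<½^ n = 0<^ n (ℚₚ.positive⁻¹ ½)

  settle : ℕ → ℕ
  settle n = proj₁ (cauchy (P n) (½ ^ℚ n) (0<½^ n))

  diagonal : ℕ → ℚ
  diagonal n = seq (P n) (settle n)

  settled : ∀ n j → settle n ℕ.≤ j → ℚ.∣ seq (P n) j ℚ.- diagonal n ∣ ℚ.≤ ½ ^ℚ n
  settled n j ≤j = proj₂ (cauchy (P n) (½ ^ℚ n) (0<½^ n)) j (settle n) ≤j ℕₚ.≤-refl

  diagonal-cauchy : IsCauchy diagonal
  diagonal-cauchy ε ε>0 =
    let N₁ , h₁ = P-cauchy (½ ℚ.* ε) (half ε>0)
        N₂ , h₂ = ½^-small (½ ℚ.* (½ ℚ.* ε)) (half (half ε>0))
    in N₁ ℕ.⊔ N₂ , λ m n ≤m ≤n →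
      -- An auxiliary index, past both settling points and late enough to compare `P m` with `P n`;
      -- it disappears from the final estimate.
      let j , (Pₘ≈ , Pₙ≈) , PₘPₙ≈ = ev-witness (ev-zip (λ _ → _,_)
            (ev-zip {λ j → settle m ℕ.≤ j} {λ j → settle n ℕ.≤ j} (λ _ → _,_) (settle m , λ _ ≤j → ≤j) (settle n , λ _ ≤j → ≤j))
            (h₁ m n (ℕₚ.m⊔n≤o⇒m≤o N₁ N₂ ≤m) (ℕₚ.m⊔n≤o⇒m≤o N₁ N₂ ≤n)))
          small = λ k ≤k → h₂ k (ℕₚ.m⊔n≤o⇒n≤o N₁ N₂ ≤k)
      in begin
        ℚ.∣ diagonal m ℚ.- diagonal n ∣
          ≤⟨ ∣∣-triangle (diagonal m) (seq (P m) j) (diagonal n) ⟩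
        ℚ.∣ diagonal m ℚ.- seq (P m) j ∣ ℚ.+ ℚ.∣ seq (P m) j ℚ.- diagonal n ∣
          ≤⟨ ℚₚ.+-monoʳ-≤ ℚ.∣ diagonal m ℚ.- seq (P m) j ∣ (∣∣-triangle (seq (P m) j) (seq (P n) j) (diagonal n)) ⟩
        ℚ.∣ diagonal m ℚ.- seq (P m) j ∣ ℚ.+ (ℚ.∣ seq (P m) j ℚ.- seq (P n) j ∣ ℚ.+ ℚ.∣ seq (P n) j ℚ.- diagonal n ∣)
          ≤⟨ ℚₚ.+-mono-≤
               (ℚₚ.≤-trans (subst (ℚ._≤ ½ ^ℚ m) (∣-∣-sym (seq (P m) j) (diagonal m)) (settled m j Pₘ≈)) (small m ≤m))
               (ℚₚ.+-mono-≤ PₘPₙ≈ (ℚₚ.≤-trans (settled n j Pₙ≈) (small n ≤n))) ⟩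
        ½ ℚ.* (½ ℚ.* ε) ℚ.+ (½ ℚ.* ε ℚ.+ ½ ℚ.* (½ ℚ.* ε))
          ≡⟨ solve 1 (λ e → con ½ :* (con ½ :* e) :+ (con ½ :* e :+ con ½ :* (con ½ :* e)) := e) refl ε ⟩
        ε ∎
    where open ℚₚ.≤-Reasoning
          open +-*-Solver

  limit : ℝ
  limit = mkℝ diagonal diagonal-cauchy

  converges : ∀ ε → 0ℚ ℚ.< ε →
    Eventually (λ n → Eventually (λ j → ℚ.∣ seq (P n) j ℚ.- seq limit j ∣ ℚ.≤ ε))
  converges ε ε>0 =
    let N₁ , h₁ = diagonal-cauchy (½ ℚ.* ε) (half ε>0)
        N₂ , h₂ = ½^-small (½ ℚ.* ε) (half ε>0)
    in N₁ ℕ.⊔ N₂ , λ n ≤n → N₁ ℕ.⊔ settle n , λ j ≤j →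
      subst (ℚ.∣ seq (P n) j ℚ.- diagonal j ∣ ℚ.≤_) (half+half ε)
        (ℚₚ.≤-trans (∣∣-triangle (seq (P n) j) (diagonal n) (diagonal j)) (ℚₚ.+-mono-≤
          (ℚₚ.≤-trans (settled n j (ℕₚ.m⊔n≤o⇒n≤o N₁ (settle n) ≤j)) (h₂ n (ℕₚ.m⊔n≤o⇒n≤o N₁ N₂ ≤n)))
          (h₁ n j (ℕₚ.m⊔n≤o⇒m≤o N₁ N₂ ≤n) (ℕₚ.m⊔n≤o⇒m≤o N₁ (settle n) ≤j))))

ℂ-complete : (P : ℕ → ℂ) →
  (∀ ε → 0ℚ ℚ.< ε → ∃[ N ] ∀ m n → N ℕ.≤ m → N ℕ.≤ n → P m - P n ≺ ε) → ∃[ L ] Lim P L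
ℂ-complete P P-cauchy = (Re.limit +i Im.limit) , λ ε ε>0 → ev-zip
  (λ n h g → bound (ev-zip (λ j p q → subst (ν (P n - (Re.limit +i Im.limit)) j ℚ.≤_) (half+half ε) (ℚₚ.+-mono-≤ p q)) h g))
  (Re.converges (½ ℚ.* ε) (half ε>0)) (Im.converges (½ ℚ.* ε) (half ε>0))
  where
  re-cauchy : ∀ ε → 0ℚ ℚ.< ε → ∃[ N ] ∀ m n → N ℕ.≤ m → N ℕ.≤ n →
    Eventually (λ j → ℚ.∣ seq (re (P m)) j ℚ.- seq (re (P n)) j ∣ ℚ.≤ ε)
  re-cauchy ε ε>0 =
    let N , h = P-cauchy ε ε>0
    in N , λ m n N≤m N≤n → ev-map (λ j → ℚₚ.≤-trans (p≤p+q ℚ.∣ seq (re (P m - P n)) j ∣ 0≤∣ seq (im (P m - P n)) j ∣))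
         (ν-bound (h m n N≤m N≤n))
  im-cauchy : ∀ ε → 0ℚ ℚ.< ε → ∃[ N ] ∀ m n → N ℕ.≤ m → N ℕ.≤ n →
    Eventually (λ j → ℚ.∣ seq (im (P m)) j ℚ.- seq (im (P n)) j ∣ ℚ.≤ ε)
  im-cauchy ε ε>0 =
    let N , h = P-cauchy ε ε>0
    in N , λ m n N≤m N≤n → ev-map (λ j → ℚₚ.≤-trans (q≤p+q ℚ.∣ seq (im (P m - P n)) j ∣ 0≤∣ seq (re (P m - P n)) j ∣))
         (ν-bound (h m n N≤m N≤n))
  module Re = ℝ-Complete (λ n → re (P n)) re-cauchy
  module Im = ℝ-Complete (λ n → im (P n)) im-cauchy

-- Summable majorants

-- tail u n m = u n + ⋯ + u (n + m - 1)
tail : (ℕ → ℚ) → ℕ → ℕ → ℚ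
tail u n zero    = 0ℚ
tail u n (suc m) = tail u n m ℚ.+ u (m ℕ.+ n)

-- A Cauchy condition, uniform in the length of the tail; the sum of a rational series need not be a
-- rational that could be named.
Summable : (ℕ → ℚ) → Set
Summable u = ∀ ε → 0ℚ ℚ.< ε → Eventually (λ n → ∀ m → tail u n m ℚ.≤ ε)

tail-mono : ∀ {u v} n → (∀ k → n ℕ.≤ k → u k ℚ.≤ v k) → ∀ m → tail u n m ℚ.≤ tail v n m
tail-mono n u≤v zero    = ℚₚ.≤-refl
tail-mono n u≤v (suc m) = ℚₚ.+-mono-≤ (tail-mono n u≤v m) (u≤v (m ℕ.+ n) (ℕₚ.m≤n+m n m))

tail-scale : ∀ c u n m → tail (λ k → c ℚ.* u k) n m ≡ c ℚ.* tail u n m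
tail-scale c u n zero    = sym (ℚₚ.*-zeroʳ c)
tail-scale c u n (suc m) = trans (cong (ℚ._+ c ℚ.* u (m ℕ.+ n)) (tail-scale c u n m))
  (sym (ℚₚ.*-distribˡ-+ c (tail u n m) (u (m ℕ.+ n))))

tail-split : ∀ u n k m → tail u n (m ℕ.+ k) ≡ tail u n k ℚ.+ tail u (k ℕ.+ n) m
tail-split u n k zero    = sym (ℚₚ.+-identityʳ (tail u n k))
tail-split u n k (suc m) = trans
  (cong₂ ℚ._+_ (tail-split u n k m) (cong u (ℕₚ.+-assoc m k n)))
  (ℚₚ.+-assoc (tail u n k) (tail u (k ℕ.+ n) m) (u (m ℕ.+ (k ℕ.+ n))))

tail-nonNeg : ∀ {u} → (∀ k → 0ℚ ℚ.≤ u k) → ∀ n m → 0ℚ ℚ.≤ tail u n m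
tail-nonNeg u≥0 n zero    = ℚₚ.≤-refl
tail-nonNeg u≥0 n (suc m) = 0≤+ (tail-nonNeg u≥0 n m) (u≥0 (m ℕ.+ n))

summable-dominated : ∀ {u v} c → 0ℚ ℚ.< c → Summable v → Eventually (λ k → u k ℚ.≤ c ℚ.* v k) → Summable u
summable-dominated {u} {v} c c>0 v-summable (K , u≤cv) ε ε>0 =
  let c′ , c′>0 , c′c≡1 = 1/pos c>0
      N , h = v-summable (c′ ℚ.* ε) (pos* c′>0 ε>0)
  in K ℕ.⊔ N , λ n ≤n m → begin
    tail u n m                     ≤⟨ tail-mono n (λ k n≤k → u≤cv k (ℕₚ.≤-trans (ℕₚ.m⊔n≤o⇒m≤o K N ≤n) n≤k)) m ⟩
    tail (λ k → c ℚ.* v k) n m     ≡⟨ tail-scale c v n m ⟩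
    c ℚ.* tail v n m               ≤⟨ ℚₚ.*-monoˡ-≤-nonNeg c {{ℚ.nonNegative (ℚₚ.<⇒≤ c>0)}} (h n (ℕₚ.m⊔n≤o⇒n≤o K N ≤n) m) ⟩
    c ℚ.* (c′ ℚ.* ε)               ≡⟨ cancel-inverse c c′ ε c′c≡1 ⟩
    ε                              ∎
  where open ℚₚ.≤-Reasoning

tail-bounded : ∀ {u} → (∀ k → 0ℚ ℚ.≤ u k) → Summable u → ∃[ U ] 0ℚ ℚ.< U × ∀ n → tail u 0 n ℚ.≤ U
tail-bounded {u} u≥0 u-summable =
  let N , h = u-summable 1ℚ 0<1
  in 1ℚ ℚ.+ tail u 0 N , ℚₚ.<-≤-trans 0<1 (p≤p+q 1ℚ (tail-nonNeg u≥0 0 N)) , λ n → begin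
    -- Appending `N` nonnegative terms gives a sum that certainly contains the first `N`, whether or
    -- not n reaches `N`.
    tail u 0 n                               ≤⟨ p≤p+q (tail u 0 n) (tail-nonNeg u≥0 (n ℕ.+ 0) N) ⟩
    tail u 0 n ℚ.+ tail u (n ℕ.+ 0) N        ≡⟨ tail-split u 0 n N ⟨
    tail u 0 (N ℕ.+ n)                       ≡⟨ cong (tail u 0) (ℕₚ.+-comm N n) ⟩
    tail u 0 (n ℕ.+ N)                       ≡⟨ tail-split u 0 N n ⟩
    tail u 0 N ℚ.+ tail u (N ℕ.+ 0) n        ≤⟨ ℚₚ.+-monoʳ-≤ (tail u 0 N) (h (N ℕ.+ 0) (ℕₚ.m≤m+n N 0) n) ⟩
    tail u 0 N ℚ.+ 1ℚ                        ≡⟨ ℚₚ.+-comm (tail u 0 N) 1ℚ ⟩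
    1ℚ ℚ.+ tail u 0 N                        ∎
  where open ℚₚ.≤-Reasoning

z-z≺0 : ∀ z → z - z ≺ 0ℚ
z-z≺0 z = bound (always λ n → ℚₚ.≤-reflexive
  (cong₂ (λ p q → ℚ.∣ p ∣ ℚ.+ ℚ.∣ q ∣) (ℚₚ.+-inverseʳ (seq (re z) n)) (ℚₚ.+-inverseʳ (seq (im z) n))))

partialSum-tail : ∀ {f u} → (∀ k → f k ≺ u k) → ∀ n m → partialSum f (m ℕ.+ n) - partialSum f n ≺ tail u n m
partialSum-tail f≺u n zero    = z-z≺0 _
partialSum-tail {f} {u} f≺u n (suc m) =
  ≺-≡ {partialSum f (m ℕ.+ n) - partialSum f n + f (m ℕ.+ n)}
      {partialSum f (m ℕ.+ n) + f (m ℕ.+ n) - partialSum f n}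
    (λ k → shift (seq (re (partialSum f (m ℕ.+ n))) k) (seq (re (partialSum f n)) k) (seq (re (f (m ℕ.+ n))) k))
    (λ k → shift (seq (im (partialSum f (m ℕ.+ n))) k) (seq (im (partialSum f n)) k) (seq (im (f (m ℕ.+ n))) k))
    (≺-+ (partialSum-tail f≺u n m) (f≺u (m ℕ.+ n)))
  where
  open +-*-Solver
  shift : ∀ p q r → p ℚ.- q ℚ.+ r ≡ p ℚ.+ r ℚ.- q
  shift = solve 3 (λ p q r → p :- q :+ r := p :+ r :- q) refl

partialSum-diff : ∀ {f g u} → (∀ k → f k - g k ≺ u k) → ∀ n → partialSum f n - partialSum g n ≺ tail u 0 n
partialSum-diff f-g≺u zero    = z-z≺0 (nat 0)
partialSum-diff {f} {g} {u} f-g≺u (suc n) = ≺-+-diff (partialSum-diff f-g≺u n)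
  (subst (λ k → f n - g n ≺ u k) (sym (ℕₚ.+-identityʳ n)) (f-g≺u n))

partialSum-cauchy : ∀ {f u} → (∀ k → f k ≺ u k) → Summable u → ∀ ε → 0ℚ ℚ.< ε →
  Eventually (λ n → ∀ m → n ℕ.≤ m → partialSum f m - partialSum f n ≺ ε)
partialSum-cauchy {f} {u} f≺u u-summable ε ε>0 = ev-map
  (λ n h m n≤m → subst (λ k → partialSum f k - partialSum f n ≺ ε) (ℕₚ.m∸n+n≡m n≤m)
    (≺-mono (h (m ℕ.∸ n)) (partialSum-tail f≺u n (m ℕ.∸ n))))
  (u-summable ε ε>0)

abstract
  -- Opaque: the sum is used only through its convergence.
  sums-exists : ∀ {f u} → (∀ k → f k ≺ u k) → Summable u → ∃[ S ] Sums f S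
  sums-exists {f} {u} f≺u u-summable = ℂ-complete (partialSum f) λ ε ε>0 →
    let N , h = partialSum-cauchy f≺u u-summable (½ ℚ.* ε) (half ε>0)
    in N , λ m n N≤m N≤n → subst (partialSum f m - partialSum f n ≺_) (half+half ε)
         (≺-trans (h N ℕₚ.≤-refl m N≤m) (≺-swap (h N ℕₚ.≤-refl n N≤n)))

-- The majorant `w` is common to all the series, so one truncation index serves them all. `G n` is
-- reached through a partial sum so long that it is close to `G n`, its length being allowed to
-- depend on n.
sums-uniform : ∀ {g : ℕ → ℕ → ℂ} {G : ℕ → ℂ} {w : ℕ → ℚ} → (∀ n m → g n m ≺ w m) → Summable w → (∀ n → Sums (g n) (G n)) →
  ∀ ε → 0ℚ ℚ.< ε → Eventually (λ N → ∀ n → G n - partialSum (g n) N ≺ ε)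
sums-uniform {g} {G} {w} g≺w w-summable g→G ε ε>0 =
  let N₀ , h = w-summable (½ ℚ.* ε) (half ε>0)
  in N₀ , λ N N₀≤N n →
    let M , k = g→G n (½ ℚ.* ε) (half ε>0)
    in subst (G n - partialSum (g n) N ≺_) (half+half ε)
         (≺-trans (≺-swap (k (M ℕ.+ N) (ℕₚ.m≤m+n M N)))
           (≺-mono (h N N₀≤N M) (partialSum-tail (g≺w n) N M)))

-- Interchange of summations in a double series

module DoubleSeries
  {f f′ : ℕ → ℂ} {F F′ : ℂ} {u u′ : ℕ → ℚ}
  (f≺u : ∀ n → f n ≺ u n) (u-summable : Summable u) (f→F : Sums f F)
  (f′≺u′ : ∀ n → f′ n ≺ u′ n) (u′-summable : Summable u′) (f′→F′ : Sums f′ F′)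
  {g g′ : ℕ → ℕ → ℂ} {G G′ : ℕ → ℂ} {w w′ : ℕ → ℚ}
  (g≺w : ∀ n m → g n m ≺ w m) (w-summable : Summable w) (g→G : ∀ n → Sums (g n) (G n))
  (g′≺w′ : ∀ n m → g′ n m ≺ w′ m) (w′-summable : Summable w′) (g′→G′ : ∀ n → Sums (g′ n) (G′ n))
  (splits : ∀ n m → f n * g n m + f′ m * g′ m n ≋ f n * f′ m)
  where

  -- Truncating every inner series at `N` costs a uniform δ, and the weights sum to at most `U`;
  -- hence the choice δ = ε / U.
  weighted : ∀ {f : ℕ → ℂ} {u : ℕ → ℚ} {g : ℕ → ℕ → ℂ} {G : ℕ → ℂ} {w : ℕ → ℚ} → (∀ n → f n ≺ u n) → Summable u →
    (∀ n m → g n m ≺ w m) → Summable w → (∀ n → Sums (g n) (G n)) → ∀ ε → 0ℚ ℚ.< ε →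
    Eventually (λ N → partialSum (λ n → f n * G n) N - partialSum (λ n → f n * partialSum (g n) N) N ≺ ε)
  weighted {f} {u} {g} {G} f≺u u-summable g≺w w-summable g→G ε ε>0 =
    let U , U>0 , u≤U = tail-bounded (λ n → ≺-nonNeg (f≺u n)) u-summable
        U′ , U′>0 , U′U≡1 = 1/pos U>0
        δ = U′ ℚ.* ε
        δ>0 = pos* U′>0 ε>0
    in ev-map (λ N near → ≺-mono
         (begin
           tail (λ n → u n ℚ.* δ) 0 N   ≤⟨ tail-mono 0 (λ n _ → ℚₚ.≤-reflexive (ℚₚ.*-comm (u n) δ)) N ⟩
           tail (λ n → δ ℚ.* u n) 0 N   ≡⟨ tail-scale δ u 0 N ⟩
           δ ℚ.* tail u 0 N             ≤⟨ ℚₚ.*-monoˡ-≤-nonNeg δ {{ℚ.nonNegative (ℚₚ.<⇒≤ δ>0)}} (u≤U N) ⟩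
           δ ℚ.* U                      ≡⟨ ℚₚ.*-comm δ U ⟩
           U ℚ.* δ                      ≡⟨ cancel-inverse U U′ ε U′U≡1 ⟩
           ε                            ∎)
         (partialSum-diff {λ n → f n * G n} {λ n → f n * partialSum (g n) N} {λ n → u n ℚ.* δ}
           (λ n → ≺-*-diff (f≺u n) (near n)) N))
       (sums-uniform {g} {G} g≺w w-summable g→G δ δ>0)
    where open ℚₚ.≤-Reasoning

  finite : ∀ N → partialSum f N * partialSum f′ N ≋
    partialSum (λ n → f n * partialSum (g n) N) N + partialSum (λ m → f′ m * partialSum (g′ m) N) N
  finite N = ≋-sym (begin
    partialSum (λ n → f n * partialSum (g n) N) N + partialSum (λ m → f′ m * partialSum (g′ m) N) N
      ≈⟨ +-cong (partialSum-cong (λ n → partialSum-scale (f n) (g n) N) N)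
                (partialSum-cong (λ m → partialSum-scale (f′ m) (g′ m) N) N) ⟨
    partialSum (λ n → partialSum (λ m → f n * g n m) N) N + partialSum (λ m → partialSum (λ n → f′ m * g′ m n) N) N
      ≈⟨ +-cong ≋-refl (partialSum-swap (λ m n → f′ m * g′ m n) N N) ⟩
    partialSum (λ n → partialSum (λ m → f n * g n m) N) N + partialSum (λ n → partialSum (λ m → f′ m * g′ m n) N) N
      ≈⟨ partialSum-+ (λ n → partialSum (λ m → f n * g n m) N) (λ n → partialSum (λ m → f′ m * g′ m n) N) N ⟨
    partialSum (λ n → partialSum (λ m → f n * g n m) N + partialSum (λ m → f′ m * g′ m n) N) N
      ≈⟨ partialSum-cong (λ n → partialSum-+ (λ m → f n * g n m) (λ m → f′ m * g′ m n) N) N ⟨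
    partialSum (λ n → partialSum (λ m → f n * g n m + f′ m * g′ m n) N) N
      ≈⟨ partialSum-cong (λ n → partialSum-cong (splits n) N) N ⟩
    partialSum (λ n → partialSum (λ m → f n * f′ m) N) N
      ≈⟨ partialSum-* f f′ N N ⟨
    partialSum f N * partialSum f′ N ∎)
    where open ≋-Reasoning

  -- No infinite double sum is formed: on the square of indices below N both orders of summation
  -- agree by `finite`, and by `weighted` completing the truncated inner sums changes the total by
  -- an amount that tends to 0.
  sums-product : Sums (λ n → f n * G n + f′ n * G′ n) (F * F′)
  sums-product = lim-cong
    {λ N → partialSum (λ n → f n * G n) N + partialSum (λ n → f′ n * G′ n) N}
    {partialSum (λ n → f n * G n + f′ n * G′ n)} {F * F′} {F * F′}
    (λ N → ≋-sym (partialSum-+ (λ n → f n * G n) (λ n → f′ n * G′ n) N)) ≋-refl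
    (lim-approx {square} {λ N → partialSum (λ n → f n * G n) N + partialSum (λ n → f′ n * G′ n) N}
      (lim-cong {λ N → partialSum f N * partialSum f′ N} {square} finite ≋-refl
        (lim-* {partialSum f} {partialSum f′} f→F f′→F′))
      λ ε ε>0 → ev-zip
        (λ N d e → subst (partialSum (λ n → f n * G n) N + partialSum (λ n → f′ n * G′ n) N - square N ≺_)
          (half+half ε) (≺-+-diff d e))
        (weighted {f} {u} {g} {G} f≺u u-summable g≺w w-summable g→G (½ ℚ.* ε) (half ε>0))
        (weighted {f′} {u′} {g′} {G′} f′≺u′ u′-summable g′≺w′ w′-summable g′→G′ (½ ℚ.* ε) (half ε>0)))
    where
    square : ℕ → ℂ
    square N = partialSum (λ n → f n * partialSum (g n) N) N + partialSum (λ m → f′ m * partialSum (g′ m) N) N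

-- The growth condition

0≤^ : ∀ {p} n → 0ℚ ℚ.≤ p → 0ℚ ℚ.≤ p ^ℚ n
0≤^ zero    p≥0 = ℚₚ.<⇒≤ 0<1
0≤^ (suc n) p≥0 = 0≤* p≥0 (0≤^ n p≥0)

^-mono : ∀ {p q} n → 0ℚ ℚ.≤ p → p ℚ.≤ q → p ^ℚ n ℚ.≤ q ^ℚ n
^-mono zero    p≥0 p≤q = ℚₚ.≤-refl
^-mono (suc n) p≥0 p≤q = *-mono p≥0 (0≤^ n (ℚₚ.≤-trans p≥0 p≤q)) p≤q (^-mono n p≥0 p≤q)

-- Takes the place of extracting roots, which need not be rational.
^-cancel : ∀ {p q} n → 0ℚ ℚ.≤ q → p ^ℚ suc n ℚ.≤ q ^ℚ suc n → p ℚ.≤ q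
^-cancel {p} {q} n q≥0 pⁿ≤qⁿ = ℚₚ.≮⇒≥ λ q<p → ℚₚ.<-irrefl refl (begin-strict
  q ℚ.* q ^ℚ n   ≤⟨ ℚₚ.*-monoˡ-≤-nonNeg q {{ℚ.nonNegative q≥0}} (^-mono n q≥0 (ℚₚ.<⇒≤ q<p)) ⟩
  q ℚ.* p ^ℚ n   <⟨ ℚₚ.*-monoˡ-<-pos (p ^ℚ n) {{ℚ.positive (0<^ n (ℚₚ.≤-<-trans q≥0 q<p))}} q<p ⟩
  p ℚ.* p ^ℚ n   ≤⟨ pⁿ≤qⁿ ⟩
  q ℚ.* q ^ℚ n   ∎)
  where open ℚₚ.≤-Reasoning

seq-^ : ∀ x n j → seq (x ^ᵣ n) j ≡ seq x j ^ℚ n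
seq-^ x zero    j = refl
seq-^ x (suc n) j = cong (seq x j ℚ.*_) (seq-^ x n j)

-- The rational bound on the exponent c may be negative; b^p is then at most 1.
^ℤ-≤ : ∀ b .{{_ : ℕ.NonZero b}} p d → p ℤ.≤ + d → b ^ℤ p ℚ.≤ ⌜ b ℕ.^ d ⌝
^ℤ-≤ b (+ m)    d (ℤ.+≤+ m≤d) = ⌜⌝-mono {b ℕ.^ m} {b ℕ.^ d} (ℕₚ.^-monoʳ-≤ b m≤d)
^ℤ-≤ b -[1+ m ] d _           = ℚₚ.≤-trans (1/≤1 (b ℕ.^ suc m) {{ℕₚ.m^n≢0 b (suc m)}})
  (⌜⌝-mono {1} {b ℕ.^ d} (ℕₚ.m^n>0 b d))
  where
  1/≤1 : ∀ n .{{_ : ℕ.NonZero n}} → + 1 ℚ./ n ℚ.≤ 1ℚ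
  1/≤1 (suc n) = Leibniz./-mono (+ 1) (+ 1) n 0 (ℤₚ.*-monoˡ-≤-nonNeg (+ 1) (ℤ.+≤+ (ℕ.s≤s ℕ.z≤n)))

-- The bound k^(d/(d+1)) ≤ k / 2^i without roots: after cancelling k^d it says 2^(i(d+1)) ≤ k.
level-power : ∀ d i k → (2 ℕ.^ suc d) ℕ.^ i ℕ.≤ k → ⌜ k ℕ.^ d ⌝ ℚ.≤ (⌜ k ⌝ ℚ.* ½ ^ℚ i) ^ℚ suc d
level-power d i k Qⁱ≤k = begin
  ⌜ k ℕ.^ d ⌝                                   ≡⟨ ⌜⌝-^ k d ⟩
  ⌜ k ⌝ ^ℚ d                                    ≡⟨ ℚₚ.*-identityʳ (⌜ k ⌝ ^ℚ d) ⟨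
  ⌜ k ⌝ ^ℚ d ℚ.* 1ℚ                             ≡⟨ cong (⌜ k ⌝ ^ℚ d ℚ.*_) Ee≡1 ⟨
  ⌜ k ⌝ ^ℚ d ℚ.* (E ℚ.* e)                      ≤⟨ ℚₚ.*-monoˡ-≤-nonNeg (⌜ k ⌝ ^ℚ d) {{ℚ.nonNegative (0≤^ d (0≤⌜⌝ k))}}
                                                     (ℚₚ.*-monoʳ-≤-nonNeg e {{ℚ.nonNegative (0≤^ (suc d) (0≤^ i (ℚₚ.nonNegative⁻¹ ½)))}}
                                                       (⌜⌝-mono Qⁱ≤k)) ⟩
  ⌜ k ⌝ ^ℚ d ℚ.* (⌜ k ⌝ ℚ.* e)                  ≡⟨ solve 3 (λ a b c → a :* (b :* c) := b :* a :* c) refl (⌜ k ⌝ ^ℚ d) ⌜ k ⌝ e ⟩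
  ⌜ k ⌝ ^ℚ suc d ℚ.* e                          ≡⟨ ^-distrib-* ⌜ k ⌝ (½ ^ℚ i) (suc d) ⟨
  (⌜ k ⌝ ℚ.* ½ ^ℚ i) ^ℚ suc d                   ∎
  where
  open ℚₚ.≤-Reasoning
  open +-*-Solver
  E = ⌜ (2 ℕ.^ suc d) ℕ.^ i ⌝
  e = (½ ^ℚ i) ^ℚ suc d
  Ee≡1 : E ℚ.* e ≡ 1ℚ
  Ee≡1 = trans (cong₂ ℚ._*_
      (trans (⌜⌝-^ (2 ℕ.^ suc d) i) (trans (cong (_^ℚ i) (⌜⌝-^ 2 (suc d))) (^-assocʳ ⌜ 2 ⌝ (suc d) i)))
      (trans (^-assocʳ ½ i (suc d)) (cong (½ ^ℚ_) (ℕₚ.*-comm i (suc d)))))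
    (^-inverse ⌜ 2 ⌝ ½ (suc d ℕ.* i) refl)

∣∣≤-cases : ∀ {p q} → p ℚ.≤ q → ℚ.- p ℚ.≤ q → ℚ.∣ p ∣ ℚ.≤ q
∣∣≤-cases {p} {q} p≤q -p≤q with ℚₚ.∣p∣≡p∨∣p∣≡-p p
... | inj₁ e = subst (ℚ._≤ q) (sym e) p≤q
... | inj₂ e = subst (ℚ._≤ q) (sym e) -p≤q

-- Each inequality of reals has a slack, chosen here as large as the bound it belongs to. So v^(d+1)
-- ≤ 2 w^(d+1) gives |v| ≤ 2 w, then |z|² ≤ 5 w² ≤ (3 w)², hence 3 w for each coordinate and 6 w for
-- `ν`.
growth-≺ : ∀ {z v w d β} → 0ℚ ℚ.< w → 0ᵣ ≤ᵣ v → v ^ᵣ suc d ≤ᵣ ratᵣ β → β ℚ.≤ w ^ℚ suc d →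
           ∣ z ∣≤ (ratᵣ 1ℚ *ᵣ v) → z ≺ ⌜ 6 ⌝ ℚ.* w
growth-≺ {z} {v} {w} {d} {β} w>0 v≥0 vᵈ≤β β≤wᵈ (_ , z≤v) = bound
  (ev-zip (λ j v≤2w normSq≤ → final j (square j v≤2w normSq≤))
    (ev-zip ∣v∣≤2w (v≥0 w w>0) (vᵈ≤β (w ^ℚ suc d) (0<^ (suc d) w>0)))
    (z≤v (w ℚ.* w) (pos* w>0 w>0)))
  where
  open ℚₚ.≤-Reasoning
  open +-*-Solver
  w≥0 = ℚₚ.<⇒≤ w>0
  2w≥0 : 0ℚ ℚ.≤ w ℚ.+ w
  2w≥0 = 0≤+ w≥0 w≥0
  3w≥0 : 0ℚ ℚ.≤ w ℚ.+ w ℚ.+ w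
  3w≥0 = 0≤+ 2w≥0 w≥0

  ∣v∣≤2w : ∀ j → 0ℚ ℚ.≤ seq v j ℚ.+ w → seq (v ^ᵣ suc d) j ℚ.≤ β ℚ.+ w ^ℚ suc d → ℚ.∣ seq v j ∣ ℚ.≤ w ℚ.+ w
  ∣v∣≤2w j 0≤v+w vᵈ≤ = ∣∣≤-cases
    (^-cancel d 2w≥0 (begin
      seq v j ^ℚ suc d               ≡⟨ seq-^ v (suc d) j ⟨
      seq (v ^ᵣ suc d) j             ≤⟨ vᵈ≤ ⟩
      β ℚ.+ w ^ℚ suc d               ≤⟨ ℚₚ.+-monoˡ-≤ (w ^ℚ suc d) β≤wᵈ ⟩
      w ^ℚ suc d ℚ.+ w ^ℚ suc d      ≡⟨ ℚₚ.*-distribʳ-+ (w ^ℚ d) w w ⟨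
      (w ℚ.+ w) ℚ.* w ^ℚ d           ≤⟨ ℚₚ.*-monoˡ-≤-nonNeg (w ℚ.+ w) {{ℚ.nonNegative 2w≥0}} (^-mono d w≥0 (p≤p+q w w≥0)) ⟩
      (w ℚ.+ w) ^ℚ suc d             ∎))
    (begin
      ℚ.- seq v j                            ≡⟨ ℚₚ.+-identityʳ (ℚ.- seq v j) ⟨
      ℚ.- seq v j ℚ.+ 0ℚ                     ≤⟨ ℚₚ.+-monoʳ-≤ (ℚ.- seq v j) 0≤v+w ⟩
      ℚ.- seq v j ℚ.+ (seq v j ℚ.+ w)        ≡⟨ solve 2 (λ v w → :- v :+ (v :+ w) := w) refl (seq v j) w ⟩
      w                                      ≤⟨ p≤p+q w w≥0 ⟩
      w ℚ.+ w                                ∎)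

  square : ∀ j → ℚ.∣ seq v j ∣ ℚ.≤ w ℚ.+ w →
    seq (normSq z) j ℚ.≤ 1ℚ ℚ.* seq v j ℚ.* (1ℚ ℚ.* seq v j) ℚ.+ w ℚ.* w →
    seq (normSq z) j ℚ.≤ (w ℚ.+ w ℚ.+ w) ℚ.* (w ℚ.+ w ℚ.+ w)
  square j v≤2w normSq≤ = begin
    seq (normSq z) j
      ≤⟨ normSq≤ ⟩
    1ℚ ℚ.* seq v j ℚ.* (1ℚ ℚ.* seq v j) ℚ.+ w ℚ.* w
      ≡⟨ cong (ℚ._+ w ℚ.* w) (solve 1 (λ v → con 1ℚ :* v :* (con 1ℚ :* v) := v :* v) refl (seq v j)) ⟩
    seq v j ℚ.* seq v j ℚ.+ w ℚ.* w
      ≡⟨ cong (ℚ._+ w ℚ.* w) (∣p∣*∣p∣ (seq v j)) ⟨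
    ℚ.∣ seq v j ∣ ℚ.* ℚ.∣ seq v j ∣ ℚ.+ w ℚ.* w
      ≤⟨ ℚₚ.+-monoˡ-≤ (w ℚ.* w) (*-mono 0≤∣ seq v j ∣ 2w≥0 v≤2w v≤2w) ⟩
    (w ℚ.+ w) ℚ.* (w ℚ.+ w) ℚ.+ w ℚ.* w
      ≤⟨ p≤p+q _ (0≤* 2w≥0 2w≥0) ⟩
    (w ℚ.+ w) ℚ.* (w ℚ.+ w) ℚ.+ w ℚ.* w ℚ.+ (w ℚ.+ w) ℚ.* (w ℚ.+ w)
      ≡⟨ solve 1 (λ w → (w :+ w) :* (w :+ w) :+ w :* w :+ (w :+ w) :* (w :+ w) := (w :+ w :+ w) :* (w :+ w :+ w)) refl w ⟩
    (w ℚ.+ w ℚ.+ w) ℚ.* (w ℚ.+ w ℚ.+ w) ∎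

  root : ∀ p q → p ℚ.* p ℚ.+ q ℚ.* q ℚ.≤ (w ℚ.+ w ℚ.+ w) ℚ.* (w ℚ.+ w ℚ.+ w) → ℚ.∣ p ∣ ℚ.≤ w ℚ.+ w ℚ.+ w
  root p q h = ^-cancel 1 3w≥0 (begin
    ℚ.∣ p ∣ ℚ.* (ℚ.∣ p ∣ ℚ.* 1ℚ)                        ≡⟨ cong (ℚ.∣ p ∣ ℚ.*_) (ℚₚ.*-identityʳ ℚ.∣ p ∣) ⟩
    ℚ.∣ p ∣ ℚ.* ℚ.∣ p ∣                                 ≡⟨ ∣p∣*∣p∣ p ⟩
    p ℚ.* p                                             ≤⟨ p≤p+q (p ℚ.* p) (Apartness.0≤q*q q) ⟩
    p ℚ.* p ℚ.+ q ℚ.* q                                 ≤⟨ h ⟩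
    (w ℚ.+ w ℚ.+ w) ℚ.* (w ℚ.+ w ℚ.+ w)                 ≡⟨ cong ((w ℚ.+ w ℚ.+ w) ℚ.*_) (ℚₚ.*-identityʳ (w ℚ.+ w ℚ.+ w)) ⟨
    (w ℚ.+ w ℚ.+ w) ℚ.* ((w ℚ.+ w ℚ.+ w) ℚ.* 1ℚ)        ∎)

  final : ∀ j → seq (normSq z) j ℚ.≤ (w ℚ.+ w ℚ.+ w) ℚ.* (w ℚ.+ w ℚ.+ w) → ν z j ℚ.≤ ⌜ 6 ⌝ ℚ.* w
  final j h = begin
    ν z j                                     ≤⟨ ℚₚ.+-mono-≤ (root a b h) (root b a (subst (ℚ._≤ _) (ℚₚ.+-comm (a ℚ.* a) (b ℚ.* b)) h)) ⟩
    (w ℚ.+ w ℚ.+ w) ℚ.+ (w ℚ.+ w ℚ.+ w)       ≡⟨ solve 1 (λ w → (w :+ w :+ w) :+ (w :+ w :+ w) := con ⌜ 6 ⌝ :* w) refl w ⟩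
    ⌜ 6 ⌝ ℚ.* w                               ∎
    where a = seq (re z) j ; b = seq (im z) j

sublinear-≺ : ∀ {A} → SublinearGrowth A → ∃[ d ] ∃[ K ] ∀ n i → K ℕ.≤ suc n → (2 ℕ.^ suc d) ℕ.^ i ℕ.≤ suc n →
  A (+ suc n) ≺ ⌜ 6 ⌝ ℚ.* (⌜ suc n ⌝ ℚ.* ½ ^ℚ i)
sublinear-≺ {A} (c , (ε , ε>0 , N , c+ε≤1) , small) =
  let K , h = small 1ℚ 0<1
  in d , K , λ n i K≤n Qⁱ≤n →
    let v , v-pow , A≤v = h (+ suc n) K≤n
    in growth-≺ {A (+ suc n)} {v} {d = d} {suc n ^ℤ (ℚ.↥ t)} (pos* (0<⌜suc⌝ n) (0<^ i (ℚₚ.positive⁻¹ ½)))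
         (IsPow.nonneg v-pow) (IsPow.upper v-pow t c≤t)
         (ℚₚ.≤-trans (^ℤ-≤ (suc n) (ℚ.↥ t) d ↥t≤d) (level-power d i (suc n) Qⁱ≤n)) A≤v
  where
  open ℚₚ.≤-Reasoning
  open +-*-Solver
  -- The gap between c and 1 provides a rational t with c ≤ t < 1. With denominator d + 1 its
  -- numerator is at most d, so t ≤ d/(d+1).
  t = 1ℚ ℚ.- ε
  d = ℚ.denominator-1 t
  t<1 : t ℚ.< 1ℚ
  t<1 = subst (t ℚ.<_) (ℚₚ.+-identityʳ 1ℚ) (ℚₚ.+-monoʳ-< 1ℚ (ℚₚ.neg-antimono-< ε>0))
  ↥t≤d : ℚ.↥ t ℤ.≤ + d
  ↥t≤d = <suc⇒≤ (subst (ℤ._< + suc d) (ℤₚ.*-identityʳ (ℚ.↥ t))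
    (subst ((ℚ.↥ t) ℤ.* + 1 ℤ.<_) (ℤₚ.*-identityˡ (+ suc d)) (ℚₚ.drop-*<* t<1)))
    where
    <suc⇒≤ : ∀ {i d} → i ℤ.< + suc d → i ℤ.≤ + d
    <suc⇒≤ {+ _}      (ℤ.+<+ (ℕ.s≤s m≤d)) = ℤ.+≤+ m≤d
    <suc⇒≤ { -[1+ _ ]} _                  = ℤ.-≤+
  c≤t : c ≤ᵣ ratᵣ t
  c≤t δ δ>0 = N , λ n N≤n → begin
    seq c n                       ≡⟨ solve 2 (λ c e → c := c :+ e :- e) refl (seq c n) ε ⟩
    seq c n ℚ.+ ε ℚ.- ε           ≤⟨ ℚₚ.+-monoˡ-≤ (ℚ.- ε) (c+ε≤1 n N≤n) ⟩
    1ℚ ℚ.- ε                      ≤⟨ p≤p+q (1ℚ ℚ.- ε) (ℚₚ.<⇒≤ δ>0) ⟩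
    t ℚ.+ δ                       ∎

-- Convergence of the majorant series

⌜⌝-suc : ∀ n → ⌜ suc n ⌝ ≡ ⌜ n ⌝ ℚ.+ 1ℚ
⌜⌝-suc n = ℚₚ.toℚᵘ-injective (begin
  ℚ.toℚᵘ ⌜ suc n ⌝                         ≈⟨ ℚₚ.toℚᵘ-fromℚᵘ (ℚᵘ.mkℚᵘ (+ suc n) 0) ⟩
  ℚᵘ.mkℚᵘ (+ suc n) 0                      ≈⟨ ℚᵘ.*≡* (cong (ℤ._* + 1) numerators) ⟩
  ℚᵘ.mkℚᵘ (+ n) 0 ℚᵘ.+ ℚᵘ.1ℚᵘ              ≈⟨ ℚᵘₚ.+-cong (ℚₚ.toℚᵘ-fromℚᵘ (ℚᵘ.mkℚᵘ (+ n) 0)) ℚᵘₚ.≃-refl ⟨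
  ℚ.toℚᵘ ⌜ n ⌝ ℚᵘ.+ ℚ.toℚᵘ 1ℚ              ≈⟨ ℚₚ.toℚᵘ-homo-+ ⌜ n ⌝ 1ℚ ⟨
  ℚ.toℚᵘ (⌜ n ⌝ ℚ.+ 1ℚ)                    ∎)
  where
  open Relation.Binary.Reasoning.Setoid ℚᵘₚ.≃-setoid
  numerators : + suc n ≡ + n ℤ.* + 1 ℤ.+ + 1 ℤ.* + 1
  numerators = trans (cong +_ (ℕₚ.+-comm 1 n)) (cong (ℤ._+ + 1) (sym (ℤₚ.*-identityʳ (+ n))))

tail-const : ∀ b n m → tail (λ _ → b) n m ≡ ⌜ m ⌝ ℚ.* b
tail-const b n zero    = sym (ℚₚ.*-zeroˡ b)
tail-const b n (suc m) = trans (cong (ℚ._+ b) (tail-const b n m)) (sym (trans (cong (ℚ._* b) (⌜⌝-suc m))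
  (solve 2 (λ m b → (m :+ con 1ℚ) :* b := m :* b :+ b) refl ⌜ m ⌝ b)))
  where open +-*-Solver

-- A condensation argument with ratio `Q`, where `g` is 1/Q: from Q^i on the terms are at most C /
-- (2Q)^i, so Q^(i+1) of them add up to at most C Q / 2^i.
module Blocks
  {u : ℕ → ℚ} {C} (C≥0 : 0ℚ ℚ.≤ C) (K Q : ℕ) .{{_ : ℕ.NonZero Q}} {g} (g≥0 : 0ℚ ℚ.≤ g) (Qg≡1 : ⌜ Q ⌝ ℚ.* g ≡ 1ℚ)
  (u≤ : ∀ n i → K ℕ.≤ n → Q ℕ.^ i ℕ.≤ n → u n ℚ.≤ C ℚ.* (½ ^ℚ i ℚ.* g ^ℚ i))
  where

  CQ : ℚ
  CQ = C ℚ.* ⌜ Q ⌝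

  CQ≥0 : 0ℚ ℚ.≤ CQ
  CQ≥0 = 0≤* C≥0 (0≤⌜⌝ Q)

  ½^≥0 : ∀ i → 0ℚ ℚ.≤ ½ ^ℚ i
  ½^≥0 i = 0≤^ i (ℚₚ.nonNegative⁻¹ ½)

  open ℚₚ.≤-Reasoning
  open +-*-Solver

  block : ∀ m n i → m ℕ.≤ Q ℕ.^ suc i → K ℕ.≤ n → Q ℕ.^ i ℕ.≤ n → tail u n m ℚ.≤ CQ ℚ.* ½ ^ℚ i
  block m n i m≤Q K≤n Qⁱ≤n = begin
    tail u n m
      ≤⟨ tail-mono n (λ k n≤k → u≤ k i (ℕₚ.≤-trans K≤n n≤k) (ℕₚ.≤-trans Qⁱ≤n n≤k)) m ⟩
    tail (λ _ → C ℚ.* (½ ^ℚ i ℚ.* g ^ℚ i)) n m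
      ≡⟨ tail-const (C ℚ.* (½ ^ℚ i ℚ.* g ^ℚ i)) n m ⟩
    ⌜ m ⌝ ℚ.* (C ℚ.* (½ ^ℚ i ℚ.* g ^ℚ i))
      ≤⟨ ℚₚ.*-monoʳ-≤-nonNeg (C ℚ.* (½ ^ℚ i ℚ.* g ^ℚ i)) {{ℚ.nonNegative (0≤* C≥0 (0≤* (½^≥0 i) (0≤^ i g≥0)))}}
           (⌜⌝-mono m≤Q) ⟩
    ⌜ Q ℕ.^ suc i ⌝ ℚ.* (C ℚ.* (½ ^ℚ i ℚ.* g ^ℚ i))
      ≡⟨ cong (ℚ._* (C ℚ.* (½ ^ℚ i ℚ.* g ^ℚ i))) (⌜⌝-^ Q (suc i)) ⟩
    ⌜ Q ⌝ ℚ.* ⌜ Q ⌝ ^ℚ i ℚ.* (C ℚ.* (½ ^ℚ i ℚ.* g ^ℚ i))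
      ≡⟨ solve 5 (λ q qi c h gi → q :* qi :* (c :* (h :* gi)) := c :* q :* h :* (qi :* gi)) refl
           ⌜ Q ⌝ (⌜ Q ⌝ ^ℚ i) C (½ ^ℚ i) (g ^ℚ i) ⟩
    CQ ℚ.* ½ ^ℚ i ℚ.* (⌜ Q ⌝ ^ℚ i ℚ.* g ^ℚ i)
      ≡⟨ cong (CQ ℚ.* ½ ^ℚ i ℚ.*_) (^-inverse ⌜ Q ⌝ g i Qg≡1) ⟩
    CQ ℚ.* ½ ^ℚ i ℚ.* 1ℚ
      ≡⟨ ℚₚ.*-identityʳ (CQ ℚ.* ½ ^ℚ i) ⟩
    CQ ℚ.* ½ ^ℚ i ∎

  -- Past a block of Q^(i+1) terms the starting index is at least Q^(i+1), so the level i rises by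
  -- one and the bound halves; the geometric series totals twice its first term. `fuel` makes the
  -- recursion structural, as each nonempty block shortens the tail.
  tail-≤ : ∀ fuel m n i → m ℕ.≤ fuel → K ℕ.≤ n → Q ℕ.^ i ℕ.≤ n → tail u n m ℚ.≤ CQ ℚ.* (½ ^ℚ i ℚ.+ ½ ^ℚ i)
  tail-≤ fuel m n i m≤fuel K≤n Qⁱ≤n with ℕₚ.≤-total m (Q ℕ.^ suc i)
  ... | inj₁ m≤Q = ℚₚ.≤-trans (block m n i m≤Q K≤n Qⁱ≤n)
    (ℚₚ.*-monoˡ-≤-nonNeg CQ {{ℚ.nonNegative CQ≥0}} (p≤p+q (½ ^ℚ i) (½^≥0 i)))
  tail-≤ zero zero n i _ K≤n Qⁱ≤n | inj₂ _ = 0≤* CQ≥0 (0≤+ (½^≥0 i) (½^≥0 i))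
  tail-≤ (suc fuel) m n i m≤fuel K≤n Qⁱ≤n | inj₂ Q≤m = begin
    tail u n m
      ≡⟨ cong (tail u n) (ℕₚ.m∸n+n≡m Q≤m) ⟨
    tail u n (m ℕ.∸ Q ℕ.^ suc i ℕ.+ Q ℕ.^ suc i)
      ≡⟨ tail-split u n (Q ℕ.^ suc i) (m ℕ.∸ Q ℕ.^ suc i) ⟩
    tail u n (Q ℕ.^ suc i) ℚ.+ tail u (Q ℕ.^ suc i ℕ.+ n) (m ℕ.∸ Q ℕ.^ suc i)
      ≤⟨ ℚₚ.+-mono-≤ (block (Q ℕ.^ suc i) n i ℕₚ.≤-refl K≤n Qⁱ≤n)
           (tail-≤ fuel (m ℕ.∸ Q ℕ.^ suc i) (Q ℕ.^ suc i ℕ.+ n) (suc i)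
             (ℕₚ.≤-trans (ℕₚ.∸-mono m≤fuel (ℕₚ.m^n>0 Q (suc i))) ℕₚ.≤-refl)
             (ℕₚ.≤-trans K≤n (ℕₚ.m≤n+m n (Q ℕ.^ suc i)))
             (ℕₚ.m≤m+n (Q ℕ.^ suc i) n)) ⟩
    CQ ℚ.* ½ ^ℚ i ℚ.+ CQ ℚ.* (½ ℚ.* ½ ^ℚ i ℚ.+ ½ ℚ.* ½ ^ℚ i)
      ≡⟨ solve 2 (λ c h → c :* h :+ c :* (con ½ :* h :+ con ½ :* h) := c :* (h :+ h)) refl CQ (½ ^ℚ i) ⟩
    CQ ℚ.* (½ ^ℚ i ℚ.+ ½ ^ℚ i) ∎

  summable : Summable u
  summable ε ε>0 =
    -- The summand 1 makes `c` positive, hence invertible, even when `CQ` is 0.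
    let c = CQ ℚ.+ CQ ℚ.+ 1ℚ
        c>0 = ℚₚ.<-≤-trans 0<1 (q≤p+q 1ℚ (0≤+ CQ≥0 CQ≥0))
        c′ , c′>0 , c′c≡1 = 1/pos c>0
        i , small = ev-witness (½^-small (c′ ℚ.* ε) (pos* c′>0 ε>0))
    in K ℕ.⊔ Q ℕ.^ i , λ n ≤n m → begin
      tail u n m
        ≤⟨ tail-≤ m m n i ℕₚ.≤-refl (ℕₚ.m⊔n≤o⇒m≤o K (Q ℕ.^ i) ≤n) (ℕₚ.m⊔n≤o⇒n≤o K (Q ℕ.^ i) ≤n) ⟩
      CQ ℚ.* (½ ^ℚ i ℚ.+ ½ ^ℚ i)
        ≤⟨ p≤p+q _ (½^≥0 i) ⟩
      CQ ℚ.* (½ ^ℚ i ℚ.+ ½ ^ℚ i) ℚ.+ ½ ^ℚ i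
        ≡⟨ solve 2 (λ c h → c :* (h :+ h) :+ h := (c :+ c :+ con 1ℚ) :* h) refl CQ (½ ^ℚ i) ⟩
      c ℚ.* ½ ^ℚ i
        ≤⟨ ℚₚ.*-monoˡ-≤-nonNeg c {{ℚ.nonNegative (ℚₚ.<⇒≤ c>0)}} small ⟩
      c ℚ.* (c′ ℚ.* ε)
        ≡⟨ cancel-inverse c c′ ε c′c≡1 ⟩
      ε ∎

-- A least rational bound cannot be chosen in general. Reading off one term that is settled within ½
-- gives a bound that exceeds any other by at most 1.
size : (x : ℝ) → ∃[ a ] Eventually (λ n → ℚ.∣ seq x n ∣ ℚ.≤ a) ×
  (∀ q → Eventually (λ n → ℚ.∣ seq x n ∣ ℚ.≤ q) → a ℚ.≤ q ℚ.+ 1ℚ)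
size x =
  let N , h = cauchy x ½ (ℚₚ.positive⁻¹ ½)
  in ℚ.∣ seq x N ∣ ℚ.+ ½
   , (N , λ n N≤n → begin
       ℚ.∣ seq x n ∣                                ≡⟨ Inverse.∣-0∣ (seq x n) ⟨
       ℚ.∣ seq x n ℚ.- 0ℚ ∣                         ≤⟨ ∣∣-triangle (seq x n) (seq x N) 0ℚ ⟩
       ℚ.∣ seq x n ℚ.- seq x N ∣ ℚ.+ ℚ.∣ seq x N ℚ.- 0ℚ ∣
         ≤⟨ ℚₚ.+-mono-≤ (h n N N≤n ℕₚ.≤-refl) (ℚₚ.≤-reflexive (Inverse.∣-0∣ (seq x N))) ⟩
       ½ ℚ.+ ℚ.∣ seq x N ∣                          ≡⟨ ℚₚ.+-comm ½ ℚ.∣ seq x N ∣ ⟩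
       ℚ.∣ seq x N ∣ ℚ.+ ½                          ∎)
   , λ q x≤q →
       let n , xₙ≤q , N≤n = ev-witness (ev-zip {R = λ n → ℚ.∣ seq x n ∣ ℚ.≤ q × N ℕ.≤ n} (λ _ → _,_) x≤q (N , λ _ ≤n → ≤n))
       in begin
         ℚ.∣ seq x N ∣ ℚ.+ ½                          ≡⟨ cong (ℚ._+ ½) (Inverse.∣-0∣ (seq x N)) ⟨
         ℚ.∣ seq x N ℚ.- 0ℚ ∣ ℚ.+ ½                   ≤⟨ ℚₚ.+-monoˡ-≤ ½ (∣∣-triangle (seq x N) (seq x n) 0ℚ) ⟩
         ℚ.∣ seq x N ℚ.- seq x n ∣ ℚ.+ ℚ.∣ seq x n ℚ.- 0ℚ ∣ ℚ.+ ½
           ≤⟨ ℚₚ.+-monoˡ-≤ ½ (ℚₚ.+-mono-≤ (h N n ℕₚ.≤-refl N≤n)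
                (ℚₚ.≤-trans (ℚₚ.≤-reflexive (Inverse.∣-0∣ (seq x n))) xₙ≤q)) ⟩
         ½ ℚ.+ q ℚ.+ ½                                ≡⟨ solve 1 (λ q → con ½ :+ q :+ con ½ := q :+ con 1ℚ) refl q ⟩
         q ℚ.+ 1ℚ                                     ∎
  where open ℚₚ.≤-Reasoning
        open +-*-Solver

ℂ-size : (z : ℂ) → ∃[ a ] z ≺ a × (∀ q → z ≺ q → a ℚ.≤ (q ℚ.+ 1ℚ) ℚ.+ (q ℚ.+ 1ℚ))
ℂ-size z =
  let a , re≤a , a-least = size (re z)
      b , im≤b , b-least = size (im z)
  in a ℚ.+ b , bound (ev-zip (λ n → ℚₚ.+-mono-≤ {ℚ.∣ seq (re z) n ∣} {a} {ℚ.∣ seq (im z) n ∣} {b}) re≤a im≤b) , λ q z≺q →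
    ℚₚ.+-mono-≤ {a} {q ℚ.+ 1ℚ} {b} {q ℚ.+ 1ℚ}
      (a-least q (ev-map (λ n → ℚₚ.≤-trans (p≤p+q ℚ.∣ seq (re z) n ∣ 0≤∣ seq (im z) n ∣)) (ν-bound z≺q)))
      (b-least q (ev-map (λ n → ℚₚ.≤-trans (q≤p+q ℚ.∣ seq (im z) n ∣ 0≤∣ seq (re z) n ∣)) (ν-bound z≺q)))

recipℕ : ℕ → ℚ
recipℕ n = proj₁ (1/pos (0<⌜suc⌝ n))

recipℕ>0 : ∀ n → 0ℚ ℚ.< recipℕ n
recipℕ>0 n = proj₁ (proj₂ (1/pos (0<⌜suc⌝ n)))

recipℕ-inverse : ∀ n → recipℕ n ℚ.* ⌜ suc n ⌝ ≡ 1ℚ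
recipℕ-inverse n = proj₂ (proj₂ (1/pos (0<⌜suc⌝ n)))

-- The growth estimate holds for every level i with Q^i ≤ n, whereas α n has to be a single number.
-- The nearly least bound of `ℂ-size` is comparable with all these estimates at once.
majorant : ∀ {A} → SublinearGrowth A →
  ∃[ α ] (∀ n → A (+ suc n) ≺ α n) × Summable (λ n → recipℕ n ℚ.* recipℕ n ℚ.* α n)
majorant {A} growth =
  let d , K , A≺ = sublinear-≺ {A} growth
      α = λ n → proj₁ (ℂ-size (A (+ suc n)))
      g , g>0 , gQ≡1 = 1/pos (0<Q d)
  in α , (λ n → proj₁ (proj₂ (ℂ-size (A (+ suc n)))))
   -- With w = (n + 1)/2^i the bound of `ℂ-size` is 2 (6 w + 1), and 1 ≤ w turns it into 14 w.
   , Blocks.summable {λ n → recipℕ n ℚ.* recipℕ n ℚ.* α n} {⌜ 14 ⌝} (0≤⌜⌝ 14) K (2 ℕ.^ suc d) {{ℕₚ.m^n≢0 2 (suc d)}}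
       {g} (ℚₚ.<⇒≤ g>0) (trans (ℚₚ.*-comm ⌜ 2 ℕ.^ suc d ⌝ g) gQ≡1)
       λ n i K≤n Qⁱ≤n → small d n i (α n) g (ℚₚ.<⇒≤ g>0) gQ≡1 (ℕₚ.m≤n⇒m≤1+n Qⁱ≤n)
         (proj₂ (proj₂ (ℂ-size (A (+ suc n)))) _ (A≺ n i (ℕₚ.m≤n⇒m≤1+n K≤n) (ℕₚ.m≤n⇒m≤1+n Qⁱ≤n)))
  where
  open ℚₚ.≤-Reasoning
  open +-*-Solver
  0<Q : ∀ d → 0ℚ ℚ.< ⌜ 2 ℕ.^ suc d ⌝
  0<Q d = subst (0ℚ ℚ.<_) (sym (⌜⌝-^ 2 (suc d))) (0<^ (suc d) (0<⌜suc⌝ 1))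
  small : ∀ d n i α g → 0ℚ ℚ.≤ g → g ℚ.* ⌜ 2 ℕ.^ suc d ⌝ ≡ 1ℚ → (2 ℕ.^ suc d) ℕ.^ i ℕ.≤ suc n →
    let w = ⌜ suc n ⌝ ℚ.* ½ ^ℚ i in
    α ℚ.≤ (⌜ 6 ⌝ ℚ.* w ℚ.+ 1ℚ) ℚ.+ (⌜ 6 ⌝ ℚ.* w ℚ.+ 1ℚ) →
    recipℕ n ℚ.* recipℕ n ℚ.* α ℚ.≤ ⌜ 14 ⌝ ℚ.* (½ ^ℚ i ℚ.* g ^ℚ i)
  small d n i α g g≥0 gQ≡1 Qⁱ≤n α≤ = begin
    r ℚ.* r ℚ.* α
      ≤⟨ scale rr≥0 α≤ ⟩
    r ℚ.* r ℚ.* ((⌜ 6 ⌝ ℚ.* w ℚ.+ 1ℚ) ℚ.+ (⌜ 6 ⌝ ℚ.* w ℚ.+ 1ℚ))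
      ≤⟨ scale rr≥0 (ℚₚ.+-mono-≤ (ℚₚ.+-monoʳ-≤ (⌜ 6 ⌝ ℚ.* w) 1≤w) (ℚₚ.+-monoʳ-≤ (⌜ 6 ⌝ ℚ.* w) 1≤w)) ⟩
    r ℚ.* r ℚ.* ((⌜ 6 ⌝ ℚ.* w ℚ.+ w) ℚ.+ (⌜ 6 ⌝ ℚ.* w ℚ.+ w))
      ≡⟨ solve 3 (λ r k h → r :* r :* ((con ⌜ 6 ⌝ :* (k :* h) :+ k :* h) :+ (con ⌜ 6 ⌝ :* (k :* h) :+ k :* h))
           := con ⌜ 14 ⌝ :* (h :* (r :* (r :* k)))) refl r ⌜ suc n ⌝ (½ ^ℚ i) ⟩
    ⌜ 14 ⌝ ℚ.* (½ ^ℚ i ℚ.* (r ℚ.* (r ℚ.* ⌜ suc n ⌝)))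
      ≡⟨ cong (λ t → ⌜ 14 ⌝ ℚ.* (½ ^ℚ i ℚ.* (r ℚ.* t))) (recipℕ-inverse n) ⟩
    ⌜ 14 ⌝ ℚ.* (½ ^ℚ i ℚ.* (r ℚ.* 1ℚ))
      ≤⟨ scale (0≤⌜⌝ 14) (scale h≥0 r≤gⁱ) ⟩
    ⌜ 14 ⌝ ℚ.* (½ ^ℚ i ℚ.* g ^ℚ i) ∎
    where
    r = recipℕ n
    w = ⌜ suc n ⌝ ℚ.* ½ ^ℚ i
    r≥0 = ℚₚ.<⇒≤ (recipℕ>0 n)
    rr≥0 = 0≤* r≥0 r≥0
    h≥0 = 0≤^ i (ℚₚ.nonNegative⁻¹ ½)
    scale : ∀ {c p q} → 0ℚ ℚ.≤ c → p ℚ.≤ q → c ℚ.* p ℚ.≤ c ℚ.* q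
    scale {c} c≥0 = ℚₚ.*-monoˡ-≤-nonNeg c {{ℚ.nonNegative c≥0}}
    1≤w : 1ℚ ℚ.≤ w
    1≤w = begin
      1ℚ                                 ≡⟨ ^-inverse ⌜ 2 ⌝ ½ i refl ⟨
      ⌜ 2 ⌝ ^ℚ i ℚ.* ½ ^ℚ i              ≡⟨ cong (ℚ._* ½ ^ℚ i) (⌜⌝-^ 2 i) ⟨
      ⌜ 2 ℕ.^ i ⌝ ℚ.* ½ ^ℚ i             ≤⟨ ℚₚ.*-monoʳ-≤-nonNeg (½ ^ℚ i) {{ℚ.nonNegative h≥0}}
                                              (⌜⌝-mono (ℕₚ.≤-trans (ℕₚ.^-monoˡ-≤ i 2≤Q) Qⁱ≤n)) ⟩
      ⌜ suc n ⌝ ℚ.* ½ ^ℚ i               ∎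
      where
      2≤Q : 2 ℕ.≤ 2 ℕ.^ suc d
      2≤Q = ℕₚ.*-monoʳ-≤ 2 (ℕₚ.m^n>0 2 d)
    r≤gⁱ : r ℚ.* 1ℚ ℚ.≤ g ^ℚ i
    r≤gⁱ = begin
      r ℚ.* 1ℚ                                              ≡⟨ cong (r ℚ.*_) (^-inverse g ⌜ 2 ℕ.^ suc d ⌝ i gQ≡1) ⟨
      r ℚ.* (g ^ℚ i ℚ.* ⌜ 2 ℕ.^ suc d ⌝ ^ℚ i)               ≡⟨ cong (λ t → r ℚ.* (g ^ℚ i ℚ.* t)) (⌜⌝-^ (2 ℕ.^ suc d) i) ⟨
      r ℚ.* (g ^ℚ i ℚ.* ⌜ (2 ℕ.^ suc d) ℕ.^ i ⌝)            ≤⟨ scale r≥0 (scale (0≤^ i g≥0) (⌜⌝-mono Qⁱ≤n)) ⟩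
      r ℚ.* (g ^ℚ i ℚ.* ⌜ suc n ⌝)                          ≡⟨ solve 3 (λ r g k → r :* (g :* k) := g :* (r :* k)) refl r (g ^ℚ i) ⌜ suc n ⌝ ⟩
      g ^ℚ i ℚ.* (r ℚ.* ⌜ suc n ⌝)                          ≡⟨ cong (g ^ℚ i ℚ.*_) (recipℕ-inverse n) ⟩
      g ^ℚ i ℚ.* 1ℚ                                         ≡⟨ ℚₚ.*-identityʳ (g ^ℚ i) ⟩
      g ^ℚ i                                                ∎

-- The number π and the values of cot and coth

πᵣ#0 : πᵣ #ᵣ 0ᵣ
-- The empty partial sum is 0, so the bound starts at index 1. From there the partial sums are at
-- least 4 - 4/3, as the alternating remainder is at most its first term.
πᵣ#0 = apart 1ℚ 0<1 1 λ { (suc n) _ → Apartness.1≤⇒1≤∣-0∣ (≥1 n) }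
  where
  open Leibniz
  open Alternating leibnizTerm term-nonneg term-anti renaming (tail to alternatingTail)
  open ℚₚ.≤-Reasoning
  open +-*-Solver
  ≥1 : ∀ n → 1ℚ ℚ.≤ alternatingSum leibnizTerm (suc n)
  ≥1 n = begin
    1ℚ                                                ≤⟨ ℚₚ.≤ᵇ⇒≤ _ ⟩
    leibnizTerm 0 ℚ.- leibnizTerm 1                   ≤⟨ ℚₚ.+-monoʳ-≤ (leibnizTerm 0) (ℚₚ.neg-antimono-≤ (proj₂ (tail-bounds n 1))) ⟩
    alternatingTail (suc n) 0                         ≡⟨ solve 1 (λ t → t := con 0ℚ :+ con 1ℚ :* t) refl (alternatingTail (suc n) 0) ⟩
    0ℚ ℚ.+ 1ℚ ℚ.* alternatingTail (suc n) 0           ≡⟨ sum-tail (suc n) 0 ⟨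
    alternatingSum leibnizTerm (suc n ℕ.+ 0)          ≡⟨ cong (λ k → alternatingSum leibnizTerm (suc k)) (ℕₚ.+-identityʳ n) ⟩
    alternatingSum leibnizTerm (suc n)                ∎

abstract
  π⁻¹ : ℂ
  π⁻¹ = real (recip πᵣ πᵣ#0)

  π-inverse : π * π⁻¹ ≋ nat 1
  π-inverse = recip-inverse πᵣ πᵣ#0

𝕚² : 𝕚 * 𝕚 ≋ - nat 1
𝕚² = pointwise (λ _ → refl) (λ _ → refl)

sums-- : ∀ {f g S T} → Sums f S → Sums g T → Sums (λ n → f n - g n) (S - T)
sums-- {f} {g} {S} {T} f→S g→T = sums-cong {λ n → f n + (- nat 1) * g n} {λ n → f n - g n}
  (λ n → solve 2 (λ a b → a :+ (:- con 1ℚ) :* b := a :- b) ≋-refl (f n) (g n))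
  (solve 2 (λ a b → a :+ (:- con 1ℚ) :* b := a :- b) ≋-refl S T)
  (sums-+ {f} {λ n → (- nat 1) * g n} {S} {(- nat 1) * T} f→S (sums-scale (- nat 1) {g} {T} g→T))
  where open ℂ-Solver

isCot : ∀ {A : ℤ → ℂ} {z s s⁻¹ S : ℂ} (P : ℕ → ℂ) → π * s ≋ z → s * s⁻¹ ≋ nat 1 →
  (∀ k → (nat (suc k) ^ 2 - s ^ 2) * P k ≋ nat 1) → Sums (λ k → A (+ suc k) * P k) S →
  IsCot A z (π⁻¹ * (A (+ 0) * s⁻¹ - nat 2 * s * S))
isCot {A} {z} {s} {s⁻¹} {S} P πs≋z s-inv P-inv P→S =
    s , ≋⇒≈ πs≋z , s#0 , k²-s²#0 , S
  , sums⇒HasSum (sums-cong {λ k → A (+ suc k) * P k} {λ k → A (+ suc k) ÷ (nat (suc k) ^ 2 - s ^ 2) [ k²-s²#0 k ]}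
      (λ k → ≋-sym (÷-inverse (A (+ suc k)) (k²-s²#0 k) (P-inv k))) ≋-refl P→S)
  , ≋⇒≈ (begin
      π * (π⁻¹ * V)                                        ≈⟨ *-assoc π π⁻¹ V ⟨
      π * π⁻¹ * V                                          ≈⟨ *-cong π-inverse ≋-refl ⟩
      nat 1 * V                                            ≈⟨ *-identityˡ V ⟩
      A (+ 0) * s⁻¹ - nat 2 * s * S                        ≈⟨ +-cong (÷-inverse (A (+ 0)) s#0 s-inv) ≋-refl ⟨
      A (+ 0) ÷ s [ s#0 ] - nat 2 * s * S                  ∎)
  where
  open ≋-Reasoning
  V = A (+ 0) * s⁻¹ - nat 2 * s * S
  s#0 = inverse⇒#0 s-inv
  k²-s²#0 : ∀ k → nat (suc k) ^ 2 - s ^ 2 #0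
  k²-s²#0 k = inverse⇒#0 (P-inv k)

-- With 𝕚 s in place of s, k² - s² becomes k² + s², and the inverse becomes -𝕚 s⁻¹. The outer factor
-- 𝕚 then makes the polar term positive again and reverses the sign of the series.
isCoth : ∀ {A : ℤ → ℂ} {z s s⁻¹ S : ℂ} (P : ℕ → ℂ) → π * s ≋ z → s * s⁻¹ ≋ nat 1 →
  (∀ k → (nat (suc k) ^ 2 + s ^ 2) * P k ≋ nat 1) → Sums (λ k → A (+ suc k) * P k) S →
  IsCoth A z (π⁻¹ * (A (+ 0) * s⁻¹ + nat 2 * s * S))
isCoth {A} {z} {s} {s⁻¹} {S} P πs≋z s-inv P-inv P→S =
    𝕚-value , isCot {A} {𝕚 * z} {𝕚 * s} {(- 𝕚) * s⁻¹} {S} P πs-inv is-inv k²-inv P→S , ≋⇒≈ value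
  where
  open ≋-Reasoning
  open ℂ-Solver

  πs-inv : π * (𝕚 * s) ≋ 𝕚 * z
  πs-inv = ≋-trans (solve 3 (λ π i s → π :* (i :* s) := i :* (π :* s)) ≋-refl π 𝕚 s) (*-congˡ πs≋z)

  is-inv : 𝕚 * s * ((- 𝕚) * s⁻¹) ≋ nat 1
  is-inv = begin
    𝕚 * s * ((- 𝕚) * s⁻¹)          ≈⟨ solve 3 (λ i s t → i :* s :* ((:- i) :* t) := (:- (i :* i)) :* (s :* t)) ≋-refl 𝕚 s s⁻¹ ⟩
    (- (𝕚 * 𝕚)) * (s * s⁻¹)        ≈⟨ *-cong (neg-cong 𝕚²) s-inv ⟩
    (- (- nat 1)) * nat 1          ≈⟨ solve 0 ((:- (:- con 1ℚ)) :* con 1ℚ := con 1ℚ) ≋-refl ⟩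
    nat 1                          ∎

  k²-inv : ∀ k → (nat (suc k) ^ 2 - (𝕚 * s) ^ 2) * P k ≋ nat 1
  k²-inv k = begin
    (nat (suc k) ^ 2 - (𝕚 * s) ^ 2) * P k
      ≈⟨ solve 4 (λ n i s p → (n :* (n :* con 1ℚ) :- i :* s :* (i :* s :* con 1ℚ)) :* p
           := (n :* n :- i :* i :* (s :* s)) :* p) ≋-refl (nat (suc k)) 𝕚 s (P k) ⟩
    (nat (suc k) * nat (suc k) - 𝕚 * 𝕚 * (s * s)) * P k
      ≈⟨ *-cong (+-cong ≋-refl (neg-cong (*-cong 𝕚² ≋-refl))) ≋-refl ⟩
    (nat (suc k) * nat (suc k) - (- nat 1) * (s * s)) * P k
      ≈⟨ solve 3 (λ n s p → (n :* n :- (:- con 1ℚ) :* (s :* s)) :* p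
           := (n :* (n :* con 1ℚ) :+ s :* (s :* con 1ℚ)) :* p) ≋-refl (nat (suc k)) s (P k) ⟩
    (nat (suc k) ^ 2 + s ^ 2) * P k
      ≈⟨ P-inv k ⟩
    nat 1 ∎

  𝕚-value : ℂ
  𝕚-value = π⁻¹ * (A (+ 0) * ((- 𝕚) * s⁻¹) - nat 2 * (𝕚 * s) * S)

  value : π⁻¹ * (A (+ 0) * s⁻¹ + nat 2 * s * S) ≋ 𝕚 * 𝕚-value
  value = begin
    π⁻¹ * (A (+ 0) * s⁻¹ + nat 2 * s * S)
      ≈⟨ solve 1 (λ v → v := (:- (:- con 1ℚ)) :* v) ≋-refl (π⁻¹ * (A (+ 0) * s⁻¹ + nat 2 * s * S)) ⟩
    (- (- nat 1)) * (π⁻¹ * (A (+ 0) * s⁻¹ + nat 2 * s * S))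
      ≈⟨ *-cong (neg-cong 𝕚²) ≋-refl ⟨
    (- (𝕚 * 𝕚)) * (π⁻¹ * (A (+ 0) * s⁻¹ + nat 2 * s * S))
      ≈⟨ solve 7 (λ i ι a t n s S → (:- (i :* i)) :* (ι :* (a :* t :+ n :* s :* S))
           := i :* (ι :* (a :* ((:- i) :* t) :- n :* (i :* s) :* S))) ≋-refl 𝕚 π⁻¹ (A (+ 0)) s⁻¹ (nat 2) s S ⟩
    𝕚 * 𝕚-value ∎

-- Reciprocals of n² - x² and n² + y²

eventual-majorant : ∀ {f : ℕ → ℂ} {v : ℕ → ℚ} → Eventually (λ n → f n ≺ v n) →
  ∃[ u ] (∀ n → f n ≺ u n) × Eventually (λ n → u n ℚ.≤ v n)
eventual-majorant {f} {v} (N , f≺v) =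
  (λ n → proj₁ (choose n)) , (λ n → proj₁ (proj₂ (choose n))) , N , λ n → proj₂ (proj₂ (choose n))
  where
  choose : ∀ n → ∃[ q ] f n ≺ q × (N ℕ.≤ n → q ℚ.≤ v n)
  choose n with N ℕₚ.≤? n
  ... | yes N≤n = v n , f≺v n N≤n , λ _ → ℚₚ.≤-refl
  -- Partial sums begin at index 0, so the finitely many early terms need bounds too; any bound will
  -- do.
  ... | no  N≰n = let q , _ , f≺q = ≺-bounded (f n) in q , f≺q , λ N≤n → contradiction N≤n N≰n

real-* : ∀ x y → real (x *ᵣ y) ≋ real x * real y
real-* x y = pointwise
  (λ n → solve 2 (λ a b → a :* b := a :* b :- con 0ℚ :* con 0ℚ) refl (seq x n) (seq y n))
  (λ n → solve 2 (λ a b → con 0ℚ := a :* con 0ℚ :+ con 0ℚ :* b) refl (seq x n) (seq y n))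
  where open +-*-Solver

real-+ : ∀ x y → real (x +ᵣ y) ≋ real x + real y
real-+ x y = pointwise (λ _ → refl) (λ _ → refl)

real-² : ∀ x → real (x ^ᵣ 2) ≋ real x ^ 2
real-² x = ≋-trans (real-* x (x ^ᵣ 1)) (*-congˡ (real-* x 1ᵣ))

real-neg : ∀ x → real (-ᵣ x) ≋ - real x
real-neg x = pointwise (λ _ → refl) (λ _ → refl)

cofactor-inverse : ∀ {a b w} (ab#0 : (a *ᵣ b) #ᵣ 0ᵣ) → real b ≋ w →
  w * (real a * real (recip (a *ᵣ b) ab#0)) ≋ nat 1
cofactor-inverse {a} {b} {w} ab#0 b≋w = begin
  w * (real a * r)        ≈⟨ *-cong b≋w ≋-refl ⟨
  real b * (real a * r)   ≈⟨ solve 3 (λ a b r → b :* (a :* r) := a :* b :* r) ≋-refl (real a) (real b) r ⟩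
  real a * real b * r     ≈⟨ *-cong (real-* a b) ≋-refl ⟨
  real (a *ᵣ b) * r       ≈⟨ recip-inverse (a *ᵣ b) ab#0 ⟩
  nat 1                   ∎
  where
  open ≋-Reasoning
  open ℂ-Solver
  r = real (recip (a *ᵣ b) ab#0)

n⁻¹ : ℕ → ℂ
n⁻¹ n = real (ratᵣ (recipℕ n))

n-inverse : ∀ n → nat (suc n) * n⁻¹ n ≋ nat 1
n-inverse n = ≋-trans (≋-sym (real-* (natᵣ (suc n)) (ratᵣ (recipℕ n))))
  (pointwise (λ _ → trans (ℚₚ.*-comm ⌜ suc n ⌝ (recipℕ n)) (recipℕ-inverse n)) (λ _ → refl))

n⁻¹-≺ : ∀ n → n⁻¹ n ≺ recipℕ n
n⁻¹-≺ n = bound (always λ _ → ℚₚ.≤-reflexive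
  (trans (ℚₚ.+-identityʳ ℚ.∣ recipℕ n ∣) (ℚₚ.0≤p⇒∣p∣≡p (ℚₚ.<⇒≤ (recipℕ>0 n)))))

recipℕ²-inverse : ∀ n → recipℕ n ℚ.* recipℕ n ℚ.* (⌜ suc n ⌝ ℚ.* ⌜ suc n ⌝) ≡ 1ℚ
recipℕ²-inverse n = trans
  (solve 2 (λ r c → r :* r :* (c :* c) := r :* c :* (r :* c)) refl (recipℕ n) ⌜ suc n ⌝)
  (cong₂ ℚ._*_ (recipℕ-inverse n) (recipℕ-inverse n))
  where open +-*-Solver

recipℕ²>0 : ∀ n → 0ℚ ℚ.< recipℕ n ℚ.* recipℕ n
recipℕ²>0 n = pos* (recipℕ>0 n) (recipℕ>0 n)

-- 1/(n² + y²) is n times the reciprocal of n (n² + y²), the only one whose apartness is in Defs.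
recip⁺ : ℝ → ℕ → ℂ
recip⁺ y n = nat (suc n) * real (recip _ (n[n²+y²]#0 y n))

recip⁺-inverse : ∀ y n → (nat (suc n) ^ 2 + real y ^ 2) * recip⁺ y n ≋ nat 1
recip⁺-inverse y n = cofactor-inverse (n[n²+y²]#0 y n)
  (≋-trans (real-+ (natᵣ (suc n) ^ᵣ 2) (y ^ᵣ 2)) (+-cong (real-² (natᵣ (suc n))) (real-² y)))

-- Dropping y² makes the bound independent of y, hence uniform over all the arguments `ny/x` and
-- `nx/y` of the inner series.
recip⁺-≺ : ∀ y n → recip⁺ y n ≺ recipℕ n ℚ.* recipℕ n ℚ.+ recipℕ n ℚ.* recipℕ n
recip⁺-≺ y n = inverse-≺ {natᵣ (suc n) ^ᵣ 2 +ᵣ y ^ᵣ 2} (recipℕ²>0 n) (recipℕ²-inverse n)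
  (always λ j → begin
    ⌜ suc n ⌝ ℚ.* ⌜ suc n ⌝
      ≤⟨ p≤p+q (⌜ suc n ⌝ ℚ.* ⌜ suc n ⌝) (Apartness.0≤q*q (seq y j)) ⟩
    ⌜ suc n ⌝ ℚ.* ⌜ suc n ⌝ ℚ.+ seq y j ℚ.* seq y j
      ≡⟨ solve 2 (λ c y → c :* c :+ y :* y := c :* (c :* con 1ℚ) :+ y :* (y :* con 1ℚ)) refl ⌜ suc n ⌝ (seq y j) ⟩
    seq (natᵣ (suc n) ^ᵣ 2 +ᵣ y ^ᵣ 2) j ∎)
  (cofactor-inverse (n[n²+y²]#0 y n) ≋-refl)
  where
  open ℚₚ.≤-Reasoning
  open +-*-Solver

module NonInteger (x : ℝ) (x∉ℤ : ∀ k → x #ᵣ intᵣ k) where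

  recip⁻ : ℕ → ℂ
  recip⁻ n = nat (suc n) * real (recip _ (n[n²-x²]#0 x x∉ℤ n))

  recip⁻-inverse : ∀ n → (nat (suc n) ^ 2 - real x ^ 2) * recip⁻ n ≋ nat 1
  recip⁻-inverse n = cofactor-inverse (n[n²-x²]#0 x x∉ℤ n)
    (≋-trans (real-+ (natᵣ (suc n) ^ᵣ 2) (-ᵣ (x ^ᵣ 2)))
      (+-cong (real-² (natᵣ (suc n))) (≋-trans (real-neg (x ^ᵣ 2)) (neg-cong (real-² x)))))

  -- Once n is at least 2x², the denominator n² - x² is at least n²/2.
  recip⁻-≺ : Eventually (λ n → recip⁻ n ≺ ⌜ 4 ⌝ ℚ.* (recipℕ n ℚ.* recipℕ n))
  recip⁻-≺ =
    let B , B>0 , x≤B = Bounded.bounded x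
        N , 2B²≤N = archimedean (B ℚ.* B ℚ.+ B ℚ.* B)
    in N , λ n N≤n → subst (recip⁻ n ≺_)
      -- The constant 4 combines the halved denominator with the factor 2 of `inverse-≺`.
      (solve 1 (λ r → r :+ r :+ (r :+ r) := con ⌜ 4 ⌝ :* r) refl (recipℕ n ℚ.* recipℕ n))
      (inverse-≺ {natᵣ (suc n) ^ᵣ 2 -ᵣ x ^ᵣ 2} {recip⁻ n} {½ ℚ.* (⌜ suc n ⌝ ℚ.* ⌜ suc n ⌝)}
        (0<+ (recipℕ²>0 n) (recipℕ²>0 n))
        (trans (solve 2 (λ r c → (r :+ r) :* (con ½ :* c) := r :* c) refl
          (recipℕ n ℚ.* recipℕ n) (⌜ suc n ⌝ ℚ.* ⌜ suc n ⌝)) (recipℕ²-inverse n))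
        (ev-map (λ j → large B n (ℚₚ.<⇒≤ B>0)
          (ℚₚ.≤-trans 2B²≤N (⌜⌝-mono {N} {suc n} (ℕₚ.m≤n⇒m≤1+n N≤n))) j) x≤B)
        (cofactor-inverse (n[n²-x²]#0 x x∉ℤ n) ≋-refl))
    where
    open ℚₚ.≤-Reasoning
    open +-*-Solver
    large : ∀ B n → 0ℚ ℚ.≤ B → B ℚ.* B ℚ.+ B ℚ.* B ℚ.≤ ⌜ suc n ⌝ → ∀ j → ℚ.∣ seq x j ∣ ℚ.≤ B →
      ½ ℚ.* (⌜ suc n ⌝ ℚ.* ⌜ suc n ⌝) ℚ.≤ seq (natᵣ (suc n) ^ᵣ 2 -ᵣ x ^ᵣ 2) j
    large B n B≥0 2B²≤n j x≤B = begin
      ½ ℚ.* (c ℚ.* c)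
        ≡⟨ solve 2 (λ c b → con ½ :* (c :* c) := c :* c :- con ½ :* (b :+ b) :+ (b :- con ½ :* (c :* c))) refl c (B ℚ.* B) ⟩
      c ℚ.* c ℚ.- ½ ℚ.* (B ℚ.* B ℚ.+ B ℚ.* B) ℚ.+ (B ℚ.* B ℚ.- ½ ℚ.* (c ℚ.* c))
        ≤⟨ ℚₚ.+-monoʳ-≤ (c ℚ.* c ℚ.- ½ ℚ.* (B ℚ.* B ℚ.+ B ℚ.* B)) B²≤½c² ⟩
      c ℚ.* c ℚ.- ½ ℚ.* (B ℚ.* B ℚ.+ B ℚ.* B) ℚ.+ 0ℚ
        ≡⟨ solve 2 (λ c b → c :* c :- con ½ :* (b :+ b) :+ con 0ℚ := c :* c :- b) refl c (B ℚ.* B) ⟩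
      c ℚ.* c ℚ.- B ℚ.* B
        ≤⟨ ℚₚ.+-monoʳ-≤ (c ℚ.* c) (ℚₚ.neg-antimono-≤ (*-mono 0≤∣ seq x j ∣ B≥0 x≤B x≤B)) ⟩
      c ℚ.* c ℚ.- ℚ.∣ seq x j ∣ ℚ.* ℚ.∣ seq x j ∣
        ≡⟨ cong (λ t → c ℚ.* c ℚ.- t) (∣p∣*∣p∣ (seq x j)) ⟩
      c ℚ.* c ℚ.- seq x j ℚ.* seq x j
        ≡⟨ solve 2 (λ c x → c :* c :- x :* x := c :* (c :* con 1ℚ) :- x :* (x :* con 1ℚ)) refl c (seq x j) ⟩
      seq (natᵣ (suc n) ^ᵣ 2 -ᵣ x ^ᵣ 2) j ∎
      where
      c = ⌜ suc n ⌝
      B²≤½c² : B ℚ.* B ℚ.- ½ ℚ.* (c ℚ.* c) ℚ.≤ 0ℚ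
      B²≤½c² = begin
        B ℚ.* B ℚ.- ½ ℚ.* (c ℚ.* c)
          ≡⟨ solve 2 (λ b c → b :- con ½ :* (c :* c) := con ½ :* (b :+ b) :- con ½ :* (c :* c)) refl (B ℚ.* B) c ⟩
        ½ ℚ.* (B ℚ.* B ℚ.+ B ℚ.* B) ℚ.- ½ ℚ.* (c ℚ.* c)
          ≤⟨ ℚₚ.+-monoˡ-≤ (ℚ.- (½ ℚ.* (c ℚ.* c))) (ℚₚ.*-monoˡ-≤-nonNeg ½ (begin
               B ℚ.* B ℚ.+ B ℚ.* B   ≤⟨ 2B²≤n ⟩
               c                     ≡⟨ ℚₚ.*-identityʳ c ⟨
               c ℚ.* 1ℚ              ≤⟨ ℚₚ.*-monoˡ-≤-nonNeg c {{ℚ.nonNegative (0≤⌜⌝ (suc n))}} (Apartness.1≤nat n) ⟩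
               c ℚ.* c               ∎)) ⟩
        ½ ℚ.* (c ℚ.* c) ℚ.- ½ ℚ.* (c ℚ.* c)
          ≡⟨ ℚₚ.+-inverseʳ (½ ℚ.* (c ℚ.* c)) ⟩
        0ℚ ∎

scaled : (u v : ℝ) → v #ᵣ 0ᵣ → ℕ → ℝ
scaled u v v#0 n = natᵣ (suc n) *ᵣ u *ᵣ recip v v#0

real-scaled : ∀ u v v#0 n → real (scaled u v v#0 n) ≋ nat (suc n) * real u * real (recip v v#0)
real-scaled u v v#0 n = ≋-trans (real-* (natᵣ (suc n) *ᵣ u) (recip v v#0)) (*-cong (real-* (natᵣ (suc n)) u) ≋-refl)

scaled-inverse : ∀ u v u#0 v#0 n → real (scaled u v v#0 n) * (n⁻¹ n * real (recip u u#0) * real v) ≋ nat 1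
scaled-inverse u v u#0 v#0 n = ≋-trans (*-cong (real-scaled u v v#0 n) ≋-refl)
  (product-inverse (product-inverse (n-inverse n) (recip-inverse u u#0))
    (≋-trans (*-comm (real (recip v v#0)) (real v)) (recip-inverse v v#0)))
  where open ℂ-Solver

π-scaled : ∀ u v v#0 n → π * real (scaled u v v#0 n) ≋ real ((πᵣ *ᵣ natᵣ (suc n) *ᵣ u) ÷ᵣ v [ v#0 ])
π-scaled u v v#0 n = ≋-trans (≋-sym (real-* πᵣ (scaled u v v#0 n)))
  (pointwise (λ j → solve 4 (λ p n u r → p :* (n :* u :* r) := p :* n :* u :* r) refl
      (seq πᵣ j) ⌜ suc n ⌝ (seq u j) (seq (recip v v#0) j))
    (λ _ → refl))
  where open +-*-Solver

-- The series attached to one sequence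

module Coefficients (A : ℤ → ℂ) (growth : SublinearGrowth A) where

  a : ℕ → ℂ
  a n = A (+ suc n)

  α : ℕ → ℚ
  α = proj₁ (majorant {A} growth)

  a≺α : ∀ n → a n ≺ α n
  a≺α = proj₁ (proj₂ (majorant {A} growth))

  α-summable : Summable (λ n → recipℕ n ℚ.* recipℕ n ℚ.* α n)
  α-summable = proj₂ (proj₂ (majorant {A} growth))

  open +-*-Solver

  dominated : ∀ c → 0ℚ ℚ.< c → ∀ {u} → Eventually (λ n → u n ℚ.≤ α n ℚ.* (c ℚ.* (recipℕ n ℚ.* recipℕ n))) → Summable u
  dominated c c>0 {u} u≤ = summable-dominated {u} c c>0 α-summable (ev-map
    (λ n → subst (u n ℚ.≤_) (solve 3 (λ a c r → a :* (c :* r) := c :* (r :* a)) refl (α n) c (recipℕ n ℚ.* recipℕ n)))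
    u≤)

  2α : ℕ → ℚ
  2α n = α n ℚ.* (recipℕ n ℚ.* recipℕ n ℚ.+ recipℕ n ℚ.* recipℕ n)

  2α-summable : Summable 2α
  2α-summable = dominated ⌜ 2 ⌝ (0<⌜suc⌝ 1) (always λ n → ℚₚ.≤-reflexive
    (cong (α n ℚ.*_) (solve 1 (λ r → r :+ r := con ⌜ 2 ⌝ :* r) refl (recipℕ n ℚ.* recipℕ n))))

  aq≺2α : ∀ y n → a n * recip⁺ y n ≺ 2α n
  aq≺2α y n = ≺-* (a≺α n) (recip⁺-≺ y n)

  q-sum : ∀ y → ∃[ S ] Sums (λ n → a n * recip⁺ y n) S
  q-sum y = sums-exists (aq≺2α y) 2α-summable

  dirichlet : ∃[ S ] Sums (λ n → a n * (n⁻¹ n * n⁻¹ n)) S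
  dirichlet = sums-exists {u = λ n → α n ℚ.* (recipℕ n ℚ.* recipℕ n)}
    (λ n → ≺-* (a≺α n) (≺-* (n⁻¹-≺ n) (n⁻¹-≺ n)))
    (dominated 1ℚ 0<1 (always λ n → ℚₚ.≤-reflexive
      (cong (α n ℚ.*_) (sym (ℚₚ.*-identityˡ (recipℕ n ℚ.* recipℕ n))))))

  isD : IsD A 2 (proj₁ dirichlet)
  isD = sums⇒HasSum (sums-cong {λ n → a n * (n⁻¹ n * n⁻¹ n)}
    {λ n → a n ÷ real (natᵣ (suc n) ^ᵣ 2) [ real#0 (natᵣ (suc n) ^ᵣ 2) (pow#0 n 2) ]}
    (λ n → ≋-sym (÷-inverse (a n) (real#0 (natᵣ (suc n) ^ᵣ 2) (pow#0 n 2)) (square-inverse n))) ≋-refl (proj₂ dirichlet))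
    where
    square-inverse : ∀ n → real (natᵣ (suc n) ^ᵣ 2) * (n⁻¹ n * n⁻¹ n) ≋ nat 1
    square-inverse n = ≋-trans (*-cong (≋-trans (real-² (natᵣ (suc n)))
        (*-congˡ (ℂ-Ring.*-identityʳ (nat (suc n))))) ≋-refl)
      (ℂ-Solver.product-inverse (n-inverse n) (n-inverse n))

  isCoth-real : ∀ {z} y y⁻¹ → π * real y ≋ z → real y * y⁻¹ ≋ nat 1 →
    IsCoth A z (π⁻¹ * (A (+ 0) * y⁻¹ + nat 2 * real y * proj₁ (q-sum y)))
  isCoth-real y y⁻¹ πy≋z y-inv = isCoth {A} (recip⁺ y) πy≋z y-inv (recip⁺-inverse y) (proj₂ (q-sum y))

  module _ (x : ℝ) (x∉ℤ : ∀ k → x #ᵣ intᵣ k) where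
    open NonInteger x x∉ℤ

    p-majorant : ∃[ u ] (∀ n → a n * recip⁻ n ≺ u n) ×
      Eventually (λ n → u n ℚ.≤ α n ℚ.* (⌜ 4 ⌝ ℚ.* (recipℕ n ℚ.* recipℕ n)))
    p-majorant = eventual-majorant {λ n → a n * recip⁻ n} (ev-map (λ n → ≺-* (a≺α n)) recip⁻-≺)

    p-majorant-summable : Summable (proj₁ p-majorant)
    p-majorant-summable = dominated ⌜ 4 ⌝ (0<⌜suc⌝ 3) (proj₂ (proj₂ p-majorant))

    p-sum : ∃[ S ] Sums (λ n → a n * recip⁻ n) S
    p-sum = sums-exists (proj₁ (proj₂ p-majorant)) p-majorant-summable

-- The product formula

module Product (A B : ℤ → ℂ) (A-growth : SublinearGrowth A) (B-growth : SublinearGrowth B)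
  (x y : ℝ) (x#0 : x #ᵣ 0ᵣ) (y#0 : y #ᵣ 0ᵣ) (x∉ℤ : ∀ k → x #ᵣ intᵣ k) where

  module 𝔸 = Coefficients A A-growth
  module 𝔹 = Coefficients B B-growth
  open 𝔸 using (a)
  open 𝔹 using () renaming (a to b)
  open NonInteger x x∉ℤ

  x⁻¹ y⁻¹ : ℂ
  x⁻¹ = real (recip x x#0)
  y⁻¹ = real (recip y y#0)

  x-inverse : real x * x⁻¹ ≋ nat 1
  x-inverse = recip-inverse x x#0

  y-inverse : real y * y⁻¹ ≋ nat 1
  y-inverse = recip-inverse y y#0

  ny/x nx/y : ℕ → ℝ
  ny/x = scaled y x x#0
  nx/y = scaled x y y#0

  a₀ b₀ SA SB DA DB : ℂ
  a₀ = A (+ 0)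
  b₀ = B (+ 0)
  SA = proj₁ (𝔸.p-sum x x∉ℤ)
  SB = proj₁ (𝔹.q-sum y)
  DA = proj₁ 𝔸.dirichlet
  DB = proj₁ 𝔹.dirichlet

  -- `HA n` and `HB n` are the values coth(π n x / y; A) and coth(π n y / x; B), and `SAₙ n` and
  -- `SBₙ n` are the series inside them.
  SAₙ SBₙ HA HB : ℕ → ℂ
  SAₙ n = proj₁ (𝔸.q-sum (nx/y n))
  SBₙ n = proj₁ (𝔹.q-sum (ny/x n))
  HA n = π⁻¹ * (a₀ * (n⁻¹ n * x⁻¹ * real y) + nat 2 * real (nx/y n) * SAₙ n)
  HB n = π⁻¹ * (b₀ * (n⁻¹ n * y⁻¹ * real x) + nat 2 * real (ny/x n) * SBₙ n)

  -- `split`, weighted by a_n b_m: the inner sums over m are the series of coth( · ; B), those over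
  -- n the series of coth( · ; A).
  double-series : Sums (λ n → a n * recip⁻ n * SBₙ n + b n * recip⁺ y n * SAₙ n) (SA * SB)
  double-series = DoubleSeries.sums-product {λ n → a n * recip⁻ n} {λ n → b n * recip⁺ y n} {SA} {SB}
    (proj₁ (proj₂ (𝔸.p-majorant x x∉ℤ))) (𝔸.p-majorant-summable x x∉ℤ) (proj₂ (𝔸.p-sum x x∉ℤ))
    (𝔹.aq≺2α y) 𝔹.2α-summable (proj₂ (𝔹.q-sum y))
    {λ n m → b m * recip⁺ (ny/x n) m} {λ m n → a n * recip⁺ (nx/y m) n} {SBₙ} {SAₙ}
    (λ n → 𝔹.aq≺2α (ny/x n)) 𝔹.2α-summable (λ n → proj₂ (𝔹.q-sum (ny/x n)))
    (λ m → 𝔸.aq≺2α (nx/y m)) 𝔸.2α-summable (λ m → proj₂ (𝔸.q-sum (nx/y m)))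
    splits
    where
    open ≋-Reasoning
    open ℂ-Solver using (solve; _:=_; _:*_; _:+_)
    splits : ∀ n m → a n * recip⁻ n * (b m * recip⁺ (ny/x n) m) + b m * recip⁺ y m * (a n * recip⁺ (nx/y m) n) ≋ a n * recip⁻ n * (b m * recip⁺ y m)
    splits n m = begin
      a n * recip⁻ n * (b m * recip⁺ (ny/x n) m) + b m * recip⁺ y m * (a n * recip⁺ (nx/y m) n)
        ≈⟨ solve 6 (λ a b p q g g′ → a :* p :* (b :* g) :+ b :* q :* (a :* g′) := a :* b :* (p :* g :+ q :* g′)) ≋-refl
             (a n) (b m) (recip⁻ n) (recip⁺ y m) (recip⁺ (ny/x n) m) (recip⁺ (nx/y m) n) ⟩
      a n * b m * (recip⁻ n * recip⁺ (ny/x n) m + recip⁺ y m * recip⁺ (nx/y m) n)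
        ≈⟨ *-congˡ (ℂ-Solver.split x-inverse y-inverse (real-scaled y x x#0 n) (real-scaled x y y#0 m)
             (recip⁻-inverse n) (recip⁺-inverse y m) (recip⁺-inverse (ny/x n) m) (recip⁺-inverse (nx/y m) n)) ⟩
      a n * b m * (recip⁻ n * recip⁺ y m)
        ≈⟨ solve 4 (λ a b p q → a :* b :* (p :* q) := a :* p :* (b :* q)) ≋-refl (a n) (b m) (recip⁻ n) (recip⁺ y m) ⟩
      a n * recip⁻ n * (b m * recip⁺ y m) ∎

  -- `S` is the closed form that `product-formula` calls for; `term-sum` shows that the series
  -- attains it.
  L S : ℂ
  L = b₀ * (real x * real x) * (SA - DA) + a₀ * (real y * real y) * (DB - SB)
        + nat 2 * (real x * real x) * (real y * real y) * (SA * SB)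
  S = π⁻¹ * x⁻¹ * y⁻¹ * L

  term : ℕ → ℂ
  term n = (real x ^ 2 * a n * HB n) ÷ real (natᵣ (suc n) *ᵣ (natᵣ (suc n) ^ᵣ 2 -ᵣ x ^ᵣ 2)) [ real#0 _ (n[n²-x²]#0 x x∉ℤ n) ]
    + (real y ^ 2 * b n * HA n) ÷ real (natᵣ (suc n) *ᵣ (natᵣ (suc n) ^ᵣ 2 +ᵣ y ^ᵣ 2)) [ real#0 _ (n[n²+y²]#0 y n) ]

  reduced : ℕ → ℂ
  reduced n = b₀ * (real x * real x) * (a n * recip⁻ n - a n * (n⁻¹ n * n⁻¹ n))
    + a₀ * (real y * real y) * (b n * (n⁻¹ n * n⁻¹ n) - b n * recip⁺ y n)
    + nat 2 * (real x * real x) * (real y * real y) * (a n * recip⁻ n * SBₙ n + b n * recip⁺ y n * SAₙ n)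

  term≋ : ∀ n → π⁻¹ * x⁻¹ * y⁻¹ * reduced n ≋ term n
  term≋ n = ≋-sym (begin
    term n
      ≈⟨ +-cong (÷-inverse (real x ^ 2 * a n * HB n) (real#0 _ (n[n²-x²]#0 x x∉ℤ n))
                  (≋-trans (*-cong (real-* (natᵣ (suc n)) (natᵣ (suc n) ^ᵣ 2 -ᵣ x ^ᵣ 2)) ≋-refl)
                    (product-inverse (n-inverse n) (cofactor-inverse (n[n²-x²]#0 x x∉ℤ n) ≋-refl))))
                (÷-inverse (real y ^ 2 * b n * HA n) (real#0 _ (n[n²+y²]#0 y n))
                  (≋-trans (*-cong (real-* (natᵣ (suc n)) (natᵣ (suc n) ^ᵣ 2 +ᵣ y ^ᵣ 2)) ≋-refl)
                    (product-inverse (n-inverse n) (cofactor-inverse (n[n²+y²]#0 y n) ≋-refl)))) ⟩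
    real x ^ 2 * a n * HB n * (n⁻¹ n * recip⁻ n) + real y ^ 2 * b n * HA n * (n⁻¹ n * recip⁺ y n)
      ≈⟨ +-cong (*-cong (*-congˡ (*-congˡ (+-cong ≋-refl (*-cong (*-congˡ (real-scaled y x x#0 n)) ≋-refl)))) ≋-refl)
                (*-cong (*-congˡ (*-congˡ (+-cong ≋-refl (*-cong (*-congˡ (real-scaled x y y#0 n)) ≋-refl)))) ≋-refl) ⟩
    real x ^ 2 * a n * (π⁻¹ * (b₀ * (n⁻¹ n * y⁻¹ * real x) + nat 2 * (nat (suc n) * real y * x⁻¹) * SBₙ n)) * (n⁻¹ n * recip⁻ n)
      + real y ^ 2 * b n * (π⁻¹ * (a₀ * (n⁻¹ n * x⁻¹ * real y) + nat 2 * (nat (suc n) * real x * y⁻¹) * SAₙ n)) * (n⁻¹ n * recip⁺ y n)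
      ≈⟨ term-formula π⁻¹ (nat 2) (a n) (b n) a₀ b₀ (SBₙ n) (SAₙ n)
           (n-inverse n) x-inverse y-inverse (recip⁻-inverse n) (recip⁺-inverse y n) ⟩
    π⁻¹ * x⁻¹ * y⁻¹ * reduced n ∎)
    where
    open ≋-Reasoning
    open ℂ-Solver using (term-formula; product-inverse)

  term-sum : Sums term S
  term-sum = sums-cong {λ n → π⁻¹ * x⁻¹ * y⁻¹ * reduced n} {term} term≋ ≋-refl
    (sums-scale (π⁻¹ * x⁻¹ * y⁻¹) {reduced} {L}
      (sums-+ {λ n → b₀ * (real x * real x) * (a n * recip⁻ n - a n * (n⁻¹ n * n⁻¹ n))
                  + a₀ * (real y * real y) * (b n * (n⁻¹ n * n⁻¹ n) - b n * recip⁺ y n)}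
              {λ n → nat 2 * (real x * real x) * (real y * real y) * (a n * recip⁻ n * SBₙ n + b n * recip⁺ y n * SAₙ n)}
              {b₀ * (real x * real x) * (SA - DA) + a₀ * (real y * real y) * (DB - SB)}
              {nat 2 * (real x * real x) * (real y * real y) * (SA * SB)}
        (sums-+ {λ n → b₀ * (real x * real x) * (a n * recip⁻ n - a n * (n⁻¹ n * n⁻¹ n))}
                {λ n → a₀ * (real y * real y) * (b n * (n⁻¹ n * n⁻¹ n) - b n * recip⁺ y n)}
                {b₀ * (real x * real x) * (SA - DA)} {a₀ * (real y * real y) * (DB - SB)}
          (sums-scale (b₀ * (real x * real x)) {λ n → a n * recip⁻ n - a n * (n⁻¹ n * n⁻¹ n)} {SA - DA}
            (sums-- {λ n → a n * recip⁻ n} {λ n → a n * (n⁻¹ n * n⁻¹ n)} {SA} {DA} (proj₂ (𝔸.p-sum x x∉ℤ)) (proj₂ 𝔸.dirichlet)))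
          (sums-scale (a₀ * (real y * real y)) {λ n → b n * (n⁻¹ n * n⁻¹ n) - b n * recip⁺ y n} {DB - SB}
            (sums-- {λ n → b n * (n⁻¹ n * n⁻¹ n)} {λ n → b n * recip⁺ y n} {DB} {SB} (proj₂ 𝔹.dirichlet) (proj₂ (𝔹.q-sum y)))))
        (sums-scale (nat 2 * (real x * real x) * (real y * real y))
          {λ n → a n * recip⁻ n * SBₙ n + b n * recip⁺ y n * SAₙ n} {SA * SB} double-series)))

theorem5p6 : (A B : ℤ → ℂ) → SublinearGrowth A → SublinearGrowth B →
    (x y : ℝ) (x#0 : x #ᵣ 0ᵣ) (y#0 : y #ᵣ 0ᵣ) (x∉ℤ : ∀ k → x #ᵣ intᵣ k) →
    Σ[ cot-πx-A ∈ ℂ ] IsCot A (real (πᵣ *ᵣ x)) cot-πx-A ×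
    Σ[ coth-πy-B ∈ ℂ ] IsCoth B (real (πᵣ *ᵣ y)) coth-πy-B ×
    Σ[ D-A-2 ∈ ℂ ] IsD A 2 D-A-2 ×
    Σ[ D-B-2 ∈ ℂ ] IsD B 2 D-B-2 ×
    Σ[ coth-πny/x-B ∈ (ℕ → ℂ) ]
    (∀ n → IsCoth B (real ((πᵣ *ᵣ natᵣ (suc n) *ᵣ y) ÷ᵣ x [ x#0 ])) (coth-πny/x-B n)) ×
    Σ[ coth-πnx/y-A ∈ (ℕ → ℂ) ]
    (∀ n → IsCoth A (real ((πᵣ *ᵣ natᵣ (suc n) *ᵣ x) ÷ᵣ y [ y#0 ])) (coth-πnx/y-A n)) ×
    Σ[ S ∈ ℂ ]
    HasSum (λ n →
    (real x ^ 2 * A (+ suc n) * coth-πny/x-B n)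
    ÷ real (natᵣ (suc n) *ᵣ (natᵣ (suc n) ^ᵣ 2 -ᵣ x ^ᵣ 2))
    [ real#0 _ (n[n²-x²]#0 x x∉ℤ n) ]
    + (real y ^ 2 * B (+ suc n) * coth-πnx/y-A n)
    ÷ real (natᵣ (suc n) *ᵣ (natᵣ (suc n) ^ᵣ 2 +ᵣ y ^ᵣ 2))
    [ real#0 _ (n[n²+y²]#0 y n) ])
    S ×
    π ^ 2 * real x * real y * cot-πx-A * coth-πy-B
    ≈ A (+ 0) * B (+ 0)
    + nat 2 * A (+ 0) * D-B-2 * real y ^ 2
    - nat 2 * B (+ 0) * D-A-2 * real x ^ 2
    - nat 2 * π * real x * real y * S
theorem5p6 A B A-growth B-growth x y x#0 y#0 x∉ℤ =
    π⁻¹ * (a₀ * x⁻¹ - nat 2 * real x * SA)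
  , isCot {A} {s = real x} recip⁻ (≋-sym (real-* πᵣ x)) x-inverse recip⁻-inverse (proj₂ (𝔸.p-sum x x∉ℤ))
  , π⁻¹ * (b₀ * y⁻¹ + nat 2 * real y * SB)
  , 𝔹.isCoth-real y y⁻¹ (≋-sym (real-* πᵣ y)) y-inverse
  , DA , 𝔸.isD , DB , 𝔹.isD
  , HB , (λ n → 𝔹.isCoth-real (ny/x n) (n⁻¹ n * y⁻¹ * real x) (π-scaled y x x#0 n) (scaled-inverse y x y#0 x#0 n))
  , HA , (λ n → 𝔸.isCoth-real (nx/y n) (n⁻¹ n * x⁻¹ * real y) (π-scaled x y y#0 n) (scaled-inverse x y x#0 y#0 n))
  , S , sums⇒HasSum {term} term-sum
  , ≋⇒≈ (ℂ-Solver.product-formula (nat 2) a₀ b₀ SA SB DA DB π-inverse x-inverse y-inverse)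
  where
  open Product A B A-growth B-growth x y x#0 y#0 x∉ℤ
  open NonInteger x x∉ℤ
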